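{- Let $p$ be a prime and $k\in\mathbb{N}$. Each of the following graphs has integral spectrum (all adjacency eigenvalues are integers): (a) $\Gamma\!\left(k\frac{q^{ta}-1}{q^t-1},\, q^{at}\right)$ for all $a,t\in\mathbb{N}$, where $q=p^k$, provided $k\mid p-1$; (b) $\Gamma\!\left(k\frac{q^{ta}-1}{q^t-1},\, q^{at}\right)$ for all $a,t\in\mathbb{N}$, where $q=p^2$, provided $k\mid p+1$; (c) $\Gamma\!\left(k\frac{q^{ta}-1}{q^t-1},\, q^{at}\right)$ for all $a,t\in\mathbb{N}$, where $q=p^{\varphi(k)}$, provided $\gcd(k,p(p-1))=1$; (d) $\Gamma\!\left(\Phi_d(p)\frac{q^{ta}-1}{q^t-1},\, q^{at}\right)$ for all $a,t\in\mathbb{N}$, where $q=p^d$ and $d>1$.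
   Context: For a prime power $Q$ and $k\in\mathbb{N}$, $R_k=\{x^k:x\in\mathbb{F}_Q^*\}$ and the generalized Paley graph $\Gamma(k,Q)$ has vertex set $\mathbb{F}_Q$ and an arc $x\to y$ iff $y-x\in R_k$. $\varphi$ is Euler's totient function and $\Phi_d(x)=\prod_{\omega}(x-\omega)$ is the $d$-th cyclotomic polynomial, the product over the primitive complex $d$-th roots of unity. -}

module Defs where

open import Level using (0ℓ)
open import Data.Nat as ℕ using (ℕ; zero; suc; NonZero)
open import Data.Nat.DivMod using (_/_)
open import Data.Nat.GCD using (gcd)
open import Data.Nat.Divisibility using (_∣_; _∣?_)
open import Data.Integer as ℤ using (ℤ; +_)
open import Data.Fin as Fin using (Fin; punchIn; toℕ)
open import Data.List using (List; []; _∷_; map; lookup; length)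
open import Data.Product using (Σ; ∃; _×_; _,_)
open import Data.Sum using (_⊎_)
open import Relation.Nullary using (¬_; yes; no)
open import Relation.Binary.PropositionalEquality using (_≡_)
open import Algebra.Bundles using (CommutativeRing)

record FiniteField (Q : ℕ) : Set₁ where
  field
    cring : CommutativeRing 0ℓ 0ℓ
  open CommutativeRing cring public
  field
    0≉1     : ¬ (0# ≈ 1#)
    inverse : ∀ x → ¬ (x ≈ 0#) → ∃ λ y → (x * y) ≈ 1#
    enum    : Fin Q → Carrier
    enum-injective  : ∀ i j → enum i ≈ enum j → i ≡ j
    enum-surjective : ∀ x → ∃ λ i → enum i ≈ x

  pow : Carrier → ℕ → Carrier
  pow x zero    = 1#
  pow x (suc n) = x * pow x n

  InR : ℕ → Carrier → Set
  InR k y = ∃ λ x → ¬ (x ≈ 0#) × (pow x k ≈ y)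

IsPaleyAdjacency : ∀ {Q} (F : FiniteField Q) (k : ℕ) → (Fin Q → Fin Q → ℤ) → Set
IsPaleyAdjacency {Q} F k A = ∀ i j →
    (A i j ≡ + 1 × InR k (enum j - enum i))
  ⊎ (A i j ≡ + 0 × ¬ InR k (enum j - enum i))
  where open FiniteField F

-- Polynomials over ℤ as coefficient lists (lowest degree first).

Poly : Set
Poly = List ℤ

_+ₚ_ : Poly → Poly → Poly
[]      +ₚ q       = q
(a ∷ p) +ₚ []      = a ∷ p
(a ∷ p) +ₚ (b ∷ q) = (a ℤ.+ b) ∷ (p +ₚ q)

scaleₚ : ℤ → Poly → Poly
scaleₚ c = map (c ℤ.*_)

_*ₚ_ : Poly → Poly → Poly
[]      *ₚ q = []
(a ∷ p) *ₚ q = scaleₚ a q +ₚ (+ 0 ∷ (p *ₚ q))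

-ₚ_ : Poly → Poly
-ₚ_ = map (λ z → ℤ.- z)

_-ₚ_ : Poly → Poly → Poly
p -ₚ q = p +ₚ (-ₚ q)

constₚ : ℤ → Poly
constₚ c = c ∷ []

Xₚ : Poly
Xₚ = + 0 ∷ + 1 ∷ []

coeff : Poly → ℕ → ℤ
coeff []      m       = + 0
coeff (a ∷ p) zero    = a
coeff (a ∷ p) (suc m) = coeff p m

sumFin : ∀ n → (Fin n → Poly) → Poly
sumFin zero    f = []
sumFin (suc n) f = f Fin.zero +ₚ sumFin n (λ i → f (Fin.suc i))

prodFin : ∀ n → (Fin n → Poly) → Poly
prodFin zero    f = constₚ (+ 1)
prodFin (suc n) f = f Fin.zero *ₚ prodFin n (λ i → f (Fin.suc i))

signₚ : ℕ → Poly
signₚ zero          = constₚ (+ 1)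
signₚ (suc zero)    = constₚ (ℤ.- (+ 1))
signₚ (suc (suc j)) = signₚ j

det : ∀ n → (Fin n → Fin n → Poly) → Poly
det zero    M = constₚ (+ 1)
det (suc n) M = sumFin (suc n) λ j →
  signₚ (toℕ j) *ₚ (M Fin.zero j *ₚ det n (λ r c → M (Fin.suc r) (punchIn j c)))

charPoly : ∀ n → (Fin n → Fin n → ℤ) → Poly
charPoly n A = det n λ i j → diag i j -ₚ constₚ (A i j)
  where
  diag : Fin n → Fin n → Poly
  diag i j with i Fin.≟ j
  ... | yes _ = Xₚ
  ... | no  _ = []

-- Integral spectrum: the characteristic polynomial splits as ∏ (x - λ_i)
-- with all λ_i ∈ ℤ, i.e. every (complex) eigenvalue, with multiplicity,
-- is an integer.
IntegralSpectrum : ∀ n → (Fin n → Fin n → ℤ) → Set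
IntegralSpectrum n A = ∃ λ (ev : Fin n → ℤ) → ∀ m →
  coeff (charPoly n A) m ≡ coeff (prodFin n (λ i → Xₚ -ₚ constₚ (ev i))) m

-- exact division (all uses have a nonzero divisor dividing the numerator)
_div_ : ℕ → ℕ → ℕ
m div zero    = 0
m div (suc n) = m / suc n

φ : ℕ → ℕ
φ k = go k
  where
  go : ℕ → ℕ
  go zero    = 0
  go (suc i) with gcd (suc i) k ℕ.≟ 1
  ... | yes _ = suc (go i)
  ... | no  _ = go i

-- Values of cyclotomic polynomials at an integer x ≥ 2, computed from the
-- identity x^d - 1 = ∏_{e ∣ d} Φ_e(x):
--   Φ_d(x) = (x^d - 1) / ∏_{e ∣ d, e < d} Φ_e(x).
-- cycTable x n = [Φ_1(x), …, Φ_n(x)] stored in reverse: head is Φ_n(x).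
private
  -- product of Φ_e(x) over proper divisors e of d, where tbl = [Φ_{d-1},…,Φ_1]
  properDivProd : ℕ → List ℕ → ℕ
  properDivProd d []        = 1
  properDivProd d (v ∷ tbl) with suc (length tbl) ∣? d
  ... | yes _ = v ℕ.* properDivProd d tbl
  ... | no  _ = properDivProd d tbl

cycTable : ℕ → ℕ → List ℕ
cycTable x zero    = []
cycTable x (suc n) = ((x ℕ.^ suc n ℕ.∸ 1) div properDivProd (suc n) (cycTable x n)) ∷ cycTable x n

-- Φ_d(x) for d ≥ 1 (and x ≥ 2)
cyclotomicAt : ℕ → ℕ → ℕ
cyclotomicAt zero    x = 0
cyclotomicAt (suc d) x with cycTable x (suc d)
... | []    = 0
... | v ∷ _ = v

paleyExp : ℕ → ℕ → ℕ → ℕ → ℕ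
paleyExp k q t a = k ℕ.* ((q ℕ.^ (t ℕ.* a) ℕ.∸ 1) div (q ℕ.^ t ℕ.∸ 1))

PaleyIntegral : ℕ → ℕ → Set₁
PaleyIntegral K Q = ∀ (F : FiniteField Q) (A : Fin Q → Fin Q → ℤ) →
  IsPaleyAdjacency F K A → IntegralSpectrum Q A

module Submission where

-- Let A be the adjacency operator of a Cayley graph on F_Q whose connection set T is closed
-- under multiplication by F_p^*.  The operators L_s = Σ_{c ∈ F_p} (translation by c s)
-- commute and satisfy L_s² = p L_s, and averaging over F_p^* gives
-- (p − 1) A = Σ_{s ∈ T} L_s − |T|.  Adding commuting operators with L² = μ L preserves the
-- property of being annihilated by a product of factors X − l, l ∈ ℤ, and the factor p − 1
-- can be removed because (c A − μ) w = 0 with μ / c nonintegral makes w divisible by every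
-- power of c.  If h = ∏ (x − l) annihilates A, then x − A divides h(x) as a matrix over ℤ[x],
-- so the monic polynomial det (x − A) divides h(x) ^ Q and splits.
--
-- The connection set R_K is closed under F_p^*: when Q − 1 = K r it consists of the
-- solutions of y ^ r = 1, and p − 1 divides r because k (p − 1) divides q ^ t − 1.

open import Defs
open import Data.Nat using (ℕ; _*_; _^_; _∸_; _+_; _≤_; _>_)
open import Data.Nat.Divisibility using (_∣_)
open import Data.Nat.GCD using (gcd)
open import Data.Nat.Primality using (Prime)
open import Data.Product using (_×_)
open import Relation.Binary.PropositionalEquality using (_≡_)

open import Algebra.Bundles using (CommutativeRing)
import Algebra.Properties.AbelianGroup
import Algebra.Properties.CommutativeMonoid.Sum
import Algebra.Properties.CommutativeSemiring.Exp
import Algebra.Properties.Group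
import Algebra.Properties.Semiring.Mult
import Algebra.Solver.Ring.NaturalCoefficients.Default
open import Data.Fin as Fin using (Fin; punchIn; punchOut; toℕ; inject₁)
open import Data.Fin.Induction using (<-weakInduction)
open import Data.Fin.Permutation using (Permutation′; permutation; _⟨$⟩ʳ_)
import Data.Fin.Properties as Fin
open import Data.Integer as ℤ using (ℤ; 0ℤ; 1ℤ; +_; ∣_∣)
import Data.Integer.Divisibility.Signed as ℤ
import Data.Integer.Properties as ℤ
open import Data.Integer.Tactic.RingSolver using (solve-∀)
open import Data.List as List using (List; []; _∷_; foldr; length; _++_)
open import Data.Nat as ℕ using (zero; suc; _<_)
open import Data.Nat.Coprimality using (Coprime; prime⇒coprime; coprime-Bézout; coprime-divisor; coprime⇒gcd≡1; gcd≡1⇒coprime)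
  renaming (sym to coprime-sym)
import Data.Nat.Divisibility as ℕ
open import Data.Nat.DivMod using (_/_; _%_; _mod_; %-distribˡ-*; m≡m%n+[m/n]*n; m*n/n≡m; m%n<n; m<n⇒m%n≡m; m%n%n≡m%n; [m+kn]%n≡m%n)
open import Data.Nat.GCD using (module Bézout; gcd-GCD; gcd[m,n]∣m; gcd[m,n]∣n; gcd-greatest; c*gcd[m,n]≡gcd[cm,cn]; gcd[m,n]≢0)
open import Data.Nat.LCM using (lcm; m∣lcm[m,n]; n∣lcm[m,n]; lcm-least; gcd*lcm)
open import Data.Nat.Primality using (prime⇒nonZero; prime⇒nonTrivial)
import Data.Nat.Properties as ℕ
import Data.Nat.Tactic.RingSolver as ℕSolver
open import Data.Product using (∃; _,_; proj₁; proj₂)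
open import Data.Sum using (_⊎_; inj₁; inj₂)
open import Data.Vec as Vec using (Vec; []; _∷_)
open import Data.Vec.Functional using (insertAt; updateAt) renaming (_∷_ to infixr 5 _◂_)
open import Data.Vec.Functional.Properties using (insertAt-lookup; insertAt-punchIn; updateAt-updates; updateAt-minimal)
open import Function using (_∘_; const; case_of_)
import Relation.Binary.Reasoning.Setoid
open import Relation.Binary.PropositionalEquality using (_≢_; refl; sym; trans; cong; cong₂; subst; module ≡-Reasoning)
open import Relation.Nullary using (¬_; Dec; yes; no; contradiction; ¬?; _×-dec_; map′)

-- Diagonalizing `A` by additive characters would bring in complex roots of unity. Sums along the
-- F_p-lines do the work of the characters without leaving ℤ; the price is the factor p - 1.
-- Annihilation by a product of factors X - l, repetitions allowed, survives every step without any
-- claim of diagonalizability, and multiplicities reappear only when the monic characteristic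
-- polynomial is split at the end. Polynomial identities are handled as identities of functions on
-- ℤ, so that determinants need a theory only over ℤ.
--
-- The arithmetic input is k (p - 1) ∣ q ^ t - 1. In (a) it holds because (p ^ n - 1) / (p - 1) is n
-- modulo p - 1; in (b) because p² - 1 = (p + 1) (p - 1); in (c) by Euler's theorem, k being coprime
-- to p - 1; in (d), where Φ_d(p) takes the place of k, because Φ_d(x) times the least common
-- multiple of the x ^ e - 1 over the proper divisors e of d is x ^ d - 1. The last fact also shows
-- that the recursive quotients in `cycTable` are exact.

module ℤGroup = Algebra.Properties.AbelianGroup ℤ.+-0-abelianGroup
open import Algebra.Properties.Semiring.Sum ℤ.+-*-semiring
  using (sum; sum-cong-≗; ∑-distrib-+; ∑-comm; *-distribˡ-sum; *-distribʳ-sum; sum-permute)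

-- Determinants over ℤ

Row : ℕ → Set
Row n = Fin n → ℤ

Mat : ℕ → Set
Mat n = Fin n → Fin n → ℤ

δ : ∀ {n} → Mat n
δ Fin.zero    Fin.zero    = 1ℤ
δ Fin.zero    (Fin.suc j) = 0ℤ
δ (Fin.suc i) Fin.zero    = 0ℤ
δ (Fin.suc i) (Fin.suc j) = δ i j

sgn : ℕ → ℤ
sgn zero    = 1ℤ
sgn (suc j) = ℤ.- sgn j

minor : ∀ {n} → Mat (suc n) → Fin (suc n) → Mat n
minor M j r c = M (Fin.suc r) (punchIn j c)

detℤ : ∀ n → Mat n → ℤ
detℤ zero    M = 1ℤ
detℤ (suc n) M = sum λ j → sgn (toℕ j) ℤ.* (M Fin.zero j ℤ.* detℤ n (minor M j))

-- Matrices are functions without extensionality, so invariance under pointwise equality is an axiom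
-- here, and linearity is stated for any three matrices that agree off row `i`. The coefficient `c`
-- packs additivity and homogeneity into one law.
record Alternating {n} (D : Mat n → ℤ) : Set where
  field
    congruent   : ∀ M M′ → (∀ i j → M i j ≡ M′ i j) → D M ≡ D M′
    linear      : ∀ i c M M₁ M₂ →
                  (∀ r → r ≢ i → ∀ j → M r j ≡ M₁ r j) →
                  (∀ r → r ≢ i → ∀ j → M r j ≡ M₂ r j) →
                  (∀ j → M i j ≡ M₁ i j ℤ.+ c ℤ.* M₂ i j) →
                  D M ≡ D M₁ ℤ.+ c ℤ.* D M₂
    alternating : ∀ r s → r ≢ s → ∀ M → (∀ j → M r j ≡ M s j) → D M ≡ 0ℤ

module AlternatingProperties {n : ℕ} {D : Mat n → ℤ} (alt : Alternating D) where
  open Alternating alt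
  open ≡-Reasoning

  private
    module Update (M : Mat n) {r s : Fin n} (r≢s : r ≢ s) where
      put : Row n → Row n → Mat n
      put f g = updateAt (updateAt M s (const g)) r (const f)

      put-r : ∀ f g j → put f g r j ≡ f j
      put-r f g j = cong (λ h → h j) (updateAt-updates r (updateAt M s (const g)))

      put-s : ∀ f g j → put f g s j ≡ g j
      put-s f g j = cong (λ h → h j) (trans
        (updateAt-minimal s r (updateAt M s (const g)) (r≢s ∘ sym)) (updateAt-updates s M))

      put-other : ∀ f g {t} → t ≢ r → t ≢ s → ∀ j → put f g t j ≡ M t j
      put-other f g t≢r t≢s j = cong (λ h → h j) (trans
        (updateAt-minimal _ r (updateAt M s (const g)) t≢r) (updateAt-minimal _ s M t≢s))

      put-unique : ∀ f g (N : Mat n) → (∀ j → N r j ≡ f j) → (∀ j → N s j ≡ g j) →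
                   (∀ t → t ≢ r → t ≢ s → ∀ j → N t j ≡ M t j) →
                   ∀ t j → N t j ≡ put f g t j
      put-unique f g N Nr Ns Nt t j with t Fin.≟ r | t Fin.≟ s
      ... | yes refl | _        = trans (Nr j) (sym (put-r f g j))
      ... | no _     | yes refl = trans (Ns j) (sym (put-s f g j))
      ... | no t≢r   | no t≢s   = trans (Nt t t≢r t≢s j) (sym (put-other f g t≢r t≢s j))

      _⊕_ : Row n → Row n → Row n
      (f ⊕ g) j = f j ℤ.+ 1ℤ ℤ.* g j

      put-linear-r : ∀ f f′ g → D (put (f ⊕ f′) g) ≡ D (put f g) ℤ.+ 1ℤ ℤ.* D (put f′ g)
      put-linear-r f f′ g = linear r 1ℤ _ _ _ (off f) (off f′)
        λ j → trans (put-r _ g j)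
                (sym (cong₂ (λ x y → x ℤ.+ 1ℤ ℤ.* y) (put-r f g j) (put-r f′ g j)))
        where
        off : ∀ h t → t ≢ r → ∀ j → put (f ⊕ f′) g t j ≡ put h g t j
        off h t t≢r j with t Fin.≟ s
        ... | yes refl = trans (put-s _ g j) (sym (put-s h g j))
        ... | no t≢s   = trans (put-other _ g t≢r t≢s j) (sym (put-other h g t≢r t≢s j))

      put-linear-s : ∀ f g g′ → D (put f (g ⊕ g′)) ≡ D (put f g) ℤ.+ 1ℤ ℤ.* D (put f g′)
      put-linear-s f g g′ = linear s 1ℤ _ _ _ (off g) (off g′)
        λ j → trans (put-s f _ j)
                (sym (cong₂ (λ x y → x ℤ.+ 1ℤ ℤ.* y) (put-s f g j) (put-s f g′ j)))
        where
        off : ∀ h t → t ≢ s → ∀ j → put f (g ⊕ g′) t j ≡ put f h t j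
        off h t t≢s j with t Fin.≟ r
        ... | yes refl = trans (put-r f _ j) (sym (put-r f h j))
        ... | no t≢r   = trans (put-other f _ t≢r t≢s j) (sym (put-other f h t≢r t≢s j))

      put-diagonal : ∀ f → D (put f f) ≡ 0ℤ
      put-diagonal f = alternating r s r≢s _ λ j → trans (put-r f f j) (sym (put-s f f j))

  -- Put f + g in both rows and expand: the total and the two terms with a repeated row vanish,
  -- which leaves D(f, g) + D(g, f) = 0. `M′` is described by its rows so that any presentation of
  -- the exchanged matrix fits.
  antisymmetric : ∀ {r s} → r ≢ s → ∀ M M′ →
    (∀ j → M′ r j ≡ M s j) → (∀ j → M′ s j ≡ M r j) →
    (∀ t → t ≢ r → t ≢ s → ∀ j → M′ t j ≡ M t j) →
    D M ≡ ℤ.- D M′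
  antisymmetric {r} {s} r≢s M M′ Mr Ms Mt = begin
    D M                                ≡⟨ congruent _ _ (put-unique f g M (λ _ → refl) (λ _ → refl) (λ _ _ _ _ → refl)) ⟩
    D (put f g)                        ≡⟨ solve-for (D (put f f)) (D (put f g)) (D (put g f)) (D (put g g))
                                            (put-diagonal f) (put-diagonal g) total ⟩
    ℤ.- D (put g f)                    ≡⟨ cong ℤ.-_ (congruent _ _ (put-unique g f M′ Mr Ms Mt)) ⟨
    ℤ.- D M′                           ∎
    where
    open Update M r≢s
    f = M r
    g = M s
    total : 0ℤ ≡ (D (put f f) ℤ.+ 1ℤ ℤ.* D (put f g)) ℤ.+ 1ℤ ℤ.* (D (put g f) ℤ.+ 1ℤ ℤ.* D (put g g))
    total = begin
      0ℤ                                                           ≡⟨ put-diagonal (f ⊕ g) ⟨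
      D (put (f ⊕ g) (f ⊕ g))                                      ≡⟨ put-linear-r f g (f ⊕ g) ⟩
      D (put f (f ⊕ g)) ℤ.+ 1ℤ ℤ.* D (put g (f ⊕ g))
        ≡⟨ cong₂ (λ x y → x ℤ.+ 1ℤ ℤ.* y) (put-linear-s f f g) (put-linear-s g f g) ⟩
      _ ∎
    ident : ∀ b c → b ≡ ((0ℤ ℤ.+ 1ℤ ℤ.* b) ℤ.+ 1ℤ ℤ.* (c ℤ.+ 1ℤ ℤ.* 0ℤ)) ℤ.+ ℤ.- c
    ident = solve-∀
    solve-for : ∀ a b c d → a ≡ 0ℤ → d ≡ 0ℤ →
      0ℤ ≡ (a ℤ.+ 1ℤ ℤ.* b) ℤ.+ 1ℤ ℤ.* (c ℤ.+ 1ℤ ℤ.* d) → b ≡ ℤ.- c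
    solve-for a b c d refl refl e = begin
      b                                                                   ≡⟨ ident b c ⟩
      ((0ℤ ℤ.+ 1ℤ ℤ.* b) ℤ.+ 1ℤ ℤ.* (c ℤ.+ 1ℤ ℤ.* 0ℤ)) ℤ.+ ℤ.- c ≡⟨ cong (ℤ._+ ℤ.- c) e ⟨
      0ℤ ℤ.+ ℤ.- c                                                        ≡⟨ ℤ.+-identityˡ _ ⟩
      ℤ.- c                                                               ∎

δ-diagonal : ∀ {n} (j : Fin n) → δ j j ≡ 1ℤ
δ-diagonal Fin.zero    = refl
δ-diagonal (Fin.suc j) = δ-diagonal j

δ-off-diagonal : ∀ {n} {i j : Fin n} → i ≢ j → δ i j ≡ 0ℤ
δ-off-diagonal {i = Fin.zero}  {Fin.zero}  i≢j = contradiction refl i≢j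
δ-off-diagonal {i = Fin.zero}  {Fin.suc j} i≢j = refl
δ-off-diagonal {i = Fin.suc i} {Fin.zero}  i≢j = refl
δ-off-diagonal {i = Fin.suc i} {Fin.suc j} i≢j = δ-off-diagonal (i≢j ∘ cong Fin.suc)

sum-zero : ∀ {n} {f : Row n} → (∀ i → f i ≡ 0ℤ) → sum f ≡ 0ℤ
sum-zero {zero}  f≡0 = refl
sum-zero {suc n} f≡0 = cong₂ ℤ._+_ (f≡0 Fin.zero) (sum-zero (f≡0 ∘ Fin.suc))

sum-δ : ∀ {n} (i : Fin n) (f : Row n) → sum (λ k → δ i k ℤ.* f k) ≡ f i
sum-δ {suc n} Fin.zero f = begin
  1ℤ ℤ.* f Fin.zero ℤ.+ sum (λ k → 0ℤ ℤ.* f (Fin.suc k)) ≡⟨ cong (ℤ._+_ (1ℤ ℤ.* f Fin.zero)) (sum-zero {n} λ k → refl) ⟩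
  1ℤ ℤ.* f Fin.zero ℤ.+ 0ℤ                               ≡⟨ ℤ.+-identityʳ _ ⟩
  1ℤ ℤ.* f Fin.zero                                      ≡⟨ ℤ.*-identityˡ _ ⟩
  f Fin.zero                                             ∎
  where open ≡-Reasoning
sum-δ {suc n} (Fin.suc i) f = trans (ℤ.+-identityˡ _) (sum-δ i (f ∘ Fin.suc))

sum-linear : ∀ {n} c (f g : Row n) →
  sum (λ i → f i ℤ.+ c ℤ.* g i) ≡ sum f ℤ.+ c ℤ.* sum g
sum-linear c f g =
  trans (∑-distrib-+ f (λ i → c ℤ.* g i)) (cong (ℤ._+_ (sum f)) (sym (*-distribˡ-sum c g)))

LinearForm : ∀ {n} → (Row n → ℤ) → Set
LinearForm F = ∀ c f g h → (∀ k → h k ≡ f k ℤ.+ c ℤ.* g k) → F h ≡ F f ℤ.+ c ℤ.* F g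

linearForm-zero : ∀ {n} {F : Row n → ℤ} → LinearForm F → F (λ _ → 0ℤ) ≡ 0ℤ
linearForm-zero {F = F} lin = solve-for (F (λ _ → 0ℤ)) (lin 1ℤ _ _ _ λ _ → refl)
  where
  ident : ∀ x → x ≡ (x ℤ.+ 1ℤ ℤ.* x) ℤ.- x
  ident = solve-∀
  solve-for : ∀ x → x ≡ x ℤ.+ 1ℤ ℤ.* x → x ≡ 0ℤ
  solve-for x e = trans (ident x) (trans (cong (ℤ._- x) (sym e)) (ℤ.+-inverseʳ x))

linearForm-expand : ∀ n (F : Row n → ℤ) → LinearForm F → ∀ f → F f ≡ sum λ j → f j ℤ.* F (δ j)
linearForm-expand zero    F lin f = trans (lin 0ℤ _ (λ _ → 0ℤ) f λ ()) (trans (ℤ.+-identityʳ _) (linearForm-zero lin))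
linearForm-expand (suc n) F lin f = begin
  F f                                                    ≡⟨ lin (f Fin.zero) (0ℤ ◂ f ∘ Fin.suc) (δ Fin.zero) f split ⟩
  F (0ℤ ◂ f ∘ Fin.suc) ℤ.+ f Fin.zero ℤ.* F (δ Fin.zero) ≡⟨ ℤ.+-comm (F (0ℤ ◂ f ∘ Fin.suc)) _ ⟩
  f Fin.zero ℤ.* F (δ Fin.zero) ℤ.+ F (0ℤ ◂ f ∘ Fin.suc)
    ≡⟨ cong (ℤ._+_ (f Fin.zero ℤ.* F (δ Fin.zero))) (linearForm-expand n (λ g → F (0ℤ ◂ g)) lin′ (f ∘ Fin.suc)) ⟩
  f Fin.zero ℤ.* F (δ Fin.zero) ℤ.+ sum (λ j → f (Fin.suc j) ℤ.* F (0ℤ ◂ δ j))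
    ≡⟨ cong (ℤ._+_ (f Fin.zero ℤ.* F (δ Fin.zero))) (sum-cong-≗ λ j → cong (f (Fin.suc j) ℤ.*_) (F-cong λ { Fin.zero → refl ; (Fin.suc k) → refl })) ⟩
  f Fin.zero ℤ.* F (δ Fin.zero) ℤ.+ sum (λ j → f (Fin.suc j) ℤ.* F (δ (Fin.suc j))) ∎
  where
  open ≡-Reasoning
  F-cong : ∀ {h g} → (∀ k → h k ≡ g k) → F h ≡ F g
  F-cong {h} {g} e = trans (lin 0ℤ g g h λ k → trans (e k) (sym (ℤ.+-identityʳ _))) (ℤ.+-identityʳ _)
  id₀ : ∀ x → x ≡ 0ℤ ℤ.+ x ℤ.* 1ℤ
  id₀ = solve-∀
  id₁ : ∀ x y → x ≡ x ℤ.+ y ℤ.* 0ℤ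
  id₁ = solve-∀
  split : ∀ k → f k ≡ (0ℤ ◂ f ∘ Fin.suc) k ℤ.+ f Fin.zero ℤ.* δ Fin.zero k
  split Fin.zero    = id₀ _
  split (Fin.suc k) = id₁ _ (f Fin.zero)
  id₂ : ∀ c → 0ℤ ≡ 0ℤ ℤ.+ c ℤ.* 0ℤ
  id₂ = solve-∀
  lin′ : LinearForm (λ g → F (0ℤ ◂ g))
  lin′ c f g h e = lin c _ _ _ λ { Fin.zero → id₂ c ; (Fin.suc k) → e k }

-- Lifts an operation that is harmless in one row to all rows at once, exchanging one row at a time.
-- `_≈_` plays the part of pointwise equality and `_∼_` is the change allowed; rows already
-- exchanged are absorbed into `E`.
rowwise-invariant : ∀ {m} {X : Set} (_≈_ _∼_ : X → X → Set) → (∀ x → x ≈ x) →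
  (E : (Fin m → X) → ℤ) →
  (∀ M N → (∀ i → M i ≈ N i) → E M ≡ E N) →
  (∀ i M N → (∀ r → r ≢ i → M r ≈ N r) → M i ∼ N i → E M ≡ E N) →
  ∀ M N → (∀ i → M i ∼ N i) → E M ≡ E N
rowwise-invariant {zero}  _≈_ _∼_ ≈-refl E E-cong step M N M∼N = E-cong M N λ ()
rowwise-invariant {suc m} {X} _≈_ _∼_ ≈-refl E E-cong step M N M∼N = begin
  E M                            ≡⟨ step Fin.zero M (N Fin.zero ◂ M ∘ Fin.suc) off (M∼N Fin.zero) ⟩
  E (N Fin.zero ◂ M ∘ Fin.suc)   ≡⟨ rowwise-invariant _≈_ _∼_ ≈-refl (λ P → E (N Fin.zero ◂ P))
                                      (λ P R e → E-cong _ _ λ { Fin.zero → ≈-refl _ ; (Fin.suc i) → e i })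
                                      (λ i P R o s → step (Fin.suc i) _ _ (off′ i P R o) s)
                                      (M ∘ Fin.suc) (N ∘ Fin.suc) (M∼N ∘ Fin.suc) ⟩
  E (N Fin.zero ◂ N ∘ Fin.suc)   ≡⟨ E-cong _ _ (λ { Fin.zero → ≈-refl _ ; (Fin.suc i) → ≈-refl _ }) ⟩
  E N                            ∎
  where
  open ≡-Reasoning
  off : ∀ r → r ≢ Fin.zero → M r ≈ (N Fin.zero ◂ M ∘ Fin.suc) r
  off Fin.zero    r≢0 = contradiction refl r≢0
  off (Fin.suc r) _   = ≈-refl _
  off′ : ∀ i (P R : Fin m → X) → (∀ r → r ≢ i → P r ≈ R r) →
         ∀ r → r ≢ Fin.suc i → (N Fin.zero ◂ P) r ≈ (N Fin.zero ◂ R) r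
  off′ i P R o Fin.zero    _ = ≈-refl _
  off′ i P R o (Fin.suc r) r≢i = o r (r≢i ∘ cong Fin.suc)

-- Every column is `j` or some `punchIn j k`, and these are the two forms at which the value of
-- `insertAt` is known.
insertAt-elim : ∀ {n} (j : Fin (suc n)) (P : Fin (suc n) → Set) →
                P j → (∀ k → P (punchIn j k)) → ∀ k → P k
insertAt-elim j P Pj Pk k with j Fin.≟ k
... | yes refl = Pj
... | no j≢k   = subst P (Fin.punchIn-punchOut j≢k) (Pk (punchOut j≢k))

module _ {n : ℕ} {D : Mat (suc n) → ℤ} (alt : Alternating D) where
  open Alternating alt
  open ≡-Reasoning

  firstRow-linear : ∀ (R : Fin n → Row (suc n)) → LinearForm (λ f → D (f ◂ R))
  firstRow-linear R c f g h e = linear Fin.zero c _ _ _ (off f) (off g) e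
    where
    off : ∀ {h : Row (suc n)} g r → r ≢ Fin.zero → ∀ j → (h ◂ R) r j ≡ (g ◂ R) r j
    off g Fin.zero    r≢0 j = contradiction refl r≢0
    off g (Fin.suc r) _   j = refl

  -- Adding a multiple of the first row `e` to another row contributes a term with two rows equal to
  -- `e`, which vanishes.
  clearRows : ∀ (e : Row (suc n)) (M N : Fin n → Row (suc n)) →
    (∀ i → ∃ λ c → ∀ k → M i k ≡ N i k ℤ.+ c ℤ.* e k) → D (e ◂ M) ≡ D (e ◂ N)
  clearRows e = rowwise-invariant (λ f g → ∀ k → f k ≡ g k)
    (λ f g → ∃ λ c → ∀ k → f k ≡ g k ℤ.+ c ℤ.* e k) (λ _ _ → refl) (λ M → D (e ◂ M))
    (λ M N M≈N → congruent _ _ λ { Fin.zero k → refl ; (Fin.suc i) k → M≈N i k }) step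
    where
    step : ∀ i (M N : Fin n → Row (suc n)) → (∀ r → r ≢ i → ∀ k → M r k ≡ N r k) →
           (∃ λ c → ∀ k → M i k ≡ N i k ℤ.+ c ℤ.* e k) → D (e ◂ M) ≡ D (e ◂ N)
    step i M N off (c , Mi) = begin
      D (e ◂ M)                                             ≡⟨ linear (Fin.suc i) c (e ◂ M) (e ◂ N) (e ◂ N′) off₁ off₂ Mi′ ⟩
      D (e ◂ N) ℤ.+ c ℤ.* D (e ◂ N′)                        ≡⟨ cong (λ z → D (e ◂ N) ℤ.+ c ℤ.* z) (alternating Fin.zero (Fin.suc i) (λ ()) (e ◂ N′)
                                                                 (λ j → sym (cong (λ h → h j) (updateAt-updates i N)))) ⟩
      D (e ◂ N) ℤ.+ c ℤ.* 0ℤ                                ≡⟨ cong (ℤ._+_ (D (e ◂ N))) (ℤ.*-zeroʳ c) ⟩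
      D (e ◂ N) ℤ.+ 0ℤ                                      ≡⟨ ℤ.+-identityʳ _ ⟩
      D (e ◂ N)                                             ∎
      where
      N′ = updateAt N i (const e)
      off₁ : ∀ r → r ≢ Fin.suc i → ∀ k → (e ◂ M) r k ≡ (e ◂ N) r k
      off₁ Fin.zero    _   k = refl
      off₁ (Fin.suc r) r≢i k = off r (r≢i ∘ cong Fin.suc) k
      off₂ : ∀ r → r ≢ Fin.suc i → ∀ k → (e ◂ M) r k ≡ (e ◂ N′) r k
      off₂ Fin.zero    _   k = refl
      off₂ (Fin.suc r) r≢i k = trans (off r (r≢i ∘ cong Fin.suc) k)
        (sym (cong (λ h → h k) (updateAt-minimal r i N (r≢i ∘ cong Fin.suc))))
      Mi′ : ∀ k → (e ◂ M) (Fin.suc i) k ≡ (e ◂ N) (Fin.suc i) k ℤ.+ c ℤ.* (e ◂ N′) (Fin.suc i) k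
      Mi′ k = trans (Mi k) (cong (λ h → N i k ℤ.+ c ℤ.* h k) (sym (updateAt-updates i N)))

  private
    ins : Fin (suc n) → Row n → Row (suc n)
    ins j f = insertAt f j 0ℤ

  -- The matrix with first row `δ j`, column `j` otherwise zero, and `N` in the remaining places. As
  -- a function of `N` it is alternating of size n, which is what the induction in
  -- `alternating-unique` runs on.
  bordered : Fin (suc n) → Mat n → ℤ
  bordered j N = D (δ j ◂ λ r → ins j (N r))

  private
    ins-cong : ∀ j {f g} → (∀ k → f k ≡ g k) → ∀ k → ins j f k ≡ ins j g k
    ins-cong j {f} {g} e = insertAt-elim j _
      (trans (insertAt-lookup f j 0ℤ) (sym (insertAt-lookup g j 0ℤ)))
      (λ k → trans (insertAt-punchIn f j 0ℤ k) (trans (e k) (sym (insertAt-punchIn g j 0ℤ k))))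

    zero-linear : ∀ c → 0ℤ ≡ 0ℤ ℤ.+ c ℤ.* 0ℤ
    zero-linear = solve-∀

    ins-linear : ∀ j c f g h → (∀ k → h k ≡ f k ℤ.+ c ℤ.* g k) →
                 ∀ k → ins j h k ≡ ins j f k ℤ.+ c ℤ.* ins j g k
    ins-linear j c f g h e = insertAt-elim j _
      (trans (insertAt-lookup h j 0ℤ) (trans (zero-linear c) (sym (cong₂ (λ x y → x ℤ.+ c ℤ.* y)
        (insertAt-lookup f j 0ℤ) (insertAt-lookup g j 0ℤ)))))
      (λ k → trans (insertAt-punchIn h j 0ℤ k) (trans (e k) (sym (cong₂ (λ x y → x ℤ.+ c ℤ.* y)
        (insertAt-punchIn f j 0ℤ k) (insertAt-punchIn g j 0ℤ k)))))

  bordered-alternating : ∀ j → Alternating (bordered j)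
  bordered-alternating j = record
    { congruent   = λ M M′ e → congruent _ _ λ { Fin.zero k → refl ; (Fin.suc i) → ins-cong j (e i) }
    ; linear      = λ i c M M₁ M₂ o₁ o₂ e → linear (Fin.suc i) c _ _ _ (off i M M₁ o₁) (off i M M₂ o₂)
                      (ins-linear j c _ _ _ e)
    ; alternating = λ r s r≢s M e → alternating (Fin.suc r) (Fin.suc s) (r≢s ∘ Fin.suc-injective) _
                      (ins-cong j e)
    }
    where
    off : ∀ i (M N : Mat n) → (∀ r → r ≢ i → ∀ k → M r k ≡ N r k) → ∀ r → r ≢ Fin.suc i →
          ∀ k → (δ j ◂ λ r → ins j (M r)) r k ≡ (δ j ◂ λ r → ins j (N r)) r k
    off i M N o Fin.zero    _   k = refl
    off i M N o (Fin.suc r) r≢i k = ins-cong j (o r (r≢i ∘ cong Fin.suc)) k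

  clearColumn : ∀ (M : Mat (suc n)) j → D (δ j ◂ M ∘ Fin.suc) ≡ bordered j (minor M j)
  clearColumn M j = clearRows (δ j) _ _ λ i → M (Fin.suc i) j , insertAt-elim j _ (at-j i) (off-j i)
    where
    id₀ : ∀ x → x ≡ 0ℤ ℤ.+ x ℤ.* 1ℤ
    id₀ = solve-∀
    id₁ : ∀ x y → x ≡ x ℤ.+ y ℤ.* 0ℤ
    id₁ = solve-∀
    at-j : ∀ i → M (Fin.suc i) j ≡ ins j (minor M j i) j ℤ.+ M (Fin.suc i) j ℤ.* δ j j
    at-j i = trans (id₀ _) (sym (cong₂ (λ x y → x ℤ.+ M (Fin.suc i) j ℤ.* y)
      (insertAt-lookup (minor M j i) j 0ℤ) (δ-diagonal j)))
    off-j : ∀ i k → M (Fin.suc i) (punchIn j k) ≡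
            ins j (minor M j i) (punchIn j k) ℤ.+ M (Fin.suc i) j ℤ.* δ j (punchIn j k)
    off-j i k = trans (id₁ _ (M (Fin.suc i) j)) (sym (cong₂ (λ x y → x ℤ.+ M (Fin.suc i) j ℤ.* y)
      (insertAt-punchIn (minor M j i) j 0ℤ k) (δ-off-diagonal (Fin.punchInᵢ≢i j k ∘ sym))))

  -- The bordered identity has the rows of the identity in cyclic order, with row `j` moved to the
  -- front. It takes j exchanges with the first row to get there, each of which changes the sign.
  bordered-δ : ∀ j → bordered j δ ≡ sgn (toℕ j) ℤ.* D δ
  bordered-δ j = trans (congruent _ _ λ { Fin.zero k → refl ; (Fin.suc r) → ins-δ r }) (cycled-δ j)
    where
    δ-punchIn : ∀ {n} (j : Fin (suc n)) r k → δ (punchIn j r) (punchIn j k) ≡ δ r k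
    δ-punchIn Fin.zero    r           k           = refl
    δ-punchIn (Fin.suc j) Fin.zero    Fin.zero    = refl
    δ-punchIn (Fin.suc j) Fin.zero    (Fin.suc k) = refl
    δ-punchIn (Fin.suc j) (Fin.suc r) Fin.zero    = refl
    δ-punchIn (Fin.suc j) (Fin.suc r) (Fin.suc k) = δ-punchIn j r k

    ins-δ : ∀ r k → ins j (δ r) k ≡ δ (punchIn j r) k
    ins-δ r = insertAt-elim j _
      (trans (insertAt-lookup (δ r) j 0ℤ) (sym (δ-off-diagonal (Fin.punchInᵢ≢i j r))))
      (λ k → trans (insertAt-punchIn (δ r) j 0ℤ k) (sym (δ-punchIn j r k)))

    cycled : Fin (suc n) → Mat (suc n)
    cycled j = δ j ◂ λ r → δ (punchIn j r)

    punchIn-suc-self : ∀ {n} (i : Fin n) → punchIn (Fin.suc i) i ≡ inject₁ i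
    punchIn-suc-self Fin.zero    = refl
    punchIn-suc-self (Fin.suc i) = cong Fin.suc (punchIn-suc-self i)

    punchIn-inject₁-self : ∀ {n} (i : Fin n) → punchIn (inject₁ i) i ≡ Fin.suc i
    punchIn-inject₁-self Fin.zero    = refl
    punchIn-inject₁-self (Fin.suc i) = cong Fin.suc (punchIn-inject₁-self i)

    punchIn-suc-other : ∀ {n} (i r : Fin n) → r ≢ i → punchIn (inject₁ i) r ≡ punchIn (Fin.suc i) r
    punchIn-suc-other Fin.zero    Fin.zero    r≢i = contradiction refl r≢i
    punchIn-suc-other Fin.zero    (Fin.suc r) r≢i = refl
    punchIn-suc-other (Fin.suc i) Fin.zero    r≢i = refl
    punchIn-suc-other (Fin.suc i) (Fin.suc r) r≢i = cong Fin.suc (punchIn-suc-other i r (r≢i ∘ cong Fin.suc))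

    -- The orders i, 0, ..., i - 1, i + 1, ... and i + 1, 0, ..., i - 1, i, ... differ by exchanging
    -- the first row with row i + 1.
    transpose : ∀ i → D (cycled (Fin.suc i)) ≡ ℤ.- D (cycled (inject₁ i))
    transpose i = AlternatingProperties.antisymmetric alt {Fin.zero} {Fin.suc i} (λ ()) _ _
      (λ k → cong (λ t → δ t k) (sym (punchIn-suc-self i)))
      (λ k → cong (λ t → δ t k) (punchIn-inject₁-self i))
      λ { Fin.zero 0≢0 _ k → contradiction refl 0≢0
        ; (Fin.suc r) _ r≢i k → cong (λ t → δ t k) (punchIn-suc-other i r (r≢i ∘ cong Fin.suc)) }

    cycled-δ : ∀ j → D (cycled j) ≡ sgn (toℕ j) ℤ.* D δ
    cycled-δ = <-weakInduction (λ j → D (cycled j) ≡ sgn (toℕ j) ℤ.* D δ)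
      (trans (congruent _ _ λ { Fin.zero k → refl ; (Fin.suc r) k → refl }) (sym (ℤ.*-identityˡ _)))
      λ i ih → begin
        D (cycled (Fin.suc i))                    ≡⟨ transpose i ⟩
        ℤ.- D (cycled (inject₁ i))                ≡⟨ cong ℤ.-_ ih ⟩
        ℤ.- (sgn (toℕ (inject₁ i)) ℤ.* D δ)       ≡⟨ ℤ.neg-distribˡ-* (sgn (toℕ (inject₁ i))) (D δ) ⟩
        ℤ.- sgn (toℕ (inject₁ i)) ℤ.* D δ         ≡⟨ cong (λ t → ℤ.- sgn t ℤ.* D δ) (Fin.toℕ-inject₁ i) ⟩
        ℤ.- sgn (toℕ i) ℤ.* D δ                   ∎

-- Linearity in the first row reduces `M` to matrices with first row `δ j`, clearing column `j`
-- leaves a bordered minor, and induction applies to it. The sign of the Laplace expansion is that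
-- of the cyclic permutation.
alternating-unique : ∀ n (D : Mat n → ℤ) → Alternating D → ∀ M → D M ≡ detℤ n M ℤ.* D δ
alternating-unique zero    D alt M = trans (Alternating.congruent alt M δ λ ()) (sym (ℤ.*-identityˡ _))
alternating-unique (suc n) D alt M = begin
  D M                                                 ≡⟨ congruent _ _ (λ { Fin.zero k → refl ; (Fin.suc r) k → refl }) ⟩
  D (M Fin.zero ◂ M ∘ Fin.suc)                        ≡⟨ linearForm-expand _ _ (firstRow-linear alt (M ∘ Fin.suc)) (M Fin.zero) ⟩
  sum (λ j → M Fin.zero j ℤ.* D (δ j ◂ M ∘ Fin.suc))  ≡⟨ sum-cong-≗ (λ j → cong (M Fin.zero j ℤ.*_) (clearColumn alt M j)) ⟩
  sum (λ j → M Fin.zero j ℤ.* bordered alt j (minor M j))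
    ≡⟨ sum-cong-≗ (λ j → trans (cong (M Fin.zero j ℤ.*_) (trans
         (alternating-unique n (bordered alt j) (bordered-alternating alt j) (minor M j))
         (cong (detℤ n (minor M j) ℤ.*_) (bordered-δ alt j))))
         (rearrange (M Fin.zero j) (detℤ n (minor M j)) (sgn (toℕ j)) (D δ))) ⟩
  sum (λ j → sgn (toℕ j) ℤ.* (M Fin.zero j ℤ.* detℤ n (minor M j)) ℤ.* D δ)
    ≡⟨ *-distribʳ-sum (D δ) (λ j → sgn (toℕ j) ℤ.* (M Fin.zero j ℤ.* detℤ n (minor M j))) ⟨
  detℤ (suc n) M ℤ.* D δ                              ∎
  where
  open ≡-Reasoning
  open Alternating alt
  rearrange : ∀ a b c d → a ℤ.* (b ℤ.* (c ℤ.* d)) ≡ c ℤ.* (a ℤ.* b) ℤ.* d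
  rearrange = solve-∀

-- The Laplace expansion is alternating and multiplicative

det-congruent : ∀ n (M M′ : Mat n) → (∀ i j → M i j ≡ M′ i j) → detℤ n M ≡ detℤ n M′
det-congruent zero    M M′ e = refl
det-congruent (suc n) M M′ e = sum-cong-≗ λ j → cong (sgn (toℕ j) ℤ.*_)
  (cong₂ ℤ._*_ (e Fin.zero j) (det-congruent n _ _ λ r c → e (Fin.suc r) (punchIn j c)))

det-linear : ∀ n i c (M M₁ M₂ : Mat n) →
  (∀ r → r ≢ i → ∀ j → M r j ≡ M₁ r j) →
  (∀ r → r ≢ i → ∀ j → M r j ≡ M₂ r j) →
  (∀ j → M i j ≡ M₁ i j ℤ.+ c ℤ.* M₂ i j) →
  detℤ n M ≡ detℤ n M₁ ℤ.+ c ℤ.* detℤ n M₂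
det-linear (suc n) i c M M₁ M₂ o₁ o₂ e = trans (sum-cong-≗ (λ j → term i j o₁ o₂ e))
  (sum-linear c (λ j → sgn (toℕ j) ℤ.* (M₁ Fin.zero j ℤ.* detℤ n (minor M₁ j)))
                (λ j → sgn (toℕ j) ℤ.* (M₂ Fin.zero j ℤ.* detℤ n (minor M₂ j))))
  where
  open ≡-Reasoning
  id₀ : ∀ s a b c m → s ℤ.* ((a ℤ.+ c ℤ.* b) ℤ.* m) ≡ s ℤ.* (a ℤ.* m) ℤ.+ c ℤ.* (s ℤ.* (b ℤ.* m))
  id₀ = solve-∀
  id₁ : ∀ s a m m′ c → s ℤ.* (a ℤ.* (m ℤ.+ c ℤ.* m′)) ≡ s ℤ.* (a ℤ.* m) ℤ.+ c ℤ.* (s ℤ.* (a ℤ.* m′))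
  id₁ = solve-∀
  term : ∀ i j →
    (∀ r → r ≢ i → ∀ j → M r j ≡ M₁ r j) →
    (∀ r → r ≢ i → ∀ j → M r j ≡ M₂ r j) →
    (∀ j → M i j ≡ M₁ i j ℤ.+ c ℤ.* M₂ i j) →
    sgn (toℕ j) ℤ.* (M Fin.zero j ℤ.* detℤ n (minor M j)) ≡
    sgn (toℕ j) ℤ.* (M₁ Fin.zero j ℤ.* detℤ n (minor M₁ j)) ℤ.+
    c ℤ.* (sgn (toℕ j) ℤ.* (M₂ Fin.zero j ℤ.* detℤ n (minor M₂ j)))
  term Fin.zero j o₁ o₂ e = begin
    s ℤ.* (M Fin.zero j ℤ.* m)                                      ≡⟨ cong (λ x → s ℤ.* (x ℤ.* m)) (e j) ⟩
    s ℤ.* ((a ℤ.+ c ℤ.* b) ℤ.* m)                                   ≡⟨ id₀ s a b c m ⟩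
    s ℤ.* (a ℤ.* m) ℤ.+ c ℤ.* (s ℤ.* (b ℤ.* m))
      ≡⟨ cong₂ (λ x y → s ℤ.* (a ℤ.* x) ℤ.+ c ℤ.* (s ℤ.* (b ℤ.* y)))
           (det-congruent n _ _ λ r k → o₁ (Fin.suc r) (λ ()) (punchIn j k))
           (det-congruent n _ _ λ r k → o₂ (Fin.suc r) (λ ()) (punchIn j k)) ⟩
    _ ∎
    where
    s = sgn (toℕ j)
    a = M₁ Fin.zero j
    b = M₂ Fin.zero j
    m = detℤ n (minor M j)
  term (Fin.suc i) j o₁ o₂ e = begin
    s ℤ.* (M Fin.zero j ℤ.* detℤ n (minor M j))
      ≡⟨ cong₂ (λ x y → s ℤ.* (x ℤ.* y)) (o₁ Fin.zero (λ ()) j)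
           (det-linear n i c (minor M j) (minor M₁ j) (minor M₂ j)
             (λ r r≢i k → o₁ (Fin.suc r) (r≢i ∘ Fin.suc-injective) _)
             (λ r r≢i k → o₂ (Fin.suc r) (r≢i ∘ Fin.suc-injective) _)
             (λ k → e _)) ⟩
    s ℤ.* (M₁ Fin.zero j ℤ.* (m₁ ℤ.+ c ℤ.* m₂))                     ≡⟨ id₁ s (M₁ Fin.zero j) m₁ m₂ c ⟩
    s ℤ.* (M₁ Fin.zero j ℤ.* m₁) ℤ.+ c ℤ.* (s ℤ.* (M₁ Fin.zero j ℤ.* m₂))
      ≡⟨ cong (λ x → s ℤ.* (M₁ Fin.zero j ℤ.* m₁) ℤ.+ c ℤ.* (s ℤ.* (x ℤ.* m₂)))
           (trans (sym (o₁ Fin.zero (λ ()) j)) (o₂ Fin.zero (λ ()) j)) ⟩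
    _ ∎
    where
    s = sgn (toℕ j)
    m₁ = detℤ n (minor M₁ j)
    m₂ = detℤ n (minor M₂ j)

doubleSum-cancel : ∀ {n} (t : Fin (suc (suc n)) → Fin (suc n) → ℤ) →
  (∀ k → t Fin.zero k ℤ.+ t (Fin.suc k) Fin.zero ≡ 0ℤ) →
  sum (λ j → sum (λ k → t (Fin.suc j) (Fin.suc k))) ≡ 0ℤ →
  sum (λ j → sum (t j)) ≡ 0ℤ
doubleSum-cancel t cancel inner = begin
  row₀ ℤ.+ sum (λ j → t (Fin.suc j) Fin.zero ℤ.+ sum (λ k → t (Fin.suc j) (Fin.suc k)))
    ≡⟨ cong (ℤ._+_ row₀) (∑-distrib-+ (λ j → t (Fin.suc j) Fin.zero) (λ j → sum (λ k → t (Fin.suc j) (Fin.suc k)))) ⟩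
  row₀ ℤ.+ (column₀ ℤ.+ sum (λ j → sum (λ k → t (Fin.suc j) (Fin.suc k))))
    ≡⟨ cong (λ x → row₀ ℤ.+ (column₀ ℤ.+ x)) inner ⟩
  row₀ ℤ.+ (column₀ ℤ.+ 0ℤ)   ≡⟨ cong (ℤ._+_ row₀) (ℤ.+-identityʳ column₀) ⟩
  row₀ ℤ.+ column₀            ≡⟨ ∑-distrib-+ (t Fin.zero) (λ j → t (Fin.suc j) Fin.zero) ⟨
  sum (λ k → t Fin.zero k ℤ.+ t (Fin.suc k) Fin.zero) ≡⟨ sum-zero cancel ⟩
  0ℤ                          ∎
  where
  open ≡-Reasoning
  row₀ = sum (t Fin.zero)
  column₀ = sum (λ j → t (Fin.suc j) Fin.zero)

-- The double Laplace expansion along two equal rows w.  The terms for the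
-- columns (0 , suc k) and (suc k , 0) cancel; the others are an instance with
-- column 0 removed from w and kept among the columns passed to E.
expansionTerm : ∀ {n} (w : Row (suc (suc n))) (E : (Fin n → Fin (suc (suc n))) → ℤ) →
                Fin (suc (suc n)) → Fin (suc n) → ℤ
expansionTerm w E j k =
  sgn (toℕ j) ℤ.* (w j ℤ.* (sgn (toℕ k) ℤ.* (w (punchIn j k) ℤ.* E (λ c → punchIn j (punchIn k c)))))

equalRows-cancel : ∀ n (w : Row (suc (suc n))) (E : (Fin n → Fin (suc (suc n))) → ℤ) →
  (∀ {g h} → (∀ c → g c ≡ h c) → E g ≡ E h) →
  sum (λ j → sum (expansionTerm w E j)) ≡ 0ℤ
equalRows-cancel n w E E-cong = doubleSum-cancel (expansionTerm w E)
  (λ k → cancel (w Fin.zero) (w (Fin.suc k)) (sgn (toℕ k)) (E (λ c → Fin.suc (punchIn k c)))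
    {sgn (toℕ {suc (suc n)} Fin.zero)} {sgn (toℕ {suc n} Fin.zero)} {sgn (toℕ (Fin.suc k))}
    {w (punchIn (Fin.suc k) Fin.zero)} {w (Fin.suc k)}
    {E (λ c → punchIn (Fin.suc k) (punchIn Fin.zero c))} refl refl refl refl refl refl)
  (inner n w E E-cong)
  where
  ident : ∀ a b s e → 1ℤ ℤ.* (a ℤ.* (s ℤ.* (b ℤ.* e))) ℤ.+ (ℤ.- s) ℤ.* (b ℤ.* (1ℤ ℤ.* (a ℤ.* e))) ≡ 0ℤ
  ident = solve-∀
  -- Stated factor by factor: unifying whole products unfolds integer multiplication.
  cancel : ∀ a b s e {t t′ s′ a′ b′ e′} → t ≡ 1ℤ → t′ ≡ 1ℤ → s′ ≡ ℤ.- s → a′ ≡ a → b′ ≡ b → e′ ≡ e →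
    t ℤ.* (a ℤ.* (s ℤ.* (b ℤ.* e))) ℤ.+ s′ ℤ.* (b′ ℤ.* (t′ ℤ.* (a′ ℤ.* e′))) ≡ 0ℤ
  cancel a b s e refl refl refl refl refl refl = ident a b s e
  signs : ∀ s a s′ x → (ℤ.- s) ℤ.* (a ℤ.* ((ℤ.- s′) ℤ.* x)) ≡ s ℤ.* (a ℤ.* (s′ ℤ.* x))
  signs = solve-∀
  inner-term : ∀ {s a s′ b e t t′ e′} → t ≡ ℤ.- s → t′ ≡ ℤ.- s′ → e ≡ e′ →
    t ℤ.* (a ℤ.* (t′ ℤ.* (b ℤ.* e))) ≡ s ℤ.* (a ℤ.* (s′ ℤ.* (b ℤ.* e′)))
  inner-term {s} {a} {s′} {b} {e} refl refl refl = signs s a s′ (b ℤ.* e)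
  inner : ∀ n (w : Row (suc (suc n))) (E : (Fin n → Fin (suc (suc n))) → ℤ) →
    (∀ {g h} → (∀ c → g c ≡ h c) → E g ≡ E h) →
    sum {suc n} (λ j → sum {n} (λ k → expansionTerm w E (Fin.suc j) (Fin.suc k))) ≡ 0ℤ
  inner zero    w E E-cong = refl
  inner (suc n) w E E-cong = trans
    (sum-cong-≗ {x = λ j → sum (λ k → expansionTerm w E (Fin.suc j) (Fin.suc k))}
                {y = λ j → sum (expansionTerm w′ E′ j)}
      λ j → sum-cong-≗ {x = λ k → expansionTerm w E (Fin.suc j) (Fin.suc k)} {y = expansionTerm w′ E′ j}
      λ k → inner-term
      {sgn (toℕ j)} {w (Fin.suc j)} {sgn (toℕ k)} {w (Fin.suc (punchIn j k))}
      {E (λ c → punchIn (Fin.suc j) (punchIn (Fin.suc k) c))}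
      {sgn (toℕ (Fin.suc j))} {sgn (toℕ (Fin.suc k))} refl refl
      (E-cong λ { Fin.zero → refl ; (Fin.suc c) → refl }))
    (equalRows-cancel n w′ E′
      λ e → E-cong λ { Fin.zero → refl ; (Fin.suc c) → cong Fin.suc (e c) })
    where
    w′ = w ∘ Fin.suc
    E′ : (Fin n → Fin (suc (suc n))) → ℤ
    E′ g = E (Fin.zero ◂ Fin.suc ∘ g)

det-equal-first-rows : ∀ n (M : Mat (suc (suc n))) →
  (∀ j → M Fin.zero j ≡ M (Fin.suc Fin.zero) j) → detℤ (suc (suc n)) M ≡ 0ℤ
det-equal-first-rows n M e = trans
  (sum-cong-≗ λ j → begin
    sgn (toℕ j) ℤ.* (w j ℤ.* sum (λ k → sgn (toℕ k) ℤ.* (M (Fin.suc Fin.zero) (punchIn j k) ℤ.* E (λ c → punchIn j (punchIn k c)))))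
      ≡⟨ cong (λ x → sgn (toℕ j) ℤ.* (w j ℤ.* x))
           (sum-cong-≗ λ k → cong (λ x → sgn (toℕ k) ℤ.* (x ℤ.* E (λ c → punchIn j (punchIn k c)))) (sym (e (punchIn j k)))) ⟩
    sgn (toℕ j) ℤ.* (w j ℤ.* sum (λ k → sgn (toℕ k) ℤ.* (w (punchIn j k) ℤ.* E (λ c → punchIn j (punchIn k c)))))
      ≡⟨ cong (sgn (toℕ j) ℤ.*_) (*-distribˡ-sum (w j) (λ k → sgn (toℕ k) ℤ.* (w (punchIn j k) ℤ.* E (λ c → punchIn j (punchIn k c))))) ⟩
    sgn (toℕ j) ℤ.* sum (λ k → w j ℤ.* (sgn (toℕ k) ℤ.* (w (punchIn j k) ℤ.* E (λ c → punchIn j (punchIn k c)))))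
      ≡⟨ *-distribˡ-sum (sgn (toℕ j)) (λ k → w j ℤ.* (sgn (toℕ k) ℤ.* (w (punchIn j k) ℤ.* E (λ c → punchIn j (punchIn k c))))) ⟩
    _ ∎)
  (equalRows-cancel n w E λ g≗h → det-congruent n _ _ λ r c → cong (M (Fin.suc (Fin.suc r))) (g≗h c))
  where
  open ≡-Reasoning
  w = M Fin.zero
  E : (Fin n → Fin (suc (suc n))) → ℤ
  E g = detℤ n λ r c → M (Fin.suc (Fin.suc r)) (g c)

module _ {n : ℕ} (alt : Alternating (detℤ n)) where
  open ≡-Reasoning

  private
    later-rows : ∀ r s → r ≢ s → ∀ M → (∀ j → M (Fin.suc r) j ≡ M (Fin.suc s) j) → detℤ (suc n) M ≡ 0ℤ
    later-rows r s r≢s M e = sum-zero λ j → begin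
      sgn (toℕ j) ℤ.* (M Fin.zero j ℤ.* detℤ n (minor M j))
        ≡⟨ cong (λ x → sgn (toℕ j) ℤ.* (M Fin.zero j ℤ.* x))
             (Alternating.alternating alt r s r≢s (minor M j) λ k → e _) ⟩
      sgn (toℕ j) ℤ.* (M Fin.zero j ℤ.* 0ℤ)  ≡⟨ cong (sgn (toℕ j) ℤ.*_) (ℤ.*-zeroʳ (M Fin.zero j)) ⟩
      sgn (toℕ j) ℤ.* 0ℤ                     ≡⟨ ℤ.*-zeroʳ (sgn (toℕ j)) ⟩
      0ℤ                                     ∎

  -- Exchanging the later row with the second one reduces to equal first two rows. The exchange
  -- takes place inside every minor, where the smaller determinant is already known to be
  -- antisymmetric.
  first-and-later : ∀ s M → (∀ j → M Fin.zero j ≡ M (Fin.suc s) j) → detℤ (suc n) M ≡ 0ℤ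
  first-and-later Fin.zero    M e = det-equal-first-rows _ M e
  first-and-later (Fin.suc s) M e = begin
    detℤ (suc n) M
      ≡⟨ sum-cong-≗ {x = λ j → sgn (toℕ j) ℤ.* (M Fin.zero j ℤ.* detℤ n (minor M j))}
                    {y = λ j → ℤ.-1ℤ ℤ.* (sgn (toℕ j) ℤ.* (M Fin.zero j ℤ.* detℤ n (minor M′ j)))}
           (λ j → trans
             (cong (λ x → sgn (toℕ j) ℤ.* (M Fin.zero j ℤ.* x)) (swap-minor j))
             (pull (sgn (toℕ j)) (M Fin.zero j) (detℤ n (minor M′ j)))) ⟩
    sum (λ j → ℤ.-1ℤ ℤ.* (sgn (toℕ j) ℤ.* (M Fin.zero j ℤ.* detℤ n (minor M′ j))))
      ≡⟨ *-distribˡ-sum ℤ.-1ℤ (λ j → sgn (toℕ j) ℤ.* (M Fin.zero j ℤ.* detℤ n (minor M′ j))) ⟨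
    ℤ.-1ℤ ℤ.* detℤ (suc n) M′       ≡⟨ cong (ℤ.-1ℤ ℤ.*_) (det-equal-first-rows _ M′ e) ⟩
    ℤ.-1ℤ ℤ.* 0ℤ                    ≡⟨⟩
    0ℤ                              ∎
    where
    π : Fin n → Fin n
    π = updateAt (Fin.suc s ◂ Fin.suc) (Fin.suc s) (const Fin.zero)
    M′ : Mat (suc n)
    M′ = M Fin.zero ◂ λ r → M (Fin.suc (π r))
    π-other : ∀ t → t ≢ Fin.zero → t ≢ Fin.suc s → π t ≡ t
    π-other Fin.zero    t≢0 _   = contradiction refl t≢0
    π-other (Fin.suc t) _   t≢s = updateAt-minimal (Fin.suc t) (Fin.suc s) (Fin.suc s ◂ Fin.suc) t≢s
    swap-minor : ∀ j → detℤ n (minor M j) ≡ ℤ.- detℤ n (minor M′ j)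
    swap-minor j = AlternatingProperties.antisymmetric alt {Fin.zero} {Fin.suc s} (λ ()) _ _
      (λ k → refl)
      (λ k → cong (λ t → M (Fin.suc t) (punchIn j k)) (updateAt-updates (Fin.suc s) (Fin.suc s ◂ Fin.suc)))
      (λ t t≢0 t≢s k → cong (λ t → M (Fin.suc t) (punchIn j k)) (π-other t t≢0 t≢s))
    pull : ∀ s a d → s ℤ.* (a ℤ.* (ℤ.- d)) ≡ ℤ.-1ℤ ℤ.* (s ℤ.* (a ℤ.* d))
    pull = solve-∀

  equalRows-vanish : ∀ r s → r ≢ s → ∀ M → (∀ j → M r j ≡ M s j) → detℤ (suc n) M ≡ 0ℤ
  equalRows-vanish Fin.zero    Fin.zero    r≢s M e = contradiction refl r≢s
  equalRows-vanish Fin.zero    (Fin.suc s) r≢s M e = first-and-later s M e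
  equalRows-vanish (Fin.suc r) Fin.zero    r≢s M e = first-and-later r M (sym ∘ e)
  equalRows-vanish (Fin.suc r) (Fin.suc s) r≢s M e = later-rows r s (r≢s ∘ cong Fin.suc) M e

det-alternating : ∀ n → Alternating (detℤ n)
det-alternating n = record
  { congruent   = det-congruent n
  ; linear      = det-linear n
  ; alternating = vanish n
  }
  where
  vanish : ∀ n r s → r ≢ s → ∀ (M : Mat n) → (∀ j → M r j ≡ M s j) → detℤ n M ≡ 0ℤ
  vanish (suc n) = equalRows-vanish (det-alternating n)

infixl 7 _⊗_
_⊗_ : ∀ {n} → Mat n → Mat n → Mat n
(M ⊗ N) i j = sum λ k → M i k ℤ.* N k j

-- For fixed `N` the left side is alternating in `M` and takes the value det N at the identity, so
-- uniqueness determines it.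
det-⊗ : ∀ n (M N : Mat n) → detℤ n (M ⊗ N) ≡ detℤ n M ℤ.* detℤ n N
det-⊗ n M N = trans (alternating-unique n (λ M → detℤ n (M ⊗ N)) alt M)
  (cong (detℤ n M ℤ.*_) (det-congruent n _ _ λ i j → sum-δ i (λ k → N k j)))
  where
  open Alternating (det-alternating n)
  distrib : ∀ a b c x → (a ℤ.+ c ℤ.* b) ℤ.* x ≡ a ℤ.* x ℤ.+ c ℤ.* (b ℤ.* x)
  distrib = solve-∀
  alt : Alternating (λ M → detℤ n (M ⊗ N))
  alt = record
    { congruent   = λ M M′ e → congruent _ _ λ i j → sum-cong-≗ λ k → cong (ℤ._* N k j) (e i k)
    ; linear      = λ i c M M₁ M₂ o₁ o₂ e → linear i c _ _ _
        (λ r r≢i j → sum-cong-≗ λ k → cong (ℤ._* N k j) (o₁ r r≢i k))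
        (λ r r≢i j → sum-cong-≗ λ k → cong (ℤ._* N k j) (o₂ r r≢i k))
        (λ j → trans (sum-cong-≗ λ k → trans (cong (ℤ._* N k j) (e k)) (distrib (M₁ i k) (M₂ i k) c (N k j)))
                     (sum-linear c (λ k → M₁ i k ℤ.* N k j) (λ k → M₂ i k ℤ.* N k j)))
    ; alternating = λ r s r≢s M e → alternating r s r≢s _ λ j → sum-cong-≗ λ k → cong (ℤ._* N k j) (e k)
    }

det-scalar : ∀ n h → detℤ n (λ i j → h ℤ.* δ i j) ≡ h ℤ.^ n
det-scalar zero    h = refl
det-scalar (suc n) h = begin
  1ℤ ℤ.* (h ℤ.* 1ℤ ℤ.* detℤ n (λ i j → h ℤ.* δ i j)) ℤ.+ sum rest ≡⟨ cong₂ ℤ._+_ (id₀ h _) (sum-zero {f = rest} λ j → id₁ (sgn (toℕ (Fin.suc j))) h (detℤ n (minor (λ i j → h ℤ.* δ i j) (Fin.suc j)))) ⟩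
  h ℤ.* detℤ n (λ i j → h ℤ.* δ i j) ℤ.+ 0ℤ                       ≡⟨ ℤ.+-identityʳ _ ⟩
  h ℤ.* detℤ n (λ i j → h ℤ.* δ i j)                              ≡⟨ cong (h ℤ.*_) (det-scalar n h) ⟩
  h ℤ.* h ℤ.^ n                                                   ∎
  where
  open ≡-Reasoning
  rest : Fin n → ℤ
  rest j = sgn (toℕ (Fin.suc j)) ℤ.* (h ℤ.* 0ℤ ℤ.* detℤ n (minor (λ i j → h ℤ.* δ i j) (Fin.suc j)))
  id₀ : ∀ h d → 1ℤ ℤ.* (h ℤ.* 1ℤ ℤ.* d) ≡ h ℤ.* d
  id₀ = solve-∀
  id₁ : ∀ s h d → s ℤ.* (h ℤ.* 0ℤ ℤ.* d) ≡ 0ℤ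
  id₁ = solve-∀

-- Polynomial functions on ℤ

evalP : Poly → ℤ → ℤ
evalP []      z = 0ℤ
evalP (a ∷ p) z = a ℤ.+ z ℤ.* evalP p z

module _ (z : ℤ) where
  open ≡-Reasoning

  evalP-+ : ∀ p q → evalP (p +ₚ q) z ≡ evalP p z ℤ.+ evalP q z
  evalP-+ []      q       = sym (ℤ.+-identityˡ _)
  evalP-+ (a ∷ p) []      = sym (ℤ.+-identityʳ _)
  evalP-+ (a ∷ p) (b ∷ q) = trans (cong (λ x → a ℤ.+ b ℤ.+ z ℤ.* x) (evalP-+ p q))
    (ident a b z (evalP p z) (evalP q z))
    where
    ident : ∀ a b z x y → a ℤ.+ b ℤ.+ z ℤ.* (x ℤ.+ y) ≡ (a ℤ.+ z ℤ.* x) ℤ.+ (b ℤ.+ z ℤ.* y)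
    ident = solve-∀

  evalP-scale : ∀ c p → evalP (scaleₚ c p) z ≡ c ℤ.* evalP p z
  evalP-scale c []      = sym (ℤ.*-zeroʳ c)
  evalP-scale c (a ∷ p) = trans (cong (λ x → c ℤ.* a ℤ.+ z ℤ.* x) (evalP-scale c p)) (ident c a z (evalP p z))
    where
    ident : ∀ c a z x → c ℤ.* a ℤ.+ z ℤ.* (c ℤ.* x) ≡ c ℤ.* (a ℤ.+ z ℤ.* x)
    ident = solve-∀

  evalP-* : ∀ p q → evalP (p *ₚ q) z ≡ evalP p z ℤ.* evalP q z
  evalP-* []      q = refl
  evalP-* (a ∷ p) q = begin
    evalP (scaleₚ a q +ₚ (0ℤ ∷ (p *ₚ q))) z                 ≡⟨ evalP-+ (scaleₚ a q) (0ℤ ∷ (p *ₚ q)) ⟩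
    evalP (scaleₚ a q) z ℤ.+ (0ℤ ℤ.+ z ℤ.* evalP (p *ₚ q) z) ≡⟨ cong₂ (λ x y → x ℤ.+ (0ℤ ℤ.+ z ℤ.* y)) (evalP-scale a q) (evalP-* p q) ⟩
    a ℤ.* evalP q z ℤ.+ (0ℤ ℤ.+ z ℤ.* (evalP p z ℤ.* evalP q z)) ≡⟨ ident a (evalP q z) z (evalP p z) ⟩
    (a ℤ.+ z ℤ.* evalP p z) ℤ.* evalP q z                   ∎
    where
    ident : ∀ a y z x → a ℤ.* y ℤ.+ (0ℤ ℤ.+ z ℤ.* (x ℤ.* y)) ≡ (a ℤ.+ z ℤ.* x) ℤ.* y
    ident = solve-∀

  evalP-neg : ∀ p → evalP (-ₚ p) z ≡ ℤ.- evalP p z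
  evalP-neg []      = refl
  evalP-neg (a ∷ p) = trans (cong (λ x → ℤ.- a ℤ.+ z ℤ.* x) (evalP-neg p)) (ident a z (evalP p z))
    where
    ident : ∀ a z x → ℤ.- a ℤ.+ z ℤ.* (ℤ.- x) ≡ ℤ.- (a ℤ.+ z ℤ.* x)
    ident = solve-∀

  evalP-- : ∀ p q → evalP (p -ₚ q) z ≡ evalP p z ℤ.- evalP q z
  evalP-- p q = trans (evalP-+ p (-ₚ q)) (cong (ℤ._+_ (evalP p z)) (evalP-neg q))

  evalP-const : ∀ c → evalP (constₚ c) z ≡ c
  evalP-const c = trans (cong (ℤ._+_ c) (ℤ.*-zeroʳ z)) (ℤ.+-identityʳ c)

  evalP-X : evalP Xₚ z ≡ z
  evalP-X = ident z
    where
    ident : ∀ z → 0ℤ ℤ.+ z ℤ.* (1ℤ ℤ.+ z ℤ.* 0ℤ) ≡ z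
    ident = solve-∀

  evalP-sign : ∀ j → evalP (signₚ j) z ≡ sgn j
  evalP-sign zero          = evalP-const 1ℤ
  evalP-sign (suc zero)    = evalP-const ℤ.-1ℤ
  evalP-sign (suc (suc j)) = trans (evalP-sign j) (sym (ℤ.neg-involutive (sgn j)))

  evalP-sumFin : ∀ n f → evalP (sumFin n f) z ≡ sum (λ i → evalP (f i) z)
  evalP-sumFin zero    f = refl
  evalP-sumFin (suc n) f = trans (evalP-+ (f Fin.zero) (sumFin n (f ∘ Fin.suc)))
    (cong (ℤ._+_ (evalP (f Fin.zero) z)) (evalP-sumFin n (f ∘ Fin.suc)))

  evalP-det : ∀ n M → evalP (det n M) z ≡ detℤ n (λ i j → evalP (M i j) z)
  evalP-det zero    M = evalP-const 1ℤ
  evalP-det (suc n) M = trans (evalP-sumFin (suc n) λ j → signₚ (toℕ j) *ₚ (M Fin.zero j *ₚ det n (minorₚ j)))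
    (sum-cong-≗ {x = λ j → evalP (signₚ (toℕ j) *ₚ (M Fin.zero j *ₚ det n (minorₚ j))) z}
                {y = λ j → sgn (toℕ j) ℤ.* (evalP (M Fin.zero j) z ℤ.* detℤ n (λ r c → evalP (minorₚ j r c) z))}
      λ j → trans (evalP-* (signₚ (toℕ j)) (M Fin.zero j *ₚ det n (minorₚ j))) (cong₂ ℤ._*_ (evalP-sign (toℕ j))
        (trans (evalP-* (M Fin.zero j) (det n (minorₚ j))) (cong (ℤ._*_ (evalP (M Fin.zero j) z)) (evalP-det n (minorₚ j))))))
    where
    minorₚ : Fin (suc n) → Fin n → Fin n → Poly
    minorₚ j r c = M (Fin.suc r) (punchIn j c)

prodℤ : ∀ n → (Fin n → ℤ) → ℤ
prodℤ zero    f = 1ℤ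
prodℤ (suc n) f = f Fin.zero ℤ.* prodℤ n (f ∘ Fin.suc)

evalP-prodFin-linear : ∀ z n (ev : Fin n → ℤ) →
  evalP (prodFin n (λ i → Xₚ -ₚ constₚ (ev i))) z ≡ prodℤ n (λ i → z ℤ.- ev i)
evalP-prodFin-linear z zero    ev = evalP-const z 1ℤ
evalP-prodFin-linear z (suc n) ev = trans (evalP-* z (Xₚ -ₚ constₚ (ev Fin.zero)) (prodFin n (λ i → Xₚ -ₚ constₚ (ev (Fin.suc i)))))
  (cong₂ ℤ._*_ (trans (evalP-- z Xₚ (constₚ (ev Fin.zero))) (cong₂ ℤ._-_ (evalP-X z) (evalP-const z (ev Fin.zero))))
               (evalP-prodFin-linear z n (ev ∘ Fin.suc)))

-- Unification recovers the function diag local to charPoly.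
mutual
  charPolyDiagonal : ∀ n → (Fin n → Fin n → ℤ) → Fin n → Fin n → Poly
  charPolyDiagonal = _

  charPoly-unfold : ∀ n A → charPoly n A ≡ det n (λ i j → charPolyDiagonal n A i j -ₚ constₚ (A i j))
  charPoly-unfold n A = refl

evalP-charPoly : ∀ z n A → evalP (charPoly n A) z ≡ detℤ n (λ i j → z ℤ.* δ i j ℤ.- A i j)
evalP-charPoly z n A = trans (evalP-det z n _) (det-congruent n _ _ λ i j →
  trans (evalP-- z (charPolyDiagonal n A i j) (constₚ (A i j))) (cong₂ ℤ._-_ (diagonal i j) (evalP-const z (A i j))))
  where
  diagonal : ∀ i j → evalP (charPolyDiagonal n A i j) z ≡ z ℤ.* δ i j
  diagonal i j with i Fin.≟ j
  ... | yes refl = trans (evalP-X z) (trans (sym (ℤ.*-identityʳ z)) (cong (z ℤ.*_) (sym (δ-diagonal i))))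
  ... | no i≢j   = trans (sym (ℤ.*-zeroʳ z)) (cong (z ℤ.*_) (sym (δ-off-diagonal i≢j)))

module _ where
  open ≡-Reasoning

  private
    -- At a point n > ∣a∣ the hypothesis makes n divide a, which forces a = 0.
    constant-term-zero : ∀ N a (f : ℤ → ℤ) → (∀ n → N ≤ n → a ℤ.+ + n ℤ.* f (+ n) ≡ 0ℤ) → a ≡ 0ℤ
    constant-term-zero N a f vanish = ℤ.∣i∣≡0⇒i≡0 (small ∣ f (+ n) ∣ abs-eq)
      where
      n = suc ∣ a ∣ ℕ.+ N
      ident : ∀ a x → a ≡ (a ℤ.+ x) ℤ.- x
      ident = solve-∀
      a≡ : a ≡ ℤ.- (+ n ℤ.* f (+ n))
      a≡ = trans (ident a (+ n ℤ.* f (+ n)))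
        (trans (cong (ℤ._- (+ n ℤ.* f (+ n))) (vanish n (ℕ.m≤n+m N (suc ∣ a ∣)))) (ℤ.+-identityˡ _))
      abs-eq : ∣ a ∣ ≡ n ℕ.* ∣ f (+ n) ∣
      abs-eq = trans (cong ∣_∣ a≡) (trans (ℤ.∣-i∣≡∣i∣ (+ n ℤ.* f (+ n))) (ℤ.abs-* (+ n) (f (+ n))))
      small : ∀ m → ∣ a ∣ ≡ n ℕ.* m → ∣ a ∣ ≡ 0
      small zero    e = trans e (ℕ.*-zeroʳ n)
      small (suc m) e = contradiction (ℕ.≤-trans (ℕ.≤-trans (ℕ.m≤m+n (suc ∣ a ∣) N) (ℕ.m≤m*n n (suc m))) (ℕ.≤-reflexive (sym e)))
                          ℕ.1+n≰n

  -- Vanishing is assumed only from `N` on because passing to the tail divides by the argument: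
  -- raising the bound to `suc N` keeps that argument nonzero.
  coeff-zero : ∀ p N → (∀ n → N ≤ n → evalP p (+ n) ≡ 0ℤ) → ∀ m → coeff p m ≡ 0ℤ
  coeff-zero []      N vanish m       = refl
  coeff-zero (a ∷ p) N vanish zero    = constant-term-zero N a (evalP p) vanish
  coeff-zero (a ∷ p) N vanish (suc m) = coeff-zero p (suc N) tail-vanish m
    where
    tail-vanish : ∀ n → suc N ≤ n → evalP p (+ n) ≡ 0ℤ
    tail-vanish (suc n) (ℕ.s≤s N≤n) = case ℤ.i*j≡0⇒i≡0∨j≡0 (+ suc n) product-zero of λ where
        (inj₁ ())
        (inj₂ e) → e
      where
      product-zero : + suc n ℤ.* evalP p (+ suc n) ≡ 0ℤ
      product-zero = begin
        + suc n ℤ.* evalP p (+ suc n)                ≡⟨ ℤ.+-identityˡ _ ⟨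
        0ℤ ℤ.+ + suc n ℤ.* evalP p (+ suc n)         ≡⟨ cong (ℤ._+ (+ suc n ℤ.* evalP p (+ suc n))) (constant-term-zero N a (evalP p) vanish) ⟨
        a ℤ.+ + suc n ℤ.* evalP p (+ suc n)          ≡⟨ vanish (suc n) (ℕ.≤-trans N≤n (ℕ.n≤1+n n)) ⟩
        0ℤ                                           ∎

evalP-coeff-zero : ∀ p → (∀ m → coeff p m ≡ 0ℤ) → ∀ z → evalP p z ≡ 0ℤ
evalP-coeff-zero []      e z = refl
evalP-coeff-zero (a ∷ p) e z = trans
  (cong₂ (λ x y → x ℤ.+ z ℤ.* y) (e 0) (evalP-coeff-zero p (e ∘ suc) z)) (trans (ℤ.+-identityˡ _) (ℤ.*-zeroʳ z))

coeff-+ : ∀ p q m → coeff (p +ₚ q) m ≡ coeff p m ℤ.+ coeff q m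
coeff-+ []      q       m       = sym (ℤ.+-identityˡ _)
coeff-+ (a ∷ p) []      m       = sym (ℤ.+-identityʳ _)
coeff-+ (a ∷ p) (b ∷ q) zero    = refl
coeff-+ (a ∷ p) (b ∷ q) (suc m) = coeff-+ p q m

coeff-neg : ∀ p m → coeff (-ₚ p) m ≡ ℤ.- coeff p m
coeff-neg []      m       = refl
coeff-neg (a ∷ p) zero    = refl
coeff-neg (a ∷ p) (suc m) = coeff-neg p m

coeff-unique : ∀ p q → (∀ z → evalP p z ≡ evalP q z) → ∀ m → coeff p m ≡ coeff q m
coeff-unique p q e m = ℤ.i-j≡0⇒i≡j _ _ (trans
  (sym (trans (coeff-+ p (-ₚ q) m) (cong (ℤ._+_ (coeff p m)) (coeff-neg q m))))
  (coeff-zero (p -ₚ q) 0 (λ n _ → trans (evalP-- (+ n) p q) (ℤ.i≡j⇒i-j≡0 (e (+ n)))) m))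

-- Lets functions such as z ↦ det (B z) be compared on large arguments only, without carrying
-- explicit coefficient lists through the computation.
IsPoly : (ℤ → ℤ) → Set
IsPoly f = ∃ λ p → ∀ z → f z ≡ evalP p z

isPoly-const : ∀ c → IsPoly (λ _ → c)
isPoly-const c = constₚ c , λ z → sym (evalP-const z c)

isPoly-id : IsPoly (λ z → z)
isPoly-id = Xₚ , λ z → sym (evalP-X z)

isPoly-+ : ∀ {f g} → IsPoly f → IsPoly g → IsPoly (λ z → f z ℤ.+ g z)
isPoly-+ (p , f≡p) (q , g≡q) = p +ₚ q , λ z → trans (cong₂ ℤ._+_ (f≡p z) (g≡q z)) (sym (evalP-+ z p q))

isPoly-* : ∀ {f g} → IsPoly f → IsPoly g → IsPoly (λ z → f z ℤ.* g z)
isPoly-* (p , f≡p) (q , g≡q) = p *ₚ q , λ z → trans (cong₂ ℤ._*_ (f≡p z) (g≡q z)) (sym (evalP-* z p q))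

isPoly-- : ∀ {f g} → IsPoly f → IsPoly g → IsPoly (λ z → f z ℤ.- g z)
isPoly-- (p , f≡p) (q , g≡q) = p -ₚ q , λ z → trans (cong₂ ℤ._-_ (f≡p z) (g≡q z)) (sym (evalP-- z p q))

isPoly-det : ∀ n (M : ℤ → Mat n) → (∀ i j → IsPoly (λ z → M z i j)) → IsPoly (λ z → detℤ n (M z))
isPoly-det n M poly = det n (λ i j → proj₁ (poly i j)) , λ z →
  trans (det-congruent n _ _ λ i j → proj₂ (poly i j) z) (sym (evalP-det z n _))

isPoly-zero : ∀ {f} → IsPoly f → ∀ N → (∀ n → N ≤ n → f (+ n) ≡ 0ℤ) → ∀ z → f z ≡ 0ℤ
isPoly-zero (p , f≡p) N vanish z =
  trans (f≡p z) (evalP-coeff-zero p (coeff-zero p N λ n N≤n → trans (sym (f≡p (+ n))) (vanish n N≤n)) z)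

-- Polynomial functions of given formal degree and leading coefficient

evalTop : ∀ {n} → Vec ℤ n → ℤ → ℤ → ℤ
evalTop []       c z = c
evalTop (a ∷ as) c z = a ℤ.+ z ℤ.* evalTop as c z

-- The leading coefficient `c` may be 0, so the class is closed under addition and under raising the
-- formal degree. For c = 1 the index `n` is the true degree, and hence the number of roots to be
-- found.
HasTop : ℕ → ℤ → (ℤ → ℤ) → Set
HasTop n c f = ∃ λ (as : Vec ℤ n) → ∀ z → f z ≡ evalTop as c z

hasTop-+ : ∀ {n c d f g} → HasTop n c f → HasTop n d g → HasTop n (c ℤ.+ d) (λ z → f z ℤ.+ g z)
hasTop-+ {c = c} {d} (as , f≡) (bs , g≡) = Vec.zipWith ℤ._+_ as bs , λ z →
  trans (cong₂ ℤ._+_ (f≡ z) (g≡ z)) (sym (add z as bs))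
  where
  ident : ∀ a b z x y → a ℤ.+ b ℤ.+ z ℤ.* (x ℤ.+ y) ≡ (a ℤ.+ z ℤ.* x) ℤ.+ (b ℤ.+ z ℤ.* y)
  ident = solve-∀
  add : ∀ z {n} (as bs : Vec ℤ n) → evalTop (Vec.zipWith ℤ._+_ as bs) (c ℤ.+ d) z ≡ evalTop as c z ℤ.+ evalTop bs d z
  add z []       []       = refl
  add z (a ∷ as) (b ∷ bs) = trans (cong (λ x → a ℤ.+ b ℤ.+ z ℤ.* x) (add z as bs))
    (ident a b z (evalTop as c z) (evalTop bs d z))

hasTop-scale : ∀ {n c f} k → HasTop n c f → HasTop n (k ℤ.* c) (λ z → k ℤ.* f z)
hasTop-scale {c = c} k (as , f≡) = Vec.map (ℤ._*_ k) as , λ z → trans (cong (ℤ._*_ k) (f≡ z)) (sym (scale z as))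
  where
  ident : ∀ k a z x → k ℤ.* a ℤ.+ z ℤ.* (k ℤ.* x) ≡ k ℤ.* (a ℤ.+ z ℤ.* x)
  ident = solve-∀
  scale : ∀ z {n} (as : Vec ℤ n) → evalTop (Vec.map (ℤ._*_ k) as) (k ℤ.* c) z ≡ k ℤ.* evalTop as c z
  scale z []       = refl
  scale z (a ∷ as) = trans (cong (λ x → k ℤ.* a ℤ.+ z ℤ.* x) (scale z as)) (ident k a z (evalTop as c z))

hasTop-raise : ∀ {n c f} → HasTop n c f → HasTop (suc n) 0ℤ f
hasTop-raise {c = c} (as , f≡) = as Vec.∷ʳ c , λ z → trans (f≡ z) (sym (raise z as))
  where
  raise : ∀ z {n} (as : Vec ℤ n) → evalTop (as Vec.∷ʳ c) 0ℤ z ≡ evalTop as c z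
  raise z []       = trans (cong (ℤ._+_ c) (ℤ.*-zeroʳ z)) (ℤ.+-identityʳ c)
  raise z (a ∷ as) = cong (λ x → a ℤ.+ z ℤ.* x) (raise z as)

hasTop-shift : ∀ {n c f} → HasTop n c f → HasTop (suc n) c (λ z → z ℤ.* f z)
hasTop-shift (as , f≡) = 0ℤ ∷ as , λ z → trans (cong (z ℤ.*_) (f≡ z)) (sym (ℤ.+-identityˡ _))

hasTop-cong : ∀ {n c d f g} → c ≡ d → (∀ z → g z ≡ f z) → HasTop n c f → HasTop n d g
hasTop-cong refl e (as , f≡) = as , λ z → trans (e z) (f≡ z)

hasTop-linear-* : ∀ {n c f} e a → HasTop n c f → HasTop (suc n) (e ℤ.* c) (λ z → (z ℤ.* e ℤ.+ a) ℤ.* f z)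
hasTop-linear-* {c = c} {f} e a top = hasTop-cong (ℤ.+-identityˡ _) (λ z → ident z e a (f z))
  (hasTop-+ (hasTop-raise (hasTop-scale a top)) (hasTop-shift (hasTop-scale e top)))
  where
  ident : ∀ z e a x → (z ℤ.* e ℤ.+ a) ℤ.* x ≡ a ℤ.* x ℤ.+ z ℤ.* (e ℤ.* x)
  ident = solve-∀

hasTop-zero : ∀ n → HasTop n 0ℤ (λ _ → 0ℤ)
hasTop-zero zero    = [] , λ _ → refl
hasTop-zero (suc n) = hasTop-raise (hasTop-zero n)

hasTop-sum : ∀ {n} m (c : Fin m → ℤ) (f : Fin m → ℤ → ℤ) → (∀ i → HasTop n (c i) (f i)) →
             HasTop n (sum c) (λ z → sum (λ i → f i z))
hasTop-sum zero    c f top = hasTop-zero _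
hasTop-sum (suc m) c f top = hasTop-+ (top Fin.zero) (hasTop-sum m (c ∘ Fin.suc) (f ∘ Fin.suc) (top ∘ Fin.suc))

-- Along the first row each linear entry z E + C raises the formal degree of its minor by one and
-- multiplies the leading coefficient by the entry of `E`; these products add up to the expansion of
-- det E.
hasTop-det : ∀ n (E C : Mat n) → HasTop n (detℤ n E) (λ z → detℤ n (λ i j → z ℤ.* E i j ℤ.+ C i j))
hasTop-det zero    E C = [] , λ _ → refl
hasTop-det (suc n) E C = hasTop-sum (suc n)
  (λ j → sgn (toℕ j) ℤ.* (E Fin.zero j ℤ.* detℤ n (minor E j))) _
  λ j → hasTop-scale (sgn (toℕ j)) (hasTop-linear-* (E Fin.zero j) (C Fin.zero j) (hasTop-det n (minor E j) (minor C j)))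

-- Integral roots

roots : List ℤ → ℤ → ℤ
roots ls z = foldr (λ l r → (z ℤ.- l) ℤ.* r) 1ℤ ls

isPoly-roots : ∀ ls → IsPoly (roots ls)
isPoly-roots []       = isPoly-const 1ℤ
isPoly-roots (l ∷ ls) = isPoly-* (isPoly-- isPoly-id (isPoly-const l)) (isPoly-roots ls)

isPoly-evalTop : ∀ {n} (as : Vec ℤ n) c → IsPoly (evalTop as c)
isPoly-evalTop []       c = isPoly-const c
isPoly-evalTop (a ∷ as) c = isPoly-+ (isPoly-const a) (isPoly-* isPoly-id (isPoly-evalTop as c))

private
  -- One step of Horner division by z - a, shared by lists and by vectors with a leading
  -- coefficient.
  divide-step : ∀ c z a p p′ q → p ℤ.- p′ ≡ (z ℤ.- a) ℤ.* q →
    (c ℤ.+ z ℤ.* p) ℤ.- (c ℤ.+ a ℤ.* p′) ≡ (z ℤ.- a) ℤ.* (p′ ℤ.+ z ℤ.* q)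
  divide-step c z a p p′ q e = begin
    (c ℤ.+ z ℤ.* p) ℤ.- (c ℤ.+ a ℤ.* p′)                      ≡⟨ ident₁ c z a p p′ ⟩
    z ℤ.* (p ℤ.- p′) ℤ.+ (z ℤ.- a) ℤ.* p′                     ≡⟨ cong (λ x → z ℤ.* x ℤ.+ (z ℤ.- a) ℤ.* p′) e ⟩
    z ℤ.* ((z ℤ.- a) ℤ.* q) ℤ.+ (z ℤ.- a) ℤ.* p′              ≡⟨ ident₂ z a q p′ ⟩
    (z ℤ.- a) ℤ.* (p′ ℤ.+ z ℤ.* q)                            ∎
    where
    open ≡-Reasoning
    ident₁ : ∀ c z a p p′ → (c ℤ.+ z ℤ.* p) ℤ.- (c ℤ.+ a ℤ.* p′) ≡ z ℤ.* (p ℤ.- p′) ℤ.+ (z ℤ.- a) ℤ.* p′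
    ident₁ = solve-∀
    ident₂ : ∀ z a q p′ → z ℤ.* ((z ℤ.- a) ℤ.* q) ℤ.+ (z ℤ.- a) ℤ.* p′ ≡ (z ℤ.- a) ℤ.* (p′ ℤ.+ z ℤ.* q)
    ident₂ = solve-∀

divideP : ∀ p a → ∃ λ q → ∀ z → evalP p z ℤ.- evalP p a ≡ (z ℤ.- a) ℤ.* evalP q z
divideP []      a = [] , λ z → sym (ℤ.*-zeroʳ (z ℤ.- a))
divideP (c ∷ p) a = let q , e = divideP p a in
  evalP p a ∷ q , λ z → divide-step c z a (evalP p z) (evalP p a) (evalP q z) (e z)

divideTop : ∀ {n} (as : Vec ℤ (suc n)) c a → ∃ λ (bs : Vec ℤ n) →
            ∀ z → evalTop as c z ℤ.- evalTop as c a ≡ (z ℤ.- a) ℤ.* evalTop bs c z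
divideTop (b ∷ [])      c a = [] , λ z → ident b c z a
  where
  ident : ∀ b c z a → (b ℤ.+ z ℤ.* c) ℤ.- (b ℤ.+ a ℤ.* c) ≡ (z ℤ.- a) ℤ.* c
  ident = solve-∀
divideTop (b ∷ b′ ∷ as) c a = let bs , e = divideTop (b′ ∷ as) c a in
  evalTop (b′ ∷ as) c a ∷ bs ,
  λ z → divide-step b z a (evalTop (b′ ∷ as) c z) (evalTop (b′ ∷ as) c a) (evalTop bs c z) (e z)

-- A nonconstant monic polynomial exceeds 1 eventually, so it divides no unit.
monic-eventually-large : ∀ {n} (as : Vec ℤ (suc n)) → ∃ λ N → ∀ m → N ≤ m → + 2 ℤ.≤ evalTop as 1ℤ (+ m)
monic-eventually-positive : ∀ {n} (as : Vec ℤ n) → ∃ λ N → ∀ m → N ≤ m → + 1 ℤ.≤ evalTop as 1ℤ (+ m)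
monic-eventually-positive []       = 0 , λ m _ → ℤ.≤-refl
monic-eventually-positive (a ∷ as) = let N , large = monic-eventually-large (a ∷ as) in
  N , λ m N≤m → ℤ.≤-trans (ℤ.+≤+ (ℕ.s≤s ℕ.z≤n)) (large m N≤m)
monic-eventually-large (a ∷ as) = let N , positive = monic-eventually-positive as in
  -- The threshold makes m ≥ 2 + ∣a∣, so that a + m x ≥ - ∣a∣ + (2 + ∣a∣) = 2 once x ≥ 1.
  N ℕ.+ (2 ℕ.+ ∣ a ∣) , λ m le → bound m (evalTop as 1ℤ (+ m))
    (ℕ.≤-trans (ℕ.m≤n+m (2 ℕ.+ ∣ a ∣) N) le) (positive m (ℕ.≤-trans (ℕ.m≤m+n N _) le))
  where
  neg-abs : ∀ a → ℤ.- (+ ∣ a ∣) ℤ.≤ a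
  neg-abs (+ zero)     = ℤ.≤-refl
  neg-abs (+ suc n)    = ℤ.-≤+
  neg-abs ℤ.-[1+ n ] = ℤ.≤-refl
  ident : ∀ t → + 2 ≡ ℤ.- t ℤ.+ (+ 2 ℤ.+ t) ℤ.* + 1
  ident = solve-∀
  bound : ∀ m x → 2 ℕ.+ ∣ a ∣ ≤ m → + 1 ℤ.≤ x → + 2 ℤ.≤ a ℤ.+ + m ℤ.* x
  bound m x le 1≤x = begin
    + 2                                                     ≡⟨ ident (+ ∣ a ∣) ⟩
    ℤ.- (+ ∣ a ∣) ℤ.+ (+ 2 ℤ.+ + ∣ a ∣) ℤ.* + 1             ≤⟨ ℤ.+-mono-≤ (neg-abs a) (ℤ.*-monoʳ-≤-nonNeg (+ 1) (ℤ.+≤+ le)) ⟩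
    a ℤ.+ + m ℤ.* + 1                                       ≤⟨ ℤ.+-monoʳ-≤ a (ℤ.*-monoˡ-≤-nonNeg (+ m) 1≤x) ⟩
    a ℤ.+ + m ℤ.* x                                         ∎
    where open ℤ.≤-Reasoning

private
  linear-factor-nonzero : ∀ l n → suc ∣ l ∣ ≤ n → + n ℤ.- l ≢ 0ℤ
  linear-factor-nonzero l n le e = ℕ.1+n≰n (ℕ.≤-trans le (ℕ.≤-reflexive (cong ∣_∣ (ℤ.i-j≡0⇒i≡j (+ n) l e))))

  -- At z = l nothing can be cancelled; equality is obtained for large z and extends to all z
  -- because both sides are polynomial.
  cancel-linear-factor : ∀ {f g} l → IsPoly f → IsPoly g →
    (∀ z → (z ℤ.- l) ℤ.* f z ≡ (z ℤ.- l) ℤ.* g z) → ∀ z → f z ≡ g z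
  cancel-linear-factor {f} {g} l pf pg e z = ℤ.i-j≡0⇒i≡j _ _
    (isPoly-zero (isPoly-- pf pg) (suc ∣ l ∣) vanish z)
    where
    ident : ∀ a x y → a ℤ.* (x ℤ.- y) ≡ a ℤ.* x ℤ.- a ℤ.* y
    ident = solve-∀
    vanish : ∀ n → suc ∣ l ∣ ≤ n → f (+ n) ℤ.- g (+ n) ≡ 0ℤ
    vanish n le = case ℤ.i*j≡0⇒i≡0∨j≡0 (+ n ℤ.- l) {f (+ n) ℤ.- g (+ n)}
      (trans (ident (+ n ℤ.- l) (f (+ n)) (g (+ n))) (ℤ.i≡j⇒i-j≡0 (e (+ n)))) of λ where
        (inj₁ e′) → contradiction e′ (linear-factor-nonzero l n le)
        (inj₂ e′) → e′

  factor-of-root : ∀ {x y d} → x ℤ.- y ≡ d → y ≡ 0ℤ → x ≡ d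
  factor-of-root {x} e refl = trans (sym (ℤ.+-identityʳ x)) e

-- Remove the roots l one at a time from the factor that vanishes at l.
divisor-splits : ∀ ls {n} (as : Vec ℤ n) g → (∀ z → evalTop as 1ℤ z ℤ.* evalP g z ≡ roots ls z) →
  ∃ λ (ev : Fin n → ℤ) → ∀ z → evalTop as 1ℤ z ≡ prodℤ n (λ i → z ℤ.- ev i)
divisor-splits []       []       g e = (λ ()) , λ z → refl
divisor-splits []       (a ∷ as) g e = contradiction abs≡1 (abs≢1 (large N ℕ.≤-refl))
  where
  N = proj₁ (monic-eventually-large (a ∷ as))
  large = proj₂ (monic-eventually-large (a ∷ as))
  value = evalTop (a ∷ as) 1ℤ (+ N)
  abs≡1 : ∣ value ∣ ≡ 1
  abs≡1 = ℕ.m*n≡1⇒m≡1 ∣ value ∣ ∣ evalP g (+ N) ∣ (trans (sym (ℤ.abs-* value (evalP g (+ N)))) (cong ∣_∣ (e (+ N))))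
  abs≢1 : ∀ {x} → + 2 ℤ.≤ x → ∣ x ∣ ≢ 1
  abs≢1 (ℤ.+≤+ (ℕ.s≤s (ℕ.s≤s _))) ()
divisor-splits (l ∷ ls) {n} as g e = case ℤ.i*j≡0⇒i≡0∨j≡0 (evalTop as 1ℤ l) at-l of λ where
    (inj₁ root) → root-of-monic as e root
    (inj₂ root) → root-of-cofactor root
  where
  open ≡-Reasoning
  Splits : ∀ {n} → Vec ℤ n → Set
  Splits {n} as = ∃ λ (ev : Fin n → ℤ) → ∀ z → evalTop as 1ℤ z ≡ prodℤ n (λ i → z ℤ.- ev i)
  at-l : evalTop as 1ℤ l ℤ.* evalP g l ≡ 0ℤ
  at-l = trans (e l) (cong (ℤ._* roots ls l) (ℤ.+-inverseʳ l))

  root-of-monic : ∀ {n} (as : Vec ℤ n) → (∀ z → evalTop as 1ℤ z ℤ.* evalP g z ≡ roots (l ∷ ls) z) →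
                  evalTop as 1ℤ l ≡ 0ℤ → Splits as
  root-of-monic []       e ()
  root-of-monic {suc n} (a ∷ as) e root = let ev , splits = divisor-splits ls bs g e′ in
    (λ { Fin.zero → l ; (Fin.suc i) → ev i }) ,
    λ z → trans (factor z) (cong ((z ℤ.- l) ℤ.*_) (splits z))
    where
    bs = proj₁ (divideTop (a ∷ as) 1ℤ l)
    factor : ∀ z → evalTop (a ∷ as) 1ℤ z ≡ (z ℤ.- l) ℤ.* evalTop bs 1ℤ z
    factor z = factor-of-root (proj₂ (divideTop (a ∷ as) 1ℤ l) z) root
    e′ : ∀ z → evalTop bs 1ℤ z ℤ.* evalP g z ≡ roots ls z
    e′ = cancel-linear-factor l (isPoly-* (isPoly-evalTop bs 1ℤ) (g , λ _ → refl)) (isPoly-roots ls) λ z → begin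
      (z ℤ.- l) ℤ.* (evalTop bs 1ℤ z ℤ.* evalP g z) ≡⟨ ℤ.*-assoc (z ℤ.- l) _ _ ⟨
      (z ℤ.- l) ℤ.* evalTop bs 1ℤ z ℤ.* evalP g z   ≡⟨ cong (ℤ._* evalP g z) (factor z) ⟨
      evalTop (a ∷ as) 1ℤ z ℤ.* evalP g z           ≡⟨ e z ⟩
      (z ℤ.- l) ℤ.* roots ls z                      ∎

  root-of-cofactor : evalP g l ≡ 0ℤ → Splits as
  root-of-cofactor root = divisor-splits ls as h
    (cancel-linear-factor l (isPoly-* (isPoly-evalTop as 1ℤ) (h , λ _ → refl)) (isPoly-roots ls) λ z → begin
      (z ℤ.- l) ℤ.* (evalTop as 1ℤ z ℤ.* evalP h z) ≡⟨ ident (z ℤ.- l) (evalTop as 1ℤ z) (evalP h z) ⟩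
      evalTop as 1ℤ z ℤ.* ((z ℤ.- l) ℤ.* evalP h z) ≡⟨ cong (evalTop as 1ℤ z ℤ.*_) (factor-of-root (proj₂ (divideP g l) z) root) ⟨
      evalTop as 1ℤ z ℤ.* evalP g z                 ≡⟨ e z ⟩
      (z ℤ.- l) ℤ.* roots ls z                      ∎)
    where
    h = proj₁ (divideP g l)
    ident : ∀ a x y → a ℤ.* (x ℤ.* y) ≡ x ℤ.* (a ℤ.* y)
    ident = solve-∀

-- Operators with an annihilating polynomial that splits over ℤ

Op : ℕ → Set
Op n = Row n → Row n

LinearOp : ∀ {n} → Op n → Set
LinearOp X = ∀ c f g h → (∀ k → h k ≡ f k ℤ.+ c ℤ.* g k) → ∀ i → X h i ≡ X f i ℤ.+ c ℤ.* X g i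

applyRoots : ∀ {n} → List ℤ → Op n → Op n
applyRoots []       X v i = v i
applyRoots (l ∷ ls) X v i = X (applyRoots ls X v) i ℤ.- l ℤ.* applyRoots ls X v i

-- The list may repeat entries and need not be minimal: only the product of the factors X - l has to
-- vanish.
IntSplit : ∀ {n} → Op n → Set
IntSplit X = ∃ λ ls → ∀ v i → applyRoots ls X v i ≡ 0ℤ

module LinearOpProperties {n : ℕ} {X : Op n} (lin : LinearOp X) where
  op-cong : ∀ {f g} → (∀ k → f k ≡ g k) → ∀ i → X f i ≡ X g i
  op-cong {f} {g} e i = trans (lin 0ℤ g g f (λ k → trans (e k) (sym (ℤ.+-identityʳ (g k)))) i) (ℤ.+-identityʳ (X g i))

  op-zero : ∀ {f} → (∀ k → f k ≡ 0ℤ) → ∀ i → X f i ≡ 0ℤ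
  op-zero {f} e i = solve-for (X f i) (lin 1ℤ f f f (λ k → trans (e k) (sym (cong₂ (λ x y → x ℤ.+ 1ℤ ℤ.* y) (e k) (e k)))) i)
    where
    ident : ∀ x → x ≡ (x ℤ.+ 1ℤ ℤ.* x) ℤ.- x
    ident = solve-∀
    solve-for : ∀ x → x ≡ x ℤ.+ 1ℤ ℤ.* x → x ≡ 0ℤ
    solve-for x e = trans (ident x) (trans (cong (ℤ._- x) (sym e)) (ℤ.+-inverseʳ x))

  op-scale : ∀ c {f g} → (∀ k → f k ≡ c ℤ.* g k) → ∀ i → X f i ≡ c ℤ.* X g i
  op-scale c {f} {g} e i = trans
    (lin c (λ _ → 0ℤ) g f (λ k → trans (e k) (sym (ℤ.+-identityˡ (c ℤ.* g k)))) i)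
    (trans (cong (ℤ._+ c ℤ.* X g i) (op-zero (λ _ → refl) i)) (ℤ.+-identityˡ (c ℤ.* X g i)))

  applyRoots-cong : ∀ ls {f g} → (∀ k → f k ≡ g k) → ∀ i → applyRoots ls X f i ≡ applyRoots ls X g i
  applyRoots-cong []       e i = e i
  applyRoots-cong (l ∷ ls) e i = cong₂ (λ x y → x ℤ.- l ℤ.* y)
    (op-cong (applyRoots-cong ls e) i) (applyRoots-cong ls e i)

  applyRoots-zero : ∀ ls {f} → (∀ k → f k ≡ 0ℤ) → ∀ i → applyRoots ls X f i ≡ 0ℤ
  applyRoots-zero []       e i = e i
  applyRoots-zero (l ∷ ls) e i = trans
    (cong₂ (λ x y → x ℤ.- l ℤ.* y) (op-zero (applyRoots-zero ls e) i) (applyRoots-zero ls e i))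
    (ident l)
    where
    ident : ∀ l → 0ℤ ℤ.- l ℤ.* 0ℤ ≡ 0ℤ
    ident = solve-∀

applyRoots-++ : ∀ {n} ls ms (X : Op n) v i → applyRoots (ls ++ ms) X v i ≡ applyRoots ls X (applyRoots ms X v) i
applyRoots-++ ls ms X v i = cong (λ f → f i) (eq ls)
  where
  eq : ∀ ls → applyRoots (ls ++ ms) X v ≡ applyRoots ls X (applyRoots ms X v)
  eq []       = refl
  eq (l ∷ ls) = cong (λ w i → X w i ℤ.- l ℤ.* w i) (eq ls)

applyRoots-shift : ∀ {n} {X Y : Op n} → LinearOp X → ∀ c → (∀ v i → Y v i ≡ X v i ℤ.+ c ℤ.* v i) →
  ∀ ls v i → applyRoots (List.map (ℤ._+_ c) ls) Y v i ≡ applyRoots ls X v i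
applyRoots-shift lin c Y≡ []       v i = refl
applyRoots-shift {X = X} {Y} lin c Y≡ (l ∷ ls) v i = begin
  Y w i ℤ.- (c ℤ.+ l) ℤ.* w i                     ≡⟨ cong (ℤ._- (c ℤ.+ l) ℤ.* w i) (Y≡ w i) ⟩
  X w i ℤ.+ c ℤ.* w i ℤ.- (c ℤ.+ l) ℤ.* w i       ≡⟨ ident (X w i) c l (w i) ⟩
  X w i ℤ.- l ℤ.* w i                             ≡⟨ cong₂ (λ x y → x ℤ.- l ℤ.* y) (op-cong ih i) (ih i) ⟩
  X w′ i ℤ.- l ℤ.* w′ i                           ∎
  where
  open ≡-Reasoning
  open LinearOpProperties lin
  w  = applyRoots (List.map (ℤ._+_ c) ls) Y v
  w′ = applyRoots ls X v
  ih : ∀ i → w i ≡ w′ i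
  ih = applyRoots-shift lin c Y≡ ls v
  ident : ∀ x c l w → x ℤ.+ c ℤ.* w ℤ.- (c ℤ.+ l) ℤ.* w ≡ x ℤ.- l ℤ.* w
  ident = solve-∀

-- An intertwiner `G` turns a polynomial in `Y` into the same polynomial in `Z`. This moves a long
-- product of factors to an operator for which part of the product is known to vanish.
applyRoots-intertwine : ∀ {n} {G Y Z : Op n} → LinearOp G → LinearOp Z →
  (∀ w i → G (Y w) i ≡ Z (G w) i) → ∀ ls v i → G (applyRoots ls Y v) i ≡ applyRoots ls Z (G v) i
applyRoots-intertwine linG linZ GY [] v i = refl
applyRoots-intertwine {G = G} {Y} {Z} linG linZ GY (l ∷ ls) v i = begin
  G (λ i → Y w i ℤ.- l ℤ.* w i) i    ≡⟨ linG (ℤ.- l) (Y w) w _ (λ k → ident₁ (Y w k) l (w k)) i ⟩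
  G (Y w) i ℤ.+ (ℤ.- l) ℤ.* G w i     ≡⟨ cong (ℤ._+ (ℤ.- l) ℤ.* G w i) (GY w i) ⟩
  Z (G w) i ℤ.+ (ℤ.- l) ℤ.* G w i     ≡⟨ ident₁ (Z (G w) i) l (G w i) ⟨
  Z (G w) i ℤ.- l ℤ.* G w i           ≡⟨ cong₂ (λ x y → x ℤ.- l ℤ.* y) (LinearOpProperties.op-cong linZ ih i) (ih i) ⟩
  _ ∎
  where
  open ≡-Reasoning
  w = applyRoots ls Y v
  ih : ∀ i → G w i ≡ applyRoots ls Z (G v) i
  ih = applyRoots-intertwine linG linZ GY ls v
  ident₁ : ∀ x l y → x ℤ.- l ℤ.* y ≡ x ℤ.+ (ℤ.- l) ℤ.* y
  ident₁ = solve-∀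

intSplit-cong : ∀ {n} {X Y : Op n} → LinearOp X → (∀ v i → Y v i ≡ X v i) → IntSplit X → IntSplit Y
intSplit-cong {X = X} {Y} lin e (ls , split) = ls , λ v i → trans (same ls v i) (split v i)
  where
  same : ∀ ls v i → applyRoots ls Y v i ≡ applyRoots ls X v i
  same []       v i = refl
  same (l ∷ ls) v i = cong₂ (λ x y → x ℤ.- l ℤ.* y)
    (trans (e _ i) (LinearOpProperties.op-cong lin (same ls v) i)) (same ls v i)

intSplit-shift : ∀ {n} {X Y : Op n} → LinearOp X → ∀ c → (∀ v i → Y v i ≡ X v i ℤ.+ c ℤ.* v i) →
                 IntSplit X → IntSplit Y
intSplit-shift lin c Y≡ (ls , split) = List.map (ℤ._+_ c) ls , λ v i →
  trans (applyRoots-shift lin c Y≡ ls v i) (split v i)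

linearOp-+ : ∀ {n} {X Y : Op n} → LinearOp X → LinearOp Y → LinearOp (λ v i → X v i ℤ.+ Y v i)
linearOp-+ {X = X} {Y} linX linY c f g h e i = trans (cong₂ ℤ._+_ (linX c f g h e i) (linY c f g h e i))
  (ident (X f i) c (X g i) (Y f i) (Y g i))
  where
  ident : ∀ x c x′ y y′ → (x ℤ.+ c ℤ.* x′) ℤ.+ (y ℤ.+ c ℤ.* y′) ≡ (x ℤ.+ y) ℤ.+ c ℤ.* (x′ ℤ.+ y′)
  ident = solve-∀

linearOp-scale : ∀ {n} {X : Op n} t → LinearOp X → LinearOp (λ v i → t ℤ.* X v i)
linearOp-scale {X = X} t linX c f g h e i = trans (cong (t ℤ.*_) (linX c f g h e i)) (ident t (X f i) c (X g i))
  where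
  ident : ∀ t x c y → t ℤ.* (x ℤ.+ c ℤ.* y) ≡ t ℤ.* x ℤ.+ c ℤ.* (t ℤ.* y)
  ident = solve-∀

linearOp-id : ∀ {n} → LinearOp {n} (λ v → v)
linearOp-id c f g h e = e

linearOp-sum : ∀ {n} m (X : Fin m → Op n) → (∀ j → LinearOp (X j)) → LinearOp (λ v i → sum (λ j → X j v i))
linearOp-sum m X lin c f g h e i = trans
  (sum-cong-≗ {x = λ j → X j h i} {y = λ j → X j f i ℤ.+ c ℤ.* X j g i} (λ j → lin j c f g h e i))
  (sum-linear c (λ j → X j f i) (λ j → X j g i))

-- L and μ − L both carry a product of factors of X + L to zero: L turns X + L
-- into X + μ, and μ − L turns it into X.
intSplit-+ : ∀ {n} {X L : Op n} μ → μ ≢ 0ℤ → LinearOp X → LinearOp L →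
  (∀ v i → L (X v) i ≡ X (L v) i) → (∀ v i → L (L v) i ≡ μ ℤ.* L v i) →
  -- The list `ls` serves X and its translate by μ serves X + μ. Being killed by both L and μ - L,
  -- the resulting vector is killed by μ, hence zero.
  IntSplit X → IntSplit (λ v i → X v i ℤ.+ L v i)
intSplit-+ {n} {X} {L} μ μ≢0 linX linL LX LL (ls , split) = ls ++ List.map (ℤ._+_ μ) ls , λ v i →
  torsion-free (L (u v) i) (u v i) (killed-by-L v i) (killed-by-N v i)
  where
  Y Z N : Op n
  Y v i = X v i ℤ.+ L v i
  Z v i = X v i ℤ.+ μ ℤ.* v i
  N v i = μ ℤ.* v i ℤ.+ ℤ.-1ℤ ℤ.* L v i
  linZ : LinearOp Z
  linZ = linearOp-+ linX (linearOp-scale μ linearOp-id)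
  linN : LinearOp N
  linN = linearOp-+ (linearOp-scale μ linearOp-id) (linearOp-scale ℤ.-1ℤ linL)
  open LinearOpProperties
  u : Row n → Row n
  u v = applyRoots (ls ++ List.map (ℤ._+_ μ) ls) Y v
  id₀ : ∀ x y → x ℤ.+ y ≡ x ℤ.+ 1ℤ ℤ.* y
  id₀ = solve-∀
  LY : ∀ w i → L (Y w) i ≡ Z (L w) i
  LY w i = trans (linL 1ℤ (X w) (L w) (Y w) (λ k → id₀ (X w k) (L w k)) i)
    (trans (sym (id₀ (L (X w) i) (L (L w) i))) (cong₂ ℤ._+_ (LX w i) (LL w i)))
  NY : ∀ w i → N (Y w) i ≡ X (N w) i
  NY w i = begin
    μ ℤ.* (X w i ℤ.+ L w i) ℤ.+ ℤ.-1ℤ ℤ.* L (Y w) i                  ≡⟨ cong (λ x → μ ℤ.* (X w i ℤ.+ L w i) ℤ.+ ℤ.-1ℤ ℤ.* x) (LY w i) ⟩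
    μ ℤ.* (X w i ℤ.+ L w i) ℤ.+ ℤ.-1ℤ ℤ.* (X (L w) i ℤ.+ μ ℤ.* L w i) ≡⟨ id₁ μ (X w i) (L w i) (X (L w) i) ⟩
    μ ℤ.* X w i ℤ.+ ℤ.-1ℤ ℤ.* X (L w) i                              ≡⟨ cong (ℤ._+ ℤ.-1ℤ ℤ.* X (L w) i) (op-scale linX μ {λ k → μ ℤ.* w k} {w} (λ k → refl) i) ⟨
    X (λ k → μ ℤ.* w k) i ℤ.+ ℤ.-1ℤ ℤ.* X (L w) i                    ≡⟨ linX ℤ.-1ℤ (λ k → μ ℤ.* w k) (L w) (N w) (λ k → refl) i ⟨
    X (N w) i                                                        ∎
    where
    open ≡-Reasoning
    id₁ : ∀ μ x l x′ → μ ℤ.* (x ℤ.+ l) ℤ.+ ℤ.-1ℤ ℤ.* (x′ ℤ.+ μ ℤ.* l) ≡ μ ℤ.* x ℤ.+ ℤ.-1ℤ ℤ.* x′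
    id₁ = solve-∀
  killed-by-L : ∀ v i → L (u v) i ≡ 0ℤ
  killed-by-L v i = trans (applyRoots-intertwine linL linZ LY (ls ++ List.map (ℤ._+_ μ) ls) v i)
    (trans (applyRoots-++ ls (List.map (ℤ._+_ μ) ls) Z (L v) i)
      (applyRoots-zero linZ ls (λ k → trans (applyRoots-shift linX μ (λ _ _ → refl) ls (L v) k) (split (L v) k)) i))
  killed-by-N : ∀ v i → N (u v) i ≡ 0ℤ
  killed-by-N v i = trans (applyRoots-intertwine linN linX NY (ls ++ List.map (ℤ._+_ μ) ls) v i)
    (trans (applyRoots-++ ls (List.map (ℤ._+_ μ) ls) X (N v) i) (split _ i))
  torsion-free : ∀ l x → l ≡ 0ℤ → μ ℤ.* x ℤ.+ ℤ.-1ℤ ℤ.* l ≡ 0ℤ → x ≡ 0ℤ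
  torsion-free l x refl e = case ℤ.i*j≡0⇒i≡0∨j≡0 μ (trans (sym (ℤ.+-identityʳ (μ ℤ.* x))) e) of λ where
    (inj₁ μ≡0) → contradiction μ≡0 μ≢0
    (inj₂ x≡0) → x≡0

-- The summands commute, so they can be added one at a time by `intSplit-+`; a coefficient 0 skips
-- its operator, which is how a connection set given by an indicator function enters.
intSplit-sum : ∀ {n} μ → μ ≢ 0ℤ → ∀ m (t : Fin m → ℤ) (L : Fin m → Op n) →
  (∀ j → t j ≡ 1ℤ ⊎ t j ≡ 0ℤ) → (∀ j → LinearOp (L j)) →
  (∀ j k v i → L j (L k v) i ≡ L k (L j v) i) → (∀ j v i → L j (L j v) i ≡ μ ℤ.* L j v i) →
  IntSplit (λ v i → sum (λ j → t j ℤ.* L j v i))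
intSplit-sum μ μ≢0 zero    t L t∈ lin comm sq = 0ℤ ∷ [] , λ v i → refl
intSplit-sum {n} μ μ≢0 (suc m) t L t∈ lin comm sq with t∈ Fin.zero
... | inj₂ t≡0 = intSplit-cong linX
  (λ v i → trans (cong (λ s → s ℤ.* L Fin.zero v i ℤ.+ X v i) t≡0) (ℤ.+-identityˡ (X v i))) rest
  where
  X : Op n
  X v i = sum (λ j → t (Fin.suc j) ℤ.* L (Fin.suc j) v i)
  linX : LinearOp X
  linX = linearOp-sum m (λ j v i → t (Fin.suc j) ℤ.* L (Fin.suc j) v i) (λ j → linearOp-scale (t (Fin.suc j)) (lin (Fin.suc j)))
  rest : IntSplit X
  rest = intSplit-sum μ μ≢0 m (t ∘ Fin.suc) (L ∘ Fin.suc) (t∈ ∘ Fin.suc) (lin ∘ Fin.suc)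
           (λ j k → comm (Fin.suc j) (Fin.suc k)) (sq ∘ Fin.suc)
... | inj₁ t≡1 = intSplit-cong (linearOp-+ linX (lin Fin.zero))
  (λ v i → trans (cong (λ s → s ℤ.* L Fin.zero v i ℤ.+ X v i) t≡1) (ident (L Fin.zero v i) (X v i)))
  (intSplit-+ μ μ≢0 linX (lin Fin.zero) commX (sq Fin.zero) rest)
  where
  X : Op n
  X v i = sum (λ j → t (Fin.suc j) ℤ.* L (Fin.suc j) v i)
  linX : LinearOp X
  linX = linearOp-sum m (λ j v i → t (Fin.suc j) ℤ.* L (Fin.suc j) v i) (λ j → linearOp-scale (t (Fin.suc j)) (lin (Fin.suc j)))
  rest : IntSplit X
  rest = intSplit-sum μ μ≢0 m (t ∘ Fin.suc) (L ∘ Fin.suc) (t∈ ∘ Fin.suc) (lin ∘ Fin.suc)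
           (λ j k → comm (Fin.suc j) (Fin.suc k)) (sq ∘ Fin.suc)
  ident : ∀ x y → 1ℤ ℤ.* x ℤ.+ y ≡ y ℤ.+ x
  ident = solve-∀
  op-sum : ∀ k (s : Fin k → ℤ) (f : Fin k → Row n) i →
           L Fin.zero (λ i → sum (λ j → s j ℤ.* f j i)) i ≡ sum (λ j → s j ℤ.* L Fin.zero (f j) i)
  op-sum zero    s f i = LinearOpProperties.op-zero (lin Fin.zero) (λ _ → refl) i
  op-sum (suc k) s f i = trans
    (lin Fin.zero (s Fin.zero) (λ i → sum (λ j → s (Fin.suc j) ℤ.* f (Fin.suc j) i)) (f Fin.zero) _
      (λ i → ℤ.+-comm (s Fin.zero ℤ.* f Fin.zero i) _) i)
    (trans (ℤ.+-comm (L Fin.zero (λ i → sum (λ j → s (Fin.suc j) ℤ.* f (Fin.suc j) i)) i) _)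
      (cong (ℤ._+_ (s Fin.zero ℤ.* L Fin.zero (f Fin.zero) i)) (op-sum k (s ∘ Fin.suc) (f ∘ Fin.suc) i)))
  commX : ∀ v i → L Fin.zero (X v) i ≡ X (L Fin.zero v) i
  commX v i = trans (op-sum m (t ∘ Fin.suc) (λ j → L (Fin.suc j) v) i)
    (sum-cong-≗ {x = λ j → t (Fin.suc j) ℤ.* L Fin.zero (L (Fin.suc j) v) i}
                {y = λ j → t (Fin.suc j) ℤ.* L (Fin.suc j) (L Fin.zero v) i}
      λ j → cong (t (Fin.suc j) ℤ.*_) (comm Fin.zero (Fin.suc j) v i))

module _ {n : ℕ} {X : Op n} (linX : LinearOp X) where
  open LinearOpProperties linX
  open ≡-Reasoning

  -- The entries of an eigenvector with eigenvalue μ / c are divisible by every power of c.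
  nonintegral-eigenvector : ∀ c .{{_ : ℕ.NonZero c}} μ → 2 ≤ c → Coprime c ∣ μ ∣ → ∀ w → (∀ i → + c ℤ.* X w i ≡ μ ℤ.* w i) →
                            ∀ i → w i ≡ 0ℤ
  nonintegral-eigenvector c μ 2≤c coprime w eigen i =
    ℤ.∣i∣≡0⇒i≡0 (vanish ∣ w i ∣ (λ k → subst (c ℕ.^ k ℕ.∣_) (sym (abs-w k)) (ℕ.m∣m*n ∣ proj₁ (descend k) i ∣)))
    where
    divide : ∀ (w : Row n) → (∀ i → + c ℤ.* X w i ≡ μ ℤ.* w i) →
             ∃ λ w′ → (∀ i → w i ≡ + c ℤ.* w′ i) × (∀ i → + c ℤ.* X w′ i ≡ μ ℤ.* w′ i)
    divide w eigen = w′ , w≡ , λ i → ℤ.*-cancelˡ-≡ (+ c) (+ c ℤ.* X w′ i) (μ ℤ.* w′ i) (begin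
        + c ℤ.* (+ c ℤ.* X w′ i)      ≡⟨ cong (+ c ℤ.*_) (op-scale (+ c) w≡ i) ⟨
        + c ℤ.* X w i                 ≡⟨ eigen i ⟩
        μ ℤ.* w i                     ≡⟨ cong (μ ℤ.*_) (w≡ i) ⟩
        μ ℤ.* (+ c ℤ.* w′ i)          ≡⟨ ident μ (+ c) (w′ i) ⟩
        + c ℤ.* (μ ℤ.* w′ i)          ∎)
      where
      ident : ∀ a b x → a ℤ.* (b ℤ.* x) ≡ b ℤ.* (a ℤ.* x)
      ident = solve-∀
      c∣w : ∀ i → c ℕ.∣ ∣ w i ∣
      c∣w i = coprime-divisor {n = ∣ μ ∣} coprime (ℕ.divides ∣ X w i ∣ (begin
        ∣ μ ∣ ℕ.* ∣ w i ∣        ≡⟨ ℤ.abs-* μ (w i) ⟨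
        ∣ μ ℤ.* w i ∣            ≡⟨ cong ∣_∣ (eigen i) ⟨
        ∣ + c ℤ.* X w i ∣        ≡⟨ ℤ.abs-* (+ c) (X w i) ⟩
        c ℕ.* ∣ X w i ∣          ≡⟨ ℕ.*-comm c _ ⟩
        ∣ X w i ∣ ℕ.* c          ∎))
      signed : ∀ i → + c ℤ.∣ w i
      signed i = ℤ.∣ᵤ⇒∣ (c∣w i)
      w′ : Row n
      w′ i = ℤ._∣_.quotient (signed i)
      w≡ : ∀ i → w i ≡ + c ℤ.* w′ i
      w≡ i = trans (ℤ._∣_.equality (signed i)) (ℤ.*-comm (w′ i) (+ c))

    Quotient : ℕ → Set
    Quotient k = ∃ λ w′ → (∀ i → ∣ w i ∣ ≡ c ℕ.^ k ℕ.* ∣ w′ i ∣) × (∀ i → + c ℤ.* X w′ i ≡ μ ℤ.* w′ i)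

    descend-step : ∀ k → Quotient k → Quotient (suc k)
    descend-step k (w₁ , w≡ , eigen₁) = proj₁ next , scaled , proj₂ (proj₂ next)
      where
      next : ∃ λ w′ → (∀ i → w₁ i ≡ + c ℤ.* w′ i) × (∀ i → + c ℤ.* X w′ i ≡ μ ℤ.* w′ i)
      next = divide w₁ eigen₁
      w₂ : Row n
      w₂ = proj₁ next
      regroup : ∀ a x → a ≡ c ℕ.^ k ℕ.* (c ℕ.* x) → a ≡ c ℕ.^ suc k ℕ.* x
      regroup a x e = trans e (trans (sym (ℕ.*-assoc (c ℕ.^ k) c x)) (cong (ℕ._* x) (ℕ.*-comm (c ℕ.^ k) c)))
      scaled : ∀ i → ∣ w i ∣ ≡ c ℕ.^ suc k ℕ.* ∣ w₂ i ∣
      scaled i = regroup ∣ w i ∣ ∣ w₂ i ∣ (trans (w≡ i) (cong (c ℕ.^ k ℕ.*_)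
        (trans (cong ∣_∣ (proj₁ (proj₂ next) i)) (ℤ.abs-* (+ c) (w₂ i)))))

    descend : ∀ k → Quotient k
    descend zero    = w , (λ i → sym (ℕ.*-identityˡ ∣ w i ∣)) , eigen
    descend (suc k) = descend-step k (descend k)

    abs-w : ∀ k → ∣ w i ∣ ≡ c ℕ.^ k ℕ.* ∣ proj₁ (descend k) i ∣
    abs-w k = proj₁ (proj₂ (descend k)) i

    power-large : ∀ k → suc k ≤ c ℕ.^ k
    power-large zero    = ℕ.≤-refl
    power-large (suc k) = ℕ.≤-trans (ℕ.≤-trans (ℕ.m≤m+n (suc (suc k)) k) (ℕ.≤-reflexive double))
      (ℕ.*-mono-≤ 2≤c (power-large k))
      where
      double : suc (suc k) ℕ.+ k ≡ 2 ℕ.* suc k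
      double = cong suc (trans (cong suc (sym (ℕ.+-identityʳ (k ℕ.+ k)))) (trans (cong suc (ℕ.+-assoc k k 0)) (sym (ℕ.+-suc k (k ℕ.+ 0)))))

    vanish : ∀ m → (∀ k → c ℕ.^ k ℕ.∣ m) → m ≡ 0
    vanish zero    d = refl
    vanish (suc m) d = contradiction (ℕ.≤-trans (power-large (suc m)) (ℕ.∣⇒≤ (d (suc m)))) (ℕ.<⇒≱ ℕ.≤-refl)

  IntegerRoot NoEigenvector : ℕ → ℤ → Set
  IntegerRoot c μ = ∃ λ l → ∀ w → (∀ i → + c ℤ.* X w i ≡ μ ℤ.* w i) → ∀ i → X w i ≡ l ℤ.* w i
  NoEigenvector c μ = ∀ w → (∀ i → + c ℤ.* X w i ≡ μ ℤ.* w i) → ∀ i → w i ≡ 0ℤ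

  -- Write μ / c in lowest terms. Denominator 1 gives an integral eigenvalue of `X`; a larger
  -- denominator excludes nonzero eigenvectors over ℤ.
  unscale-factor : ∀ c .{{_ : ℕ.NonZero c}} μ → IntegerRoot c μ ⊎ NoEigenvector c μ
  unscale-factor c μ with gcd[m,n]∣m c ∣ μ ∣ | ℤ.∣ᵤ⇒∣ {+ gcd c ∣ μ ∣} {μ} (gcd[m,n]∣n c ∣ μ ∣)
  ... | ℕ.divides c′ c≡ | ℤ.divides μ′ μ≡ = by-size c′ refl
      where
      g = gcd c ∣ μ ∣
      instance
        g-nonZero : ℕ.NonZero g
        g-nonZero = ℕ.≢-nonZero (gcd[m,n]≢0 c ∣ μ ∣ (inj₁ (ℕ.≢-nonZero⁻¹ c)))
      reduced : ∀ w → (∀ i → + c ℤ.* X w i ≡ μ ℤ.* w i) → ∀ i → + c′ ℤ.* X w i ≡ μ′ ℤ.* w i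
      reduced w eigen i = ℤ.*-cancelˡ-≡ (+ g) (+ c′ ℤ.* X w i) (μ′ ℤ.* w i) (begin
        + g ℤ.* (+ c′ ℤ.* X w i)   ≡⟨ rotate (+ g) (+ c′) (X w i) ⟩
        + c′ ℤ.* + g ℤ.* X w i     ≡⟨ cong (ℤ._* X w i) (trans (sym (ℤ.pos-* c′ g)) (cong +_ (sym c≡))) ⟩
        + c ℤ.* X w i              ≡⟨ eigen i ⟩
        μ ℤ.* w i                  ≡⟨ cong (ℤ._* w i) μ≡ ⟩
        μ′ ℤ.* + g ℤ.* w i         ≡⟨ rotate (+ g) μ′ (w i) ⟨
        + g ℤ.* (μ′ ℤ.* w i)       ∎)
        where
        rotate : ∀ g c x → g ℤ.* (c ℤ.* x) ≡ c ℤ.* g ℤ.* x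
        rotate = solve-∀
      coprime : Coprime c′ ∣ μ′ ∣
      coprime {d} (d∣c′ , d∣μ′) = ℕ.*-cancelʳ-≡ d 1 g (trans
        (ℕ.∣-antisym (gcd-greatest dg∣c dg∣μ) (ℕ.n∣m*n d)) (sym (ℕ.*-identityˡ g)))
        where
        dg∣c : d ℕ.* g ℕ.∣ c
        dg∣c = subst (d ℕ.* g ℕ.∣_) (sym c≡) (ℕ.*-monoˡ-∣ g d∣c′)
        dg∣μ : d ℕ.* g ℕ.∣ ∣ μ ∣
        dg∣μ = subst (d ℕ.* g ℕ.∣_) (sym (trans (cong ∣_∣ μ≡) (ℤ.abs-* μ′ (+ g)))) (ℕ.*-monoˡ-∣ g d∣μ′)
      by-size : ∀ m → m ≡ c′ → IntegerRoot c μ ⊎ NoEigenvector c μ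
      by-size zero          e = contradiction (trans c≡ (cong (ℕ._* g) (sym e))) (ℕ.≢-nonZero⁻¹ c)
      by-size (suc zero)    e = inj₁ (μ′ , λ w eigen i → trans (sym (ℤ.*-identityˡ (X w i)))
        (trans (cong (λ x → + x ℤ.* X w i) e) (reduced w eigen i)))
      by-size (suc (suc m)) e = inj₂ λ w eigen → nonintegral-eigenvector c′ {{subst ℕ.NonZero e _}} μ′
        (subst (2 ≤_) e (ℕ.s≤s (ℕ.s≤s ℕ.z≤n))) coprime w (reduced w eigen)

  -- Each factor c X - μ is either replaced by X - l with l = μ / c, or dropped because it is
  -- injective.
  intSplit-unscale : ∀ c .{{_ : ℕ.NonZero c}} → IntSplit (λ v i → + c ℤ.* X v i) → IntSplit X
  intSplit-unscale c (μs , split) = proj₁ (unscale μs) , λ v → proj₂ (unscale μs) v (split v)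
    where
    cX : Op n
    cX v i = + c ℤ.* X v i
    eigen : ∀ {μ μs} u → (∀ i → applyRoots (μ ∷ μs) cX u i ≡ 0ℤ) →
            ∀ i → + c ℤ.* X (applyRoots μs cX u) i ≡ μ ℤ.* applyRoots μs cX u i
    eigen {μ} {μs} u e i = ℤ.i-j≡0⇒i≡j (+ c ℤ.* X (applyRoots μs cX u) i) (μ ℤ.* applyRoots μs cX u i) (e i)
    unscale : ∀ μs → ∃ λ ls → ∀ u → (∀ i → applyRoots μs cX u i ≡ 0ℤ) → ∀ i → applyRoots ls X u i ≡ 0ℤ
    unscale []       = [] , λ u e → e
    unscale (μ ∷ μs) with unscale μs | unscale-factor c μ
    ... | ls , rest | inj₂ injective = ls , λ u e → rest u (injective (applyRoots μs cX u) (eigen {μ} {μs} u e))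
    -- X - l commutes with the remaining factors of c X, so it can be moved past them onto `u`; the
    -- induction hypothesis then applies to (X - l) u.
    ... | ls , rest | inj₁ (l , root) = ls ++ l ∷ [] , λ u e i → trans (applyRoots-++ ls (l ∷ []) X u i)
      (rest (G u) (λ k → trans (sym (applyRoots-intertwine linG (linearOp-scale (+ c) linX) GcX μs u k))
        (ℤ.i≡j⇒i-j≡0 {X (applyRoots μs cX u) k} {l ℤ.* applyRoots μs cX u k} (root (applyRoots μs cX u) (eigen {μ} {μs} u e) k))) i)
      where
      G : Op n
      G v i = X v i ℤ.- l ℤ.* v i
      ident : ∀ x l y → x ℤ.- l ℤ.* y ≡ x ℤ.+ (ℤ.- l) ℤ.* y
      ident = solve-∀
      linG : LinearOp G
      linG d f g h e i = trans (ident (X h i) l (h i)) (trans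
        (linearOp-+ linX (linearOp-scale (ℤ.- l) linearOp-id) d f g h e i)
        (sym (cong₂ (λ x y → x ℤ.+ d ℤ.* y) (ident (X f i) l (f i)) (ident (X g i) l (g i)))))
      GcX : ∀ w i → G (cX w) i ≡ + c ℤ.* X (G w) i
      GcX w i = begin
        X (cX w) i ℤ.- l ℤ.* (+ c ℤ.* X w i)            ≡⟨ cong (ℤ._- l ℤ.* (+ c ℤ.* X w i)) (op-scale (+ c) {cX w} {X w} (λ _ → refl) i) ⟩
        + c ℤ.* X (X w) i ℤ.- l ℤ.* (+ c ℤ.* X w i)     ≡⟨ pull (+ c) (X (X w) i) l (X w i) ⟩
        + c ℤ.* (X (X w) i ℤ.+ (ℤ.- l) ℤ.* X w i)       ≡⟨ cong (+ c ℤ.*_) (linX (ℤ.- l) (X w) w (G w) (λ k → ident (X w k) l (w k)) i) ⟨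
        + c ℤ.* X (G w) i                               ∎
        where
        pull : ∀ c x l y → c ℤ.* x ℤ.- l ℤ.* (c ℤ.* y) ≡ c ℤ.* (x ℤ.+ (ℤ.- l) ℤ.* y)
        pull = solve-∀

-- From annihilating polynomials to characteristic polynomials

act : ∀ {n} → Mat n → Op n
act A v i = sum λ j → A i j ℤ.* v j

act-linear : ∀ {n} (A : Mat n) → LinearOp (act A)
act-linear A c f g h e i = trans
  (sum-cong-≗ {x = λ j → A i j ℤ.* h j} {y = λ j → A i j ℤ.* f j ℤ.+ c ℤ.* (A i j ℤ.* g j)}
    λ j → trans (cong (A i j ℤ.*_) (e j)) (ident (A i j) (f j) c (g j)))
  (sum-linear c (λ j → A i j ℤ.* f j) (λ j → A i j ℤ.* g j))
  where
  ident : ∀ a x c y → a ℤ.* (x ℤ.+ c ℤ.* y) ≡ a ℤ.* x ℤ.+ c ℤ.* (a ℤ.* y)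
  ident = solve-∀

roots-power : ∀ ls n z → roots (List.concat (List.replicate n ls)) z ≡ roots ls z ℤ.^ n
roots-power ls zero    z = refl
roots-power ls (suc n) z = trans (roots-++ ls) (cong (roots ls z ℤ.*_) (roots-power ls n z))
  where
  ms = List.concat (List.replicate n ls)
  roots-++ : ∀ ls → roots (ls ++ ms) z ≡ roots ls z ℤ.* roots ms z
  roots-++ []       = sym (ℤ.*-identityˡ _)
  roots-++ (l ∷ ls) = trans (cong ((z ℤ.- l) ℤ.*_) (roots-++ ls)) (sym (ℤ.*-assoc (z ℤ.- l) (roots ls z) (roots ms z)))

-- The quotient of h(z) − h(X) by z − X for h = roots ls.
cofactor : ∀ {n} → List ℤ → Op n → ℤ → Op n
cofactor []       X z v i = 0ℤ
cofactor (l ∷ ls) X z v i = (z ℤ.- l) ℤ.* cofactor ls X z v i ℤ.+ applyRoots ls X v i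

cofactor-spec : ∀ {n} {X : Op n} → LinearOp X → ∀ ls z v i →
  z ℤ.* cofactor ls X z v i ℤ.- X (cofactor ls X z v) i ≡ roots ls z ℤ.* v i ℤ.- applyRoots ls X v i
cofactor-spec {X = X} lin [] z v i = trans
  (cong (λ x → z ℤ.* 0ℤ ℤ.- x) (LinearOpProperties.op-zero lin (λ _ → refl) i)) (ident z (v i))
  where
  ident : ∀ z v → z ℤ.* 0ℤ ℤ.- 0ℤ ≡ 1ℤ ℤ.* v ℤ.- v
  ident = solve-∀
cofactor-spec {X = X} lin (l ∷ ls) z v i = begin
  z ℤ.* ((z ℤ.- l) ℤ.* b i ℤ.+ H i) ℤ.- X (λ k → (z ℤ.- l) ℤ.* b k ℤ.+ H k) i
    ≡⟨ cong (λ x → z ℤ.* ((z ℤ.- l) ℤ.* b i ℤ.+ H i) ℤ.- x)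
         (lin (z ℤ.- l) H b _ (λ k → ℤ.+-comm ((z ℤ.- l) ℤ.* b k) (H k)) i) ⟩
  z ℤ.* ((z ℤ.- l) ℤ.* b i ℤ.+ H i) ℤ.- (X H i ℤ.+ (z ℤ.- l) ℤ.* X b i)
    ≡⟨ id₀ z l (b i) (H i) (X H i) (X b i) ⟩
  (z ℤ.- l) ℤ.* (z ℤ.* b i ℤ.- X b i) ℤ.+ (z ℤ.* H i ℤ.- X H i)
    ≡⟨ cong (λ x → (z ℤ.- l) ℤ.* x ℤ.+ (z ℤ.* H i ℤ.- X H i)) (cofactor-spec lin ls z v i) ⟩
  (z ℤ.- l) ℤ.* (roots ls z ℤ.* v i ℤ.- H i) ℤ.+ (z ℤ.* H i ℤ.- X H i)
    ≡⟨ id₁ z l (roots ls z) (v i) (H i) (X H i) ⟩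
  (z ℤ.- l) ℤ.* roots ls z ℤ.* v i ℤ.- (X H i ℤ.- l ℤ.* H i) ∎
  where
  open ≡-Reasoning
  b = cofactor ls X z v
  H = applyRoots ls X v
  id₀ : ∀ z l b h x y → z ℤ.* ((z ℤ.- l) ℤ.* b ℤ.+ h) ℤ.- (x ℤ.+ (z ℤ.- l) ℤ.* y) ≡
        (z ℤ.- l) ℤ.* (z ℤ.* b ℤ.- y) ℤ.+ (z ℤ.* h ℤ.- x)
  id₀ = solve-∀
  id₁ : ∀ z l r v h x → (z ℤ.- l) ℤ.* (r ℤ.* v ℤ.- h) ℤ.+ (z ℤ.* h ℤ.- x) ≡
        (z ℤ.- l) ℤ.* r ℤ.* v ℤ.- (x ℤ.- l ℤ.* h)
  id₁ = solve-∀

isPoly-cofactor : ∀ {n} ls (X : Op n) v i → IsPoly (λ z → cofactor ls X z v i)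
isPoly-cofactor []       X v i = isPoly-const 0ℤ
isPoly-cofactor (l ∷ ls) X v i = isPoly-+
  (isPoly-* (isPoly-- isPoly-id (isPoly-const l)) (isPoly-cofactor ls X v i)) (isPoly-const (applyRoots ls X v i))

intSplit⇒integralSpectrum : ∀ n (A : Mat n) → IntSplit (act A) → IntegralSpectrum n A
intSplit⇒integralSpectrum n A (ls , split) = proj₁ χ-splits , coeff-unique (charPoly n A) (prodFin n λ i → Xₚ -ₚ constₚ (proj₁ χ-splits i)) λ z → begin
  evalP (charPoly n A) z                                          ≡⟨ χ≡ z ⟩
  evalTop (proj₁ χ-monic) 1ℤ z                                    ≡⟨ proj₂ χ-splits z ⟩
  prodℤ n (λ i → z ℤ.- proj₁ χ-splits i)                          ≡⟨ evalP-prodFin-linear z n (proj₁ χ-splits) ⟨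
  evalP (prodFin n (λ i → Xₚ -ₚ constₚ (proj₁ χ-splits i))) z     ∎
  where
  open ≡-Reasoning
  χ : ℤ → ℤ
  χ z = detℤ n (λ i j → z ℤ.* δ i j ℤ.- A i j)
  det-δ : detℤ n δ ≡ 1ℤ
  det-δ = trans (det-congruent n _ _ λ i j → sym (ℤ.*-identityˡ (δ i j))) (trans (det-scalar n 1ℤ) (ℤ.^-zeroˡ n))
  χ-monic : HasTop n 1ℤ χ
  χ-monic = hasTop-cong det-δ (λ _ → refl) (hasTop-det n δ (λ i j → ℤ.- A i j))
  χ≡ : ∀ z → evalP (charPoly n A) z ≡ evalTop (proj₁ χ-monic) 1ℤ z
  χ≡ z = trans (evalP-charPoly z n A) (proj₂ χ-monic z)
  -- Column `j` is the cofactor applied to the j-th basis vector. Since h(A) = 0 for h = `roots ls`,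
  -- this gives (z - A) B(z) = h(z), and taking determinants produces the n-th power of h.
  B : ℤ → Mat n
  B z i j = cofactor ls (act A) z (λ k → δ k j) i
  B-poly : IsPoly (λ z → detℤ n (B z))
  B-poly = isPoly-det n B λ i j → isPoly-cofactor ls (act A) (λ k → δ k j) i
  product : ∀ z i j → ((λ i j → z ℤ.* δ i j ℤ.- A i j) ⊗ B z) i j ≡ roots ls z ℤ.* δ i j
  product z i j = begin
    sum (λ k → (z ℤ.* δ i k ℤ.- A i k) ℤ.* B z k j)
      ≡⟨ sum-cong-≗ {x = λ k → (z ℤ.* δ i k ℤ.- A i k) ℤ.* B z k j}
                    {y = λ k → z ℤ.* (δ i k ℤ.* B z k j) ℤ.+ ℤ.-1ℤ ℤ.* (A i k ℤ.* B z k j)}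
                    (λ k → id₀ z (δ i k) (A i k) (B z k j)) ⟩
    sum (λ k → z ℤ.* (δ i k ℤ.* B z k j) ℤ.+ ℤ.-1ℤ ℤ.* (A i k ℤ.* B z k j))
      ≡⟨ sum-linear ℤ.-1ℤ (λ k → z ℤ.* (δ i k ℤ.* B z k j)) (λ k → A i k ℤ.* B z k j) ⟩
    sum (λ k → z ℤ.* (δ i k ℤ.* B z k j)) ℤ.+ ℤ.-1ℤ ℤ.* act A (λ k → B z k j) i
      ≡⟨ cong (ℤ._+ ℤ.-1ℤ ℤ.* act A (λ k → B z k j) i)
           (trans (sym (*-distribˡ-sum z (λ k → δ i k ℤ.* B z k j))) (cong (z ℤ.*_) (sum-δ i (λ k → B z k j)))) ⟩
    z ℤ.* B z i j ℤ.+ ℤ.-1ℤ ℤ.* act A (λ k → B z k j) i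
      ≡⟨ id₁ (z ℤ.* B z i j) (act A (λ k → B z k j) i) ⟩
    z ℤ.* B z i j ℤ.- act A (λ k → B z k j) i
      ≡⟨ cofactor-spec (act-linear A) ls z (λ k → δ k j) i ⟩
    roots ls z ℤ.* δ i j ℤ.- applyRoots ls (act A) (λ k → δ k j) i
      ≡⟨ cong (λ x → roots ls z ℤ.* δ i j ℤ.- x) (split (λ k → δ k j) i) ⟩
    roots ls z ℤ.* δ i j ℤ.- 0ℤ
      ≡⟨ ℤ.+-identityʳ _ ⟩
    roots ls z ℤ.* δ i j ∎
    where
    id₀ : ∀ z d a b → (z ℤ.* d ℤ.- a) ℤ.* b ≡ z ℤ.* (d ℤ.* b) ℤ.+ ℤ.-1ℤ ℤ.* (a ℤ.* b)
    id₀ = solve-∀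
    id₁ : ∀ x y → x ℤ.+ ℤ.-1ℤ ℤ.* y ≡ x ℤ.- y
    id₁ = solve-∀
  divides : ∀ z → evalTop (proj₁ χ-monic) 1ℤ z ℤ.* evalP (proj₁ B-poly) z ≡ roots (List.concat (List.replicate n ls)) z
  divides z = begin
    evalTop (proj₁ χ-monic) 1ℤ z ℤ.* evalP (proj₁ B-poly) z ≡⟨ cong₂ ℤ._*_ (proj₂ χ-monic z) (proj₂ B-poly z) ⟨
    χ z ℤ.* detℤ n (B z)                                    ≡⟨ det-⊗ n (λ i j → z ℤ.* δ i j ℤ.- A i j) (B z) ⟨
    detℤ n ((λ i j → z ℤ.* δ i j ℤ.- A i j) ⊗ B z)          ≡⟨ det-congruent n _ _ (product z) ⟩
    detℤ n (λ i j → roots ls z ℤ.* δ i j)                   ≡⟨ det-scalar n (roots ls z) ⟩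
    roots ls z ℤ.^ n                                        ≡⟨ roots-power ls n z ⟨
    roots (List.concat (List.replicate n ls)) z             ∎
  χ-splits : ∃ λ (ev : Fin n → ℤ) → ∀ z → evalTop (proj₁ χ-monic) 1ℤ z ≡ prodℤ n (λ i → z ℤ.- ev i)
  χ-splits = divisor-splits (List.concat (List.replicate n ls)) (proj₁ χ-monic) (proj₁ B-poly) divides

-- Monic polynomials over a finite field

module FieldProperties {Q : ℕ} (F : FiniteField Q) where
  open FiniteField F public
    using (Carrier; _≈_; 0#; 1#; cring; 0≉1; inverse; enum; enum-injective; enum-surjective; pow; InR)
    renaming (_+_ to infixl 6 _+ᶠ_; _*_ to infixl 7 _*ᶠ_; _-_ to infixl 6 _-ᶠ_; -_ to -ᶠ_)
  module R = CommutativeRing cring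
  module Mult = Algebra.Properties.Semiring.Mult R.semiring
  module Exp = Algebra.Properties.CommutativeSemiring.Exp R.commutativeSemiring
  module Sum = Algebra.Properties.CommutativeMonoid.Sum R.+-commutativeMonoid
  module Prod = Algebra.Properties.CommutativeMonoid.Sum R.*-commutativeMonoid
  module G = Algebra.Properties.AbelianGroup R.+-abelianGroup
  module Gr = Algebra.Properties.Group R.+-group
  module Solver = Algebra.Solver.Ring.NaturalCoefficients.Default R.commutativeSemiring
  open Relation.Binary.Reasoning.Setoid R.setoid

  index : Carrier → Fin Q
  index x = proj₁ (enum-surjective x)

  enum-index : ∀ x → enum (index x) ≈ x
  enum-index x = proj₂ (enum-surjective x)

  index-cong : ∀ {x y} → x ≈ y → index x ≡ index y
  index-cong {x} {y} e = enum-injective _ _ (R.trans (enum-index x) (R.trans e (R.sym (enum-index y))))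

  index-enum : ∀ i → index (enum i) ≡ i
  index-enum i = enum-injective _ _ (enum-index (enum i))

  _≈?_ : ∀ x y → Dec (x ≈ y)
  x ≈? y = map′ (λ e → R.trans (R.sym (enum-index x)) (R.trans (R.reflexive (cong enum e)) (enum-index y)))
                index-cong (index x Fin.≟ index y)

  zero-product : ∀ {x y} → x *ᶠ y ≈ 0# → ¬ x ≈ 0# → y ≈ 0#
  zero-product {x} {y} xy≈0 x≉0 = begin
    y                 ≈⟨ R.*-identityˡ y ⟨
    1# *ᶠ y           ≈⟨ R.*-congʳ (proj₂ (inverse x x≉0)) ⟨
    x *ᶠ x⁻¹ *ᶠ y     ≈⟨ R.*-congʳ (R.*-comm x x⁻¹) ⟩
    x⁻¹ *ᶠ x *ᶠ y     ≈⟨ R.*-assoc x⁻¹ x y ⟩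
    x⁻¹ *ᶠ (x *ᶠ y)   ≈⟨ R.*-congˡ xy≈0 ⟩
    x⁻¹ *ᶠ 0#         ≈⟨ R.zeroʳ x⁻¹ ⟩
    0#                ∎
    where x⁻¹ = proj₁ (inverse x x≉0)

  product-nonzero : ∀ {x y} → ¬ x ≈ 0# → ¬ y ≈ 0# → ¬ x *ᶠ y ≈ 0#
  product-nonzero x≉0 y≉0 xy≈0 = y≉0 (zero-product xy≈0 x≉0)

  pow≡^ : ∀ x n → pow x n ≡ x Exp.^ n
  pow≡^ x zero    = refl
  pow≡^ x (suc n) = cong (x *ᶠ_) (pow≡^ x n)

  pow-cong : ∀ n {x y} → x ≈ y → pow x n ≈ pow y n
  pow-cong zero    e = R.refl
  pow-cong (suc n) e = R.*-cong e (pow-cong n e)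

  pow-distrib-* : ∀ x y n → pow (x *ᶠ y) n ≈ pow x n *ᶠ pow y n
  pow-distrib-* x y n rewrite pow≡^ (x *ᶠ y) n | pow≡^ x n | pow≡^ y n = Exp.^-distrib-* x y n

  pow-pow : ∀ x m n → pow (pow x m) n ≈ pow x (m ℕ.* n)
  pow-pow x m n rewrite pow≡^ x m | pow≡^ (x Exp.^ m) n | pow≡^ x (m ℕ.* n) = Exp.^-assocʳ x m n

  pow-one : ∀ n → pow 1# n ≈ 1#
  pow-one zero    = R.refl
  pow-one (suc n) = R.trans (R.*-identityˡ _) (pow-one n)

  pow-nonzero : ∀ {x} n → ¬ x ≈ 0# → ¬ pow x n ≈ 0#
  pow-nonzero zero    x≉0 e = 0≉1 (R.sym e)
  pow-nonzero (suc n) x≉0   = product-nonzero x≉0 (pow-nonzero n x≉0)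

  pow-zero : ∀ n {x} → pow x n ≈ 0# → x ≈ 0#
  pow-zero n {x} e with x ≈? 0#
  ... | yes x≈0 = x≈0
  ... | no x≉0  = contradiction e (pow-nonzero n x≉0)

  evalMonic : ∀ {n} → Vec Carrier n → Carrier → Carrier
  evalMonic []       x = 1#
  evalMonic (a ∷ as) x = a +ᶠ x *ᶠ evalMonic as x

  evalMonic-cong : ∀ {n} (as : Vec Carrier n) {x y} → x ≈ y → evalMonic as x ≈ evalMonic as y
  evalMonic-cong []       e = R.refl
  evalMonic-cong (a ∷ as) e = R.+-congˡ (R.*-cong e (evalMonic-cong as e))

  -- `d` stands for x - a. Describing it by x ≈ d + a keeps the identities free of subtraction,
  -- within the scope of the semiring solver.
  divideMonic : ∀ {n} (as : Vec Carrier (suc n)) a → ∃ λ (bs : Vec Carrier n) →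
    ∀ x d → x ≈ d +ᶠ a → evalMonic as x ≈ d *ᶠ evalMonic bs x +ᶠ evalMonic as a
  divideMonic (b ∷ []) a = [] , λ x d x≈d+a → R.trans (R.+-congˡ (R.*-congʳ x≈d+a)) (ident b d a 1#)
    where
    ident : ∀ b d a e → b +ᶠ (d +ᶠ a) *ᶠ e ≈ d *ᶠ e +ᶠ (b +ᶠ a *ᶠ e)
    ident = solve 4 (λ b d a e → b :+ (d :+ a) :* e := d :* e :+ (b :+ a :* e)) R.refl
      where open Solver
  divideMonic (b ∷ b′ ∷ as) a = let bs , e = divideMonic (b′ ∷ as) a in
    evalMonic (b′ ∷ as) a ∷ bs , λ x d x≈d+a → begin
      b +ᶠ x *ᶠ evalMonic (b′ ∷ as) x
        ≈⟨ R.+-congˡ (R.*-cong x≈d+a (e x d x≈d+a)) ⟩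
      b +ᶠ (d +ᶠ a) *ᶠ (d *ᶠ evalMonic bs x +ᶠ evalMonic (b′ ∷ as) a)
        ≈⟨ ident b d a (evalMonic bs x) (evalMonic (b′ ∷ as) a) ⟩
      d *ᶠ (evalMonic (b′ ∷ as) a +ᶠ (d +ᶠ a) *ᶠ evalMonic bs x) +ᶠ (b +ᶠ a *ᶠ evalMonic (b′ ∷ as) a)
        ≈⟨ R.+-congʳ (R.*-congˡ (R.+-congˡ (R.*-congʳ x≈d+a))) ⟨
      d *ᶠ (evalMonic (b′ ∷ as) a +ᶠ x *ᶠ evalMonic bs x) +ᶠ (b +ᶠ a *ᶠ evalMonic (b′ ∷ as) a) ∎
    where
    ident : ∀ b d a g f → b +ᶠ (d +ᶠ a) *ᶠ (d *ᶠ g +ᶠ f) ≈ d *ᶠ (f +ᶠ (d +ᶠ a) *ᶠ g) +ᶠ (b +ᶠ a *ᶠ f)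
    ident = solve 5 (λ b d a g f → b :+ (d :+ a) :* (d :* g :+ f) := d :* (f :+ (d :+ a) :* g) :+ (b :+ a :* f)) R.refl
      where open Solver

  subtract-add : ∀ x a → x ≈ (x -ᶠ a) +ᶠ a
  subtract-add x a = R.sym (R.trans (R.+-assoc x (-ᶠ a) a)
    (R.trans (R.+-congˡ (R.-‿inverseˡ a)) (R.+-identityʳ x)))

  difference-nonzero : ∀ {x a} → ¬ x ≈ a → ¬ (x -ᶠ a) ≈ 0#
  difference-nonzero {x} {a} x≉a e = x≉a (R.trans (subtract-add x a) (R.trans (R.+-congʳ e) (R.+-identityˡ a)))

  -- Dividing by the linear factor of the first root leaves a monic polynomial of degree one less
  -- that vanishes at the other roots, as a field has no zero divisors.
  root-bound : ∀ {m n} (as : Vec Carrier n) (f : Fin m → Carrier) →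
    (∀ i j → f i ≈ f j → i ≡ j) → (∀ i → evalMonic as (f i) ≈ 0#) → m ≤ n
  root-bound {zero}          as f inj roots = ℕ.z≤n
  root-bound {suc m} {zero}  [] f inj roots = contradiction (R.sym (roots Fin.zero)) 0≉1
  root-bound {suc m} {suc n} as f inj roots = ℕ.s≤s (root-bound (proj₁ division) (f ∘ Fin.suc)
    (λ i j e → Fin.suc-injective (inj _ _ e)) λ i → zero-product (begin
      (f (Fin.suc i) -ᶠ f Fin.zero) *ᶠ evalMonic (proj₁ division) (f (Fin.suc i))
        ≈⟨ R.+-identityʳ _ ⟨
      (f (Fin.suc i) -ᶠ f Fin.zero) *ᶠ evalMonic (proj₁ division) (f (Fin.suc i)) +ᶠ 0#
        ≈⟨ R.+-congˡ (roots Fin.zero) ⟨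
      (f (Fin.suc i) -ᶠ f Fin.zero) *ᶠ evalMonic (proj₁ division) (f (Fin.suc i)) +ᶠ evalMonic as (f Fin.zero)
        ≈⟨ proj₂ division (f (Fin.suc i)) _ (subtract-add _ _) ⟨
      evalMonic as (f (Fin.suc i))
        ≈⟨ roots (Fin.suc i) ⟩
      0# ∎)
    (difference-nonzero λ e → Fin.0≢1+n (sym (inj _ _ e))))
    where
    division = divideMonic as (f Fin.zero)

  evalMonic-pad : ∀ m {n} (as : Vec Carrier n) x → evalMonic (Vec.replicate m 0# Vec.++ as) x ≈ pow x m *ᶠ evalMonic as x
  evalMonic-pad zero    as x = R.sym (R.*-identityˡ _)
  evalMonic-pad (suc m) as x = begin
    0# +ᶠ x *ᶠ evalMonic (Vec.replicate m 0# Vec.++ as) x ≈⟨ R.+-identityˡ _ ⟩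
    x *ᶠ evalMonic (Vec.replicate m 0# Vec.++ as) x       ≈⟨ R.*-congˡ (evalMonic-pad m as x) ⟩
    x *ᶠ (pow x m *ᶠ evalMonic as x)                      ≈⟨ R.*-assoc x _ _ ⟨
    x *ᶠ pow x m *ᶠ evalMonic as x                        ∎

  -- Turns vanishing at (k + 1)-th powers x ^ (k + 1) into vanishing at x itself, with the degree
  -- multiplied by k + 1, so that `root-bound` can count the x.
  substitutePower : ∀ k {n} (as : Vec Carrier n) → ∃ λ (bs : Vec Carrier (n ℕ.* suc k)) →
    ∀ x → evalMonic bs x ≈ evalMonic as (pow x (suc k))
  substitutePower k []       = [] , λ x → R.refl
  substitutePower k (a ∷ as) = let bs , e = substitutePower k as in
    a ∷ (Vec.replicate k 0# Vec.++ bs) , λ x → R.+-congˡ (begin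
      x *ᶠ evalMonic (Vec.replicate k 0# Vec.++ bs) x      ≈⟨ R.*-congˡ (evalMonic-pad k bs x) ⟩
      x *ᶠ (pow x k *ᶠ evalMonic bs x)                     ≈⟨ R.*-assoc x _ _ ⟨
      x *ᶠ pow x k *ᶠ evalMonic bs x                       ≈⟨ R.*-congˡ (e x) ⟩
      pow x (suc k) *ᶠ evalMonic as (pow x (suc k))        ∎)

  multiplication : ∀ x → ¬ x ≈ 0# → Permutation′ Q
  multiplication x x≉0 = permutation (λ i → index (x *ᶠ enum i)) (λ i → index (x⁻¹ *ᶠ enum i))
    (λ i → undo x x⁻¹ xx⁻¹ i) (λ i → undo x⁻¹ x (R.trans (R.*-comm x⁻¹ x) xx⁻¹) i)
    where
    x⁻¹  = proj₁ (inverse x x≉0)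
    xx⁻¹ = proj₂ (inverse x x≉0)
    undo : ∀ a b → a *ᶠ b ≈ 1# → ∀ i → index (a *ᶠ enum (index (b *ᶠ enum i))) ≡ i
    undo a b ab≈1 i = trans (index-cong (begin
      a *ᶠ enum (index (b *ᶠ enum i)) ≈⟨ R.*-congˡ (enum-index _) ⟩
      a *ᶠ (b *ᶠ enum i)              ≈⟨ R.*-assoc a b _ ⟨
      a *ᶠ b *ᶠ enum i                ≈⟨ R.*-congʳ ab≈1 ⟩
      1# *ᶠ enum i                    ≈⟨ R.*-identityˡ _ ⟩
      enum i                          ∎)) (index-enum i)

  translation : Carrier → Permutation′ Q
  translation a = permutation (λ i → index (enum i +ᶠ a)) (λ i → index (enum i +ᶠ -ᶠ a))
    (undo (-ᶠ a) a (R.-‿inverseˡ a)) (undo a (-ᶠ a) (R.-‿inverseʳ a))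
    where
    undo : ∀ b c → b +ᶠ c ≈ 0# → ∀ i → index (enum (index (enum i +ᶠ b)) +ᶠ c) ≡ i
    undo b c e i = trans (index-cong (begin
      enum (index (enum i +ᶠ b)) +ᶠ c ≈⟨ R.+-congʳ (enum-index _) ⟩
      enum i +ᶠ b +ᶠ c                ≈⟨ R.+-assoc _ b c ⟩
      enum i +ᶠ (b +ᶠ c)              ≈⟨ R.+-congˡ e ⟩
      enum i +ᶠ 0#                    ≈⟨ R.+-identityʳ _ ⟩
      enum i                          ∎)) (index-enum i)

  ι : ℕ → Carrier
  ι n = n Mult.× 1#

  ι-* : ∀ m n → ι (m ℕ.* n) ≈ ι m *ᶠ ι n
  ι-* = Mult.×1-homo-*

  ι-+ : ∀ m n → ι (m ℕ.+ n) ≈ ι m +ᶠ ι n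
  ι-+ = Mult.×-homo-+ 1#

  ι-^ : ∀ m n → ι (m ℕ.^ n) ≈ pow (ι m) n
  ι-^ m zero    = R.+-identityʳ 1#
  ι-^ m (suc n) = R.trans (ι-* m (m ℕ.^ n)) (R.*-congˡ (ι-^ m n))

  -- Translation by 1 permutes the field, so Q · 1 + Σ x = Σ x.
  ι-order : ι Q ≈ 0#
  ι-order = Gr.identityʳ-unique total (ι Q) (begin
    total +ᶠ ι Q                                ≈⟨ R.+-congˡ (Sum.sum-replicate Q) ⟨
    total +ᶠ Sum.sum {Q} (λ _ → 1#)             ≈⟨ Sum.∑-distrib-+ enum (λ _ → 1#) ⟨
    Sum.sum (λ i → enum i +ᶠ 1#)                ≈⟨ Sum.sum-cong-≋ (λ i → R.sym (enum-index (enum i +ᶠ 1#))) ⟩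
    Sum.sum (λ i → enum (translation 1# ⟨$⟩ʳ i)) ≈⟨ Sum.sum-permute enum (translation 1#) ⟨
    total                                       ∎)
    where total = Sum.sum enum

  module _ {p : ℕ} (n : ℕ) (Q≡p^n : Q ≡ p ℕ.^ n) where
    -- ι(p) ^ n = ι(Q) = 0, and a field has no nonzero nilpotents.
    characteristic : ι p ≈ 0#
    characteristic = pow-zero n (R.trans (R.sym (ι-^ p n)) (R.trans (R.reflexive (cong ι (sym Q≡p^n))) ι-order))

    ι-multiple : ∀ m → ι (m ℕ.* p) ≈ 0#
    ι-multiple m = R.trans (ι-* m p) (R.trans (R.*-congˡ characteristic) (R.zeroʳ _))

  InR-cong : ∀ k {x y} → x ≈ y → InR k x → InR k y
  InR-cong k x≈y (z , z≉0 , e) = z , z≉0 , R.trans e x≈y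

  InR-* : ∀ k {x y} → InR k x → InR k y → InR k (x *ᶠ y)
  InR-* k (u , u≉0 , eu) (v , v≉0 , ev) =
    u *ᶠ v , product-nonzero u≉0 v≉0 , R.trans (pow-distrib-* u v k) (R.*-cong eu ev)

  InR-cancel : ∀ k {x y} → InR k x → InR k (x *ᶠ y) → InR k y
  InR-cancel k {x} {y} (u , u≉0 , eu) xy∈R =
    InR-cong k (begin
      u⁻ᵏ *ᶠ (x *ᶠ y)        ≈⟨ R.*-assoc u⁻ᵏ x y ⟨
      u⁻ᵏ *ᶠ x *ᶠ y          ≈⟨ R.*-congʳ (R.*-congˡ eu) ⟨
      u⁻ᵏ *ᶠ pow u k *ᶠ y    ≈⟨ R.*-congʳ (pow-distrib-* u⁻¹ u k) ⟨
      pow (u⁻¹ *ᶠ u) k *ᶠ y  ≈⟨ R.*-congʳ (R.trans (pow-cong k u⁻¹u≈1) (pow-one k)) ⟩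
      1# *ᶠ y                ≈⟨ R.*-identityˡ y ⟩
      y                      ∎)
      (InR-* k (u⁻¹ , u⁻¹≉0 , R.refl) xy∈R)
    where
    u⁻¹ = proj₁ (inverse u u≉0)
    u⁻ᵏ = pow u⁻¹ k
    u⁻¹u≈1 : u⁻¹ *ᶠ u ≈ 1#
    u⁻¹u≈1 = R.trans (R.*-comm u⁻¹ u) (proj₂ (inverse u u≉0))
    u⁻¹≉0 : ¬ u⁻¹ ≈ 0#
    u⁻¹≉0 e = 0≉1 (R.trans (R.sym (R.zeroˡ u)) (R.trans (R.*-congʳ (R.sym e)) u⁻¹u≈1))

  InR? : ∀ k y → Dec (InR k y)
  InR? k y = map′ (λ (i , e) → enum i , e)
    (λ (x , x≉0 , e) → index x , (λ e′ → x≉0 (R.trans (R.sym (enum-index x)) e′)) , R.trans (pow-cong k (enum-index x)) e)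
    (Fin.any? λ i → ¬? (enum i ≈? 0#) ×-dec (pow (enum i) k ≈? y))

-- Power residues in the multiplicative group

module PowerResidues {N : ℕ} (F : FiniteField (suc N)) where
  open FieldProperties F
  open Relation.Binary.Reasoning.Setoid R.setoid

  nonzero : Fin N → Carrier
  nonzero j = enum (punchIn (index 0#) j)

  nonzero≉0 : ∀ j → ¬ nonzero j ≈ 0#
  nonzero≉0 j e = Fin.punchInᵢ≢i (index 0#) j (trans (sym (index-enum _)) (index-cong e))

  private
    -- Replacing the value at 0 by 1 makes a product over the nonzero elements a product over all of
    -- `Fin Q`, where multiplication by x acts as a permutation.
    weight : (Carrier → Carrier) → Carrier → Carrier
    weight f x with x ≈? 0#
    ... | yes _ = 1#
    ... | no _  = f x

    weight-zero : ∀ f {x} → x ≈ 0# → weight f x ≡ 1#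
    weight-zero f {x} x≈0 with x ≈? 0#
    ... | yes _   = refl
    ... | no x≉0 = contradiction x≈0 x≉0

    weight-nonzero : ∀ f {x} → ¬ x ≈ 0# → weight f x ≡ f x
    weight-nonzero f {x} x≉0 with x ≈? 0#
    ... | yes x≈0 = contradiction x≈0 x≉0
    ... | no _    = refl

    weight-product : ∀ f → Prod.sum (λ i → weight f (enum i)) ≈ Prod.sum (λ j → f (nonzero j))
    weight-product f = begin
      Prod.sum (λ i → weight f (enum i))
        ≈⟨ Prod.sum-remove {i = index 0#} (λ i → weight f (enum i)) ⟩
      weight f (enum (index 0#)) *ᶠ Prod.sum (λ j → weight f (nonzero j))
        ≈⟨ R.*-cong (R.reflexive (weight-zero f (enum-index 0#)))
                    (Prod.sum-cong-≋ (λ j → R.reflexive (weight-nonzero f (nonzero≉0 j)))) ⟩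
      1# *ᶠ Prod.sum (λ j → f (nonzero j))
        ≈⟨ R.*-identityˡ _ ⟩
      Prod.sum (λ j → f (nonzero j)) ∎

    product-nonzero-all : ∀ n (f : Fin n → Carrier) → (∀ i → ¬ f i ≈ 0#) → ¬ Prod.sum f ≈ 0#
    product-nonzero-all zero    f f≉0 e = 0≉1 (R.sym e)
    product-nonzero-all (suc n) f f≉0   = product-nonzero (f≉0 Fin.zero) (product-nonzero-all n (f ∘ Fin.suc) (f≉0 ∘ Fin.suc))

    product-replicate : ∀ n x → Prod.sum {n} (λ _ → x) ≈ pow x n
    product-replicate zero    x = R.refl
    product-replicate (suc n) x = R.*-congˡ (product-replicate n x)

  -- Multiplication by x permutes the nonzero elements.
  pow-order : ∀ {x} → ¬ x ≈ 0# → pow x N ≈ 1#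
  pow-order {x} x≉0 = begin
    pow x N       ≈⟨ R.*-identityˡ _ ⟨
    1# *ᶠ pow x N ≈⟨ R.*-congʳ (proj₂ (inverse total total≉0)) ⟨
    total *ᶠ total⁻¹ *ᶠ pow x N ≈⟨ reorder total total⁻¹ (pow x N) ⟩
    pow x N *ᶠ total *ᶠ total⁻¹ ≈⟨ R.*-congʳ absorb ⟩
    total *ᶠ total⁻¹ ≈⟨ proj₂ (inverse total total≉0) ⟩
    1# ∎
    where
    id′ : Carrier → Carrier
    id′ y = y
    total = Prod.sum (λ i → weight id′ (enum i))
    total≉0 : ¬ total ≈ 0#
    total≉0 e = product-nonzero-all N nonzero nonzero≉0 (R.trans (R.sym (weight-product id′)) e)
    total⁻¹ = proj₁ (inverse total total≉0)
    reorder : ∀ a b c → a *ᶠ b *ᶠ c ≈ c *ᶠ a *ᶠ b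
    reorder a b c = R.trans (R.*-comm (a *ᶠ b) c) (R.sym (R.*-assoc c a b))
    step : ∀ i → weight id′ (enum (multiplication x x≉0 ⟨$⟩ʳ i)) ≈ weight (λ _ → x) (enum i) *ᶠ weight id′ (enum i)
    step i with enum i ≈? 0#
    ... | yes e≈0 = R.trans (R.reflexive (weight-zero id′ (R.trans (enum-index _) (R.trans (R.*-congˡ e≈0) (R.zeroʳ x)))))
                            (R.sym (R.*-identityˡ 1#))
    ... | no e≉0  = R.trans (R.reflexive (weight-nonzero id′ λ e → product-nonzero x≉0 e≉0 (R.trans (R.sym (enum-index _)) e)))
                            (enum-index _)
    absorb : pow x N *ᶠ total ≈ total
    absorb = begin
      pow x N *ᶠ total
        ≈⟨ R.*-congʳ (R.trans (weight-product (λ _ → x)) (product-replicate N x)) ⟨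
      Prod.sum (λ i → weight (λ _ → x) (enum i)) *ᶠ total
        ≈⟨ Prod.∑-distrib-+ (λ i → weight (λ _ → x) (enum i)) (λ i → weight id′ (enum i)) ⟨
      Prod.sum (λ i → weight (λ _ → x) (enum i) *ᶠ weight id′ (enum i))
        ≈⟨ Prod.sum-cong-≋ (λ i → R.sym (step i)) ⟩
      Prod.sum (λ i → weight id′ (enum (multiplication x x≉0 ⟨$⟩ʳ i)))
        ≈⟨ Prod.sum-permute (λ i → weight id′ (enum i)) (multiplication x x≉0) ⟨
      total ∎

  -- Otherwise (Z ^ r − 1) / (Z − y) would vanish at all the powers x ^ k,
  -- and so give a polynomial in x of degree k (r − 1) < N with N roots.
  power-residue : ∀ k r → N ≡ suc k ℕ.* suc r → ∀ {y} → pow y (suc r) ≈ 1# → InR (suc k) y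
  power-residue k r N≡ {y} y^r≈1 with InR? (suc k) y
  ... | yes y∈R = y∈R
  ... | no y∉R  = contradiction
    (root-bound (proj₁ composed) nonzero
      (λ i j e → Fin.punchIn-injective (index 0#) i j (enum-injective _ _ e))
      (λ j → R.trans (proj₂ composed (nonzero j)) (g-vanishes j)))
    (ℕ.<⇒≱ (ℕ.≤-trans (ℕ.*-monoˡ-< (suc k) {r} {suc r} (ℕ.n<1+n r)) (ℕ.≤-reflexive (trans (ℕ.*-comm (suc r) (suc k)) (sym N≡)))))
    where
    -- The lower coefficients of Z ^ (r + 1) - 1, with the leading 1 implicit. The summand 0 is the
    -- length of the empty vector appended.
    zʳ-1 : Vec Carrier (suc (r ℕ.+ 0))
    zʳ-1 = (-ᶠ 1#) ∷ (Vec.replicate r 0# Vec.++ [])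
    zʳ-1-spec : ∀ x → pow x (suc r) ≈ 1# → evalMonic zʳ-1 x ≈ 0#
    zʳ-1-spec x e = begin
      -ᶠ 1# +ᶠ x *ᶠ evalMonic (Vec.replicate r 0# Vec.++ []) x ≈⟨ R.+-congˡ (R.*-congˡ (R.trans (evalMonic-pad r [] x) (R.*-identityʳ _))) ⟩
      -ᶠ 1# +ᶠ pow x (suc r)                                   ≈⟨ R.+-congˡ e ⟩
      -ᶠ 1# +ᶠ 1#                                              ≈⟨ R.-‿inverseˡ 1# ⟩
      0#                                                       ∎
    division : ∃ λ (bs : Vec Carrier (r ℕ.+ 0)) → _
    division = divideMonic zʳ-1 y
    composed : ∃ λ (bs : Vec Carrier (r ℕ.* suc k)) → ∀ x → evalMonic bs x ≈ evalMonic (proj₁ division) (pow x (suc k))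
    composed = subst (λ m → ∃ λ (bs : Vec Carrier (m ℕ.* suc k)) → ∀ x → evalMonic bs x ≈ evalMonic (proj₁ division) (pow x (suc k)))
      {r ℕ.+ 0} {r} (ℕ.+-identityʳ r) (substitutePower k (proj₁ division))
    g-vanishes : ∀ j → evalMonic (proj₁ division) (pow (nonzero j) (suc k)) ≈ 0#
    g-vanishes j = zero-product (begin
      (z -ᶠ y) *ᶠ evalMonic (proj₁ division) z                       ≈⟨ R.+-identityʳ _ ⟨
      (z -ᶠ y) *ᶠ evalMonic (proj₁ division) z +ᶠ 0#                 ≈⟨ R.+-congˡ (zʳ-1-spec y y^r≈1) ⟨
      (z -ᶠ y) *ᶠ evalMonic (proj₁ division) z +ᶠ evalMonic zʳ-1 y   ≈⟨ proj₂ division z (z -ᶠ y) (subtract-add z y) ⟨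
      evalMonic zʳ-1 z                                               ≈⟨ zʳ-1-spec z z^r≈1 ⟩
      0#                                                             ∎)
      (difference-nonzero λ e → y∉R (nonzero j , nonzero≉0 j , e))
      where
      z = pow (nonzero j) (suc k)
      z^r≈1 : pow z (suc r) ≈ 1#
      z^r≈1 = R.trans (pow-pow (nonzero j) (suc k) (suc r))
        (R.trans (R.reflexive (cong (pow (nonzero j)) (sym N≡))) (pow-order (nonzero≉0 j)))

-- Cayley graphs on a field of characteristic p

-- Both sides are the sum of f over 0, ..., p.
sum-shift : ∀ p (f : ℕ → ℤ) →
  sum {p} (λ c → f (suc (toℕ c))) ℤ.+ f 0 ≡ sum {p} (λ c → f (toℕ c)) ℤ.+ f p
sum-shift zero    f = refl
sum-shift (suc p) f = begin
  f 1 ℤ.+ sum {p} (λ c → f (suc (suc (toℕ c)))) ℤ.+ f 0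
    ≡⟨ cong (ℤ._+ f 0) (ℤ.+-comm (f 1) _) ⟩
  sum {p} (λ c → f (suc (suc (toℕ c)))) ℤ.+ f 1 ℤ.+ f 0
    ≡⟨ cong (ℤ._+ f 0) (sum-shift p (f ∘ suc)) ⟩
  sum {p} (λ c → f (suc (toℕ c))) ℤ.+ f (suc p) ℤ.+ f 0
    ≡⟨ ident (sum {p} (λ c → f (suc (toℕ c)))) (f (suc p)) (f 0) ⟩
  f 0 ℤ.+ sum {p} (λ c → f (suc (toℕ c))) ℤ.+ f (suc p) ∎
  where
  open ≡-Reasoning
  ident : ∀ s a b → s ℤ.+ a ℤ.+ b ≡ b ℤ.+ s ℤ.+ a
  ident = solve-∀

-- Moving the window by one loses its first value and gains the value p places further on, which is
-- the same by periodicity. It replaces arithmetic modulo p in the index.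
sum-periodic : ∀ p (f : ℕ → ℤ) → (∀ m → f (p ℕ.+ m) ≡ f m) → ∀ m →
  sum {p} (λ c → f (toℕ c ℕ.+ m)) ≡ sum {p} (λ c → f (toℕ c))
sum-periodic p f periodic zero    = sum-cong-≗ {n = p} λ c → cong f (ℕ.+-identityʳ (toℕ c))
sum-periodic p f periodic (suc m) = trans
  (sum-cong-≗ {n = p} {x = λ c → f (toℕ c ℕ.+ suc m)} {y = λ c → g (suc (toℕ c))} λ c → cong f (ℕ.+-suc (toℕ c) m))
  (trans (ℤGroup.∙-cancelʳ (g 0) (sum {p} (λ c → g (suc (toℕ c)))) (sum {p} (λ c → g (toℕ c))) (trans (sum-shift p g) (cong (ℤ._+_ (sum {p} (λ c → g (toℕ c)))) (periodic m))))
    (sum-periodic p f periodic m))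
  where
  g : ℕ → ℤ
  g j = f (j ℕ.+ m)

sum-constant : ∀ p x → sum {p} (λ _ → x) ≡ + p ℤ.* x
sum-constant zero    x = sym (ℤ.*-zeroˡ x)
sum-constant (suc p) x = trans (cong (ℤ._+_ x) (sum-constant p x)) (sym (ℤ.suc-* (+ p) x))

module LineOperators {Q : ℕ} (F : FiniteField Q) (p : ℕ)
                     (ιp≈0 : FiniteField._≈_ F (FieldProperties.ι F p) (FiniteField.0# F)) where
  open FieldProperties F

  shift : Carrier → Fin Q → Fin Q
  shift a i = index (enum i +ᶠ a)

  shift-cong : ∀ {a b} → a ≈ b → ∀ i → shift a i ≡ shift b i
  shift-cong e i = index-cong (R.+-congˡ e)

  shift-shift : ∀ a b i → shift a (shift b i) ≡ shift (b +ᶠ a) i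
  shift-shift a b i = index-cong (R.trans (R.+-congʳ (enum-index _)) (R.+-assoc _ b a))

  shift-comm : ∀ a b i → shift a (shift b i) ≡ shift b (shift a i)
  shift-comm a b i = trans (shift-shift a b i) (trans (shift-cong (R.+-comm b a) i) (sym (shift-shift b a i)))

  shift-zero : ∀ {a} → a ≈ 0# → ∀ i → shift a i ≡ i
  shift-zero e i = trans (index-cong (R.trans (R.+-congˡ e) (R.+-identityʳ _))) (index-enum i)

  -- The index `c` runs over representatives of the prime field. At s = 0 this is p times the
  -- identity, so it obeys the same law L² = p L.
  line : Carrier → Op Q
  line s v i = sum {p} λ c → v (shift (ι (toℕ c) *ᶠ s) i)

  line-linear : ∀ s → LinearOp (line s)
  line-linear s = linearOp-sum p (λ c v i → v (shift (ι (toℕ c) *ᶠ s) i)) λ c d f g h e i → e _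

  line-comm : ∀ s t v i → line s (line t v) i ≡ line t (line s v) i
  line-comm s t v i = trans
    (∑-comm {p} {p} (λ c d → v (shift (ι (toℕ d) *ᶠ t) (shift (ι (toℕ c) *ᶠ s) i))))
    (sum-cong-≗ {n = p} λ d → sum-cong-≗ {n = p} λ c → cong v (shift-comm (ι (toℕ d) *ᶠ t) (ι (toℕ c) *ᶠ s) i))

  -- For each fixed translation c s in the outer sum, the inner sum runs over the same multiples of
  -- s, started at c instead of 0.
  line-square : ∀ s v i → line s (line s v) i ≡ + p ℤ.* line s v i
  line-square s v i = trans
    (sum-cong-≗ {n = p} {x = λ c → line s v (shift (ι (toℕ c) *ᶠ s) i)} {y = λ _ → line s v i} λ c → trans
      (sum-cong-≗ {n = p} λ d → cong v (trans (shift-shift _ _ i) (shift-cong (add (toℕ d) (toℕ c)) i)))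
      (sum-periodic p (λ m → v (shift (ι m *ᶠ s) i)) periodic (toℕ c)))
    (sum-constant p (line s v i))
    where
    add : ∀ d c → ι c *ᶠ s +ᶠ ι d *ᶠ s ≈ ι (d ℕ.+ c) *ᶠ s
    add d c = R.trans (R.+-comm _ _) (R.trans (R.sym (R.distribʳ s (ι d) (ι c))) (R.*-congʳ (R.sym (ι-+ d c))))
    periodic : ∀ m → v (shift (ι (p ℕ.+ m) *ᶠ s) i) ≡ v (shift (ι m *ᶠ s) i)
    periodic m = cong v (shift-cong (R.*-congʳ (R.trans (ι-+ p m) (R.trans (R.+-congʳ ιp≈0) (R.+-identityˡ _)))) i)

-- Averaging A over the permutations x ↦ c x of its connection set T gives
-- (p − 1) A = Σ T s (line s) − |T|.
module PrimeFieldInvariant {Q : ℕ} (F : FiniteField Q) (p : ℕ) .{{_ : ℕ.NonZero p}}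
    (ιp≈0 : FiniteField._≈_ F (FieldProperties.ι F (suc p)) (FiniteField.0# F))
    (k : ℕ) (ι∈R : ∀ c → c < p → FiniteField.InR F k (FieldProperties.ι F (suc c)))
    (A : Fin Q → Fin Q → ℤ) (adjacency : IsPaleyAdjacency F k A) where
  open FieldProperties F
  -- Here `suc p` is the integer that vanishes in the field; `p` counts the elements `ι (suc c)`
  -- with c < p, which lie in the connection set and are therefore nonzero.
  open LineOperators F (suc p) ιp≈0
  open ≡-Reasoning

  T : Row Q
  T s = A (index 0#) s

  T∈ : ∀ s → T s ≡ 1ℤ ⊎ T s ≡ 0ℤ
  T∈ s with adjacency (index 0#) s
  ... | inj₁ (e , _) = inj₁ e
  ... | inj₂ (e , _) = inj₂ e

  A-cong : ∀ {i j i′ j′} → (InR k (enum j -ᶠ enum i) → InR k (enum j′ -ᶠ enum i′)) →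
           (InR k (enum j′ -ᶠ enum i′) → InR k (enum j -ᶠ enum i)) → A i j ≡ A i′ j′
  A-cong {i} {j} {i′} {j′} to from with adjacency i j | adjacency i′ j′
  ... | inj₁ (e , _) | inj₁ (e′ , _)  = trans e (sym e′)
  ... | inj₁ (_ , r) | inj₂ (_ , ¬r′) = contradiction (to r) ¬r′
  ... | inj₂ (_ , ¬r) | inj₁ (_ , r′) = contradiction (from r′) ¬r
  ... | inj₂ (e , _) | inj₂ (e′ , _)  = trans e (sym e′)

  from-zero : ∀ s → enum s -ᶠ enum (index 0#) ≈ enum s
  from-zero s = R.trans (R.+-congˡ (R.trans (R.-‿cong (enum-index 0#)) Gr.ε⁻¹≈ε)) (R.+-identityʳ _)

  A-shift : ∀ i s → A i (shift (enum s) i) ≡ T s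
  A-shift i s = A-cong (InR-cong k same) (InR-cong k (R.sym same))
    where
    same : enum (shift (enum s) i) -ᶠ enum i ≈ enum s -ᶠ enum (index 0#)
    same = R.trans (R.+-congʳ (enum-index _)) (R.trans (G.xyx⁻¹≈y (enum i) (enum s)) (R.sym (from-zero s)))

  module _ (c : ℕ) (c<p : c < p) (ιc≉0 : ¬ ι (suc c) ≈ 0#) where
    dilation : Permutation′ Q
    dilation = multiplication (ι (suc c)) ιc≉0

    T-dilation : ∀ s → T (dilation ⟨$⟩ʳ s) ≡ T s
    T-dilation s = A-cong
      (λ r → InR-cong k (R.sym (from-zero s)) (InR-cancel k (ι∈R c c<p) (InR-cong k dilated r)))
      (λ r → InR-cong k (R.sym dilated) (InR-* k (ι∈R c c<p) (InR-cong k (from-zero s) r)))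
      where
      dilated : enum (dilation ⟨$⟩ʳ s) -ᶠ enum (index 0#) ≈ ι (suc c) *ᶠ enum s
      dilated = R.trans (from-zero _) (enum-index _)

  row-permutation : Fin Q → Permutation′ Q
  row-permutation i = permutation (λ s → shift (enum s) i) (λ j → index (enum j -ᶠ enum i))
    (λ j → trans (index-cong (R.trans (R.+-congˡ (enum-index _)) (R.trans (R.+-comm _ _) (R.sym (subtract-add (enum j) (enum i)))))) (index-enum j))
    (λ s → trans (index-cong (R.trans (R.+-congʳ (enum-index _)) (G.xyx⁻¹≈y (enum i) (enum s)))) (index-enum s))

  act-convolution : ∀ v i → act A v i ≡ sum λ s → T s ℤ.* v (shift (enum s) i)
  act-convolution v i = trans (sum-permute (λ j → A i j ℤ.* v j) (row-permutation i))
    (sum-cong-≗ {x = λ s → A i (shift (enum s) i) ℤ.* v (shift (enum s) i)} {y = λ s → T s ℤ.* v (shift (enum s) i)}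
      λ s → cong (ℤ._* v (shift (enum s) i)) (A-shift i s))

  act-dilated : ∀ c → c < p → ∀ v i → act A v i ≡ sum λ s → T s ℤ.* v (shift (ι (suc c) *ᶠ enum s) i)
  act-dilated c c<p v i = begin
    act A v i
      ≡⟨ act-convolution v i ⟩
    sum (λ s → T s ℤ.* v (shift (enum s) i))
      ≡⟨ sum-permute (λ s → T s ℤ.* v (shift (enum s) i)) π ⟩
    sum (λ s → T (π ⟨$⟩ʳ s) ℤ.* v (shift (enum (π ⟨$⟩ʳ s)) i))
      ≡⟨ sum-cong-≗ {x = λ s → T (π ⟨$⟩ʳ s) ℤ.* v (shift (enum (π ⟨$⟩ʳ s)) i)}
                    {y = λ s → T s ℤ.* v (shift (ι (suc c) *ᶠ enum s) i)}
           (λ s → cong₂ ℤ._*_ (T-dilation c c<p ιc≉0 s) (cong v (shift-cong (enum-index _) i))) ⟩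
    sum (λ s → T s ℤ.* v (shift (ι (suc c) *ᶠ enum s) i)) ∎
    where
    ιc≉0 : ¬ ι (suc c) ≈ 0#
    ιc≉0 e = let x , x≉0 , xᵏ≈ιc = ι∈R c c<p in pow-nonzero k x≉0 (R.trans xᵏ≈ιc e)
    π = dilation c c<p ιc≉0

  degree : ℤ
  degree = sum T

  averaged : ∀ v i → + p ℤ.* act A v i ≡ sum (λ s → T s ℤ.* line (enum s) v i) ℤ.+ (ℤ.- degree) ℤ.* v i
  averaged v i = begin
    + p ℤ.* act A v i                      ≡⟨ sum-constant p (act A v i) ⟨
    sum {p} (λ _ → act A v i)              ≡⟨ sum-cong-≗ {x = λ _ → act A v i} {y = λ c → sum (term c)}
                                                (λ c → act-dilated (toℕ c) (Fin.toℕ<n c) v i) ⟩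
    sum (λ c → sum (term c))               ≡⟨ ∑-comm term ⟩
    sum (λ s → sum {p} (λ c → term c s))
      -- The averages omit the multiple 0 that `line` includes. It translates by 0 and contributes v
      -- i for every s in the connection set, hence the correction by - `degree`.
      ≡⟨ sum-cong-≗ {x = λ s → sum {p} (λ c → term c s)}
                    {y = λ s → T s ℤ.* line (enum s) v i ℤ.+ (ℤ.- v i) ℤ.* T s}
           (λ s → trans (sym (*-distribˡ-sum {p} (T s) (λ c → value (suc (toℕ c)) s)))
             (without-zero (T s) (sum {p} (λ c → value (suc (toℕ c)) s)) (v i) (value 0 s)
               (cong v (shift-zero (R.zeroˡ (enum s)) i)))) ⟩
    sum (λ s → T s ℤ.* line (enum s) v i ℤ.+ (ℤ.- v i) ℤ.* T s)
      ≡⟨ sum-linear (ℤ.- v i) (λ s → T s ℤ.* line (enum s) v i) T ⟩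
    sum (λ s → T s ℤ.* line (enum s) v i) ℤ.+ (ℤ.- v i) ℤ.* degree
      ≡⟨ cong (ℤ._+_ (sum (λ s → T s ℤ.* line (enum s) v i))) (negate (v i) degree) ⟩
    sum (λ s → T s ℤ.* line (enum s) v i) ℤ.+ (ℤ.- degree) ℤ.* v i ∎
    where
    value : ℕ → Fin Q → ℤ
    value m s = v (shift (ι m *ᶠ enum s) i)
    term : Fin p → Fin Q → ℤ
    term c s = T s ℤ.* value (suc (toℕ c)) s
    negate : ∀ x d → (ℤ.- x) ℤ.* d ≡ (ℤ.- d) ℤ.* x
    negate = solve-∀
    ident : ∀ t S x → t ℤ.* S ≡ t ℤ.* (x ℤ.+ S) ℤ.+ (ℤ.- x) ℤ.* t
    ident = solve-∀
    without-zero : ∀ t S x y → y ≡ x → t ℤ.* S ≡ t ℤ.* (y ℤ.+ S) ℤ.+ (ℤ.- x) ℤ.* t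
    without-zero t S x y refl = ident t S x

  integral : IntegralSpectrum Q A
  integral = intSplit⇒integralSpectrum Q A (intSplit-unscale (act-linear A) p
    (intSplit-shift {X = λ v i → sum (λ s → T s ℤ.* line (enum s) v i)}
      (linearOp-sum Q (λ s v i → T s ℤ.* line (enum s) v i) λ s → linearOp-scale (T s) (line-linear (enum s)))
      (ℤ.- degree) averaged
      (intSplit-sum (+ suc p) (λ ()) Q T (line ∘ enum) T∈ (line-linear ∘ enum)
        (λ s t → line-comm (enum s) (enum t)) (λ s → line-square (enum s)))))

trivial-field : ¬ FiniteField 1
trivial-field F = 0≉1 (R.trans (R.sym (enum-index 0#))
  (R.trans (R.reflexive (cong enum (Fin1 (index 0#) (index 1#)))) (enum-index 1#)))
  where
  open FieldProperties F
  Fin1 : ∀ (i j : Fin 1) → i ≡ j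
  Fin1 Fin.zero Fin.zero = refl

-- For Q − 1 = K r the K-th powers are the solutions of y ^ r = 1, which include
-- the prime field when p − 1 divides r.
paley-integral : ∀ p n K r → Prime p →
  (∀ c .{{_ : ℕ.NonZero c}} → c < p → ∃ λ m → c ℕ.^ (p ℕ.∸ 1) ≡ suc (m ℕ.* p)) →
  p ℕ.∸ 1 ℕ.∣ r → ∀ {Q} → Q ≡ p ℕ.^ n → Q ≡ suc (K ℕ.* r) → PaleyIntegral K Q
-- If K or r is 0 then Q = 1, and no field has one element.
paley-integral p n zero    r       _ _ _ _ refl F = contradiction F trivial-field
paley-integral p n (suc k) zero    _ _ _ _ refl F = contradiction (subst FiniteField (cong suc (ℕ.*-zeroʳ k)) F) trivial-field
paley-integral 0 n (suc k) (suc r) p-prime _ _ _ _ F = contradiction (ℕ.nonTrivial⇒n>1 0 {{prime⇒nonTrivial p-prime}}) λ ()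
paley-integral 1 n (suc k) (suc r) p-prime _ _ _ _ F = contradiction (ℕ.nonTrivial⇒n>1 1 {{prime⇒nonTrivial p-prime}}) λ { (ℕ.s≤s ()) }
paley-integral (suc (suc q)) n (suc k) (suc r) p-prime fermat p-1∣r Q≡pⁿ refl F A adjacency =
  PrimeFieldInvariant.integral F (suc q) (characteristic n Q≡pⁿ) (suc k) ι∈R A adjacency
  where
  open FieldProperties F
  p = suc (suc q)
  ι-order-p-1 : ∀ c → c < suc q → pow (ι (suc c)) (suc q) ≈ 1#
  ι-order-p-1 c c<p = let m , e = fermat (suc c) (ℕ.s≤s c<p) in
    R.trans (R.sym (ι-^ (suc c) (suc q))) (R.trans (R.reflexive (cong ι e))
      (R.trans (R.+-congˡ (ι-multiple n Q≡pⁿ m)) (R.+-identityʳ 1#)))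
  ι∈R : ∀ c → c < suc q → InR (suc k) (ι (suc c))
  ι∈R c c<p = PowerResidues.power-residue F k r refl (raise p-1∣r)
    where
    raise : suc q ℕ.∣ suc r → pow (ι (suc c)) (suc r) ≈ 1#
    raise (ℕ.divides t e) = R.trans (R.reflexive (cong (pow (ι (suc c))) (trans e (ℕ.*-comm t (suc q)))))
      (R.trans (R.sym (pow-pow (ι (suc c)) (suc q) t)) (R.trans (pow-cong t (ι-order-p-1 c c<p)) (pow-one t)))

-- Euler's theorem for Defs.φ

-- Unification recovers the counting function local to φ.  The impossible
-- hypothesis reduces the with-clause so that both its arguments become
-- variables.
yes-unique : ∀ {m n : ℕ} (d : Dec (m ≡ n)) (e : m ≡ n) → d ≡ yes e
yes-unique (yes e′) e = cong yes (ℕ.≡-irrelevant e′ e)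
yes-unique (no ¬e)  e = contradiction e ¬e

mutual
  totatives : ℕ → ℕ → ℕ
  totatives = _

  φ-unfold : (coprime : ∀ n → gcd (suc n) (suc n) ≡ 1) → ∀ n → φ (suc n) ≡ suc (totatives (suc n) n)
  φ-unfold coprime n with gcd (suc n) (suc n) ℕ.≟ 1 | yes-unique (gcd (suc n) (suc n) ℕ.≟ 1) (coprime n)
  ... | _ | refl with suc n
  ...   | k = refl

totatives-coprime : ∀ k i → gcd (suc i) k ≡ 1 → totatives k (suc i) ≡ suc (totatives k i)
totatives-coprime k i e with gcd (suc i) k ℕ.≟ 1
... | yes _ = refl
... | no ¬e = contradiction e ¬e

-- Multiplication by `a` permutes the units modulo k, so their product P satisfies a ^ φ(k) P ≡ P,
-- and P is coprime to k. Nonunits are replaced by 1 so that the products run over all residues and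
-- the permutation is one of `Fin k`.
module ModularUnits (k : ℕ) .{{_ : ℕ.NonZero k}} (a : ℕ) .{{_ : ℕ.NonZero a}} (a⊥k : Coprime a k) where
  module Prod = Algebra.Properties.CommutativeMonoid.Sum ℕ.*-1-commutativeMonoid
  open ≡-Reasoning

  infix 4 _≋_
  _≋_ : ℕ → ℕ → Set
  x ≋ y = x % k ≡ y % k

  ≋-* : ∀ {x x′ y y′} → x ≋ x′ → y ≋ y′ → x * y ≋ x′ * y′
  ≋-* {x} {x′} {y} {y′} e e′ = trans (%-distribˡ-* x y k)
    (trans (cong₂ (λ u v → (u * v) % k) e e′) (sym (%-distribˡ-* x′ y′ k)))

  ≋-∸ : ∀ x y → x ≋ y → k ∣ x ∸ y
  ≋-∸ x y e = ℕ.divides (x / k ∸ y / k) (begin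
    x ∸ y                                          ≡⟨ cong₂ _∸_ (m≡m%n+[m/n]*n x k) (m≡m%n+[m/n]*n y k) ⟩
    (x % k + x / k * k) ∸ (y % k + y / k * k)      ≡⟨ cong (λ r → (r + x / k * k) ∸ (y % k + y / k * k)) e ⟩
    (y % k + x / k * k) ∸ (y % k + y / k * k)      ≡⟨ ℕ.[m+n]∸[m+o]≡n∸o (y % k) _ _ ⟩
    x / k * k ∸ y / k * k                          ≡⟨ ℕ.*-distribʳ-∸ k (x / k) (y / k) ⟨
    (x / k ∸ y / k) * k                            ∎)

  modular-inverse : ∃ λ b → b * a ≋ 1
  modular-inverse = case coprime-Bézout a⊥k of λ where
      (Bézout.+- x y e) → x , trans (cong (_% k) (sym e)) ([m+kn]%n≡m%n 1 y k)
      -- This form of Bézout's identity says x a ≡ -1. Without negative numbers the inverse -x is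
      -- written x (x a), since (x a)² ≡ 1.
      (Bézout.-+ x y e) → x * (x * a) , (begin
        (x * (x * a) * a) % k                        ≡⟨ [m+kn]%n≡m%n (x * (x * a) * a) (2 * y) k ⟨
        (x * (x * a) * a + 2 * y * k) % k            ≡⟨ cong (_% k) (square x y e) ⟩
        (1 + y * (1 + x * a) * k) % k                ≡⟨ [m+kn]%n≡m%n 1 (y * (1 + x * a)) k ⟩
        1 % k                                        ∎)
    where
    id₀ : ∀ x a → x * (x * a) * a + 2 * (1 + x * a) ≡ 1 + (1 + x * a) * (1 + x * a)
    id₀ = ℕSolver.solve-∀
    id₁ : ∀ y k u → y * k * u ≡ y * u * k
    id₁ = ℕSolver.solve-∀
    square : ∀ x y → 1 + x * a ≡ y * k → x * (x * a) * a + 2 * y * k ≡ 1 + y * (1 + x * a) * k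
    square x y e = begin
      x * (x * a) * a + 2 * y * k         ≡⟨ cong (_+_ (x * (x * a) * a)) (trans (ℕ.*-assoc 2 y k) (cong (2 *_) (sym e))) ⟩
      x * (x * a) * a + 2 * (1 + x * a)   ≡⟨ id₀ x a ⟩
      1 + (1 + x * a) * (1 + x * a)       ≡⟨ cong (λ u → 1 + u * (1 + x * a)) e ⟩
      1 + y * k * (1 + x * a)             ≡⟨ cong suc (id₁ y k (1 + x * a)) ⟩
      1 + y * (1 + x * a) * k             ∎

  b = proj₁ modular-inverse

  toℕ-mod : ∀ m → toℕ (m mod k) ≡ m % k
  toℕ-mod m = Fin.toℕ-fromℕ< (m%n<n m k)

  undo : ∀ x y → x * y ≋ 1 → ∀ (i : Fin k) → (x * toℕ ((y * toℕ i) mod k)) mod k ≡ i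
  undo x y xy≋1 i = Fin.toℕ-injective (begin
    toℕ ((x * toℕ ((y * toℕ i) mod k)) mod k)    ≡⟨ toℕ-mod _ ⟩
    (x * toℕ ((y * toℕ i) mod k)) % k            ≡⟨ cong (λ m → (x * m) % k) (toℕ-mod _) ⟩
    (x * ((y * toℕ i) % k)) % k                  ≡⟨ ≋-* {x} refl (m%n%n≡m%n (y * toℕ i) k) ⟩
    (x * (y * toℕ i)) % k                        ≡⟨ cong (_% k) (ℕ.*-assoc x y (toℕ i)) ⟨
    (x * y * toℕ i) % k                          ≡⟨ ≋-* {x * y} xy≋1 refl ⟩
    (1 * toℕ i) % k                              ≡⟨ cong (_% k) (ℕ.*-identityˡ (toℕ i)) ⟩
    toℕ i % k                                    ≡⟨ m<n⇒m%n≡m (Fin.toℕ<n i) ⟩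
    toℕ i                                        ∎)

  multiply : Permutation′ k
  multiply = permutation (λ i → (a * toℕ i) mod k) (λ i → (b * toℕ i) mod k)
    (undo a b (trans (cong (_% k) (ℕ.*-comm a b)) (proj₂ modular-inverse)))
    (undo b a (proj₂ modular-inverse))

  unit-part : (ℕ → ℕ) → ℕ → ℕ
  unit-part f i with gcd i k ℕ.≟ 1
  ... | yes _ = f i
  ... | no _  = 1

  unit-part-unit : ∀ f i → gcd i k ≡ 1 → unit-part f i ≡ f i
  unit-part-unit f i e with gcd i k ℕ.≟ 1
  ... | yes _ = refl
  ... | no ¬e = contradiction e ¬e

  unit-part-nonunit : ∀ f i → gcd i k ≢ 1 → unit-part f i ≡ 1
  unit-part-nonunit f i ¬e with gcd i k ℕ.≟ 1
  ... | yes e = contradiction e ¬e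
  ... | no _  = refl

  multiply-unit : ∀ i → gcd i k ≡ 1 → gcd ((a * i) % k) k ≡ 1
  multiply-unit i e = coprime⇒gcd≡1 λ {d} (d∣r , d∣k) → gcd≡1⇒coprime e
    ( coprime-divisor (λ (c∣d , c∣a) → a⊥k (c∣a , ℕ.∣-trans c∣d d∣k)) (ℕ.∣n∣m%n⇒∣m d∣k d∣r)
    , d∣k)

  multiply-nonunit : ∀ i → gcd ((a * i) % k) k ≡ 1 → gcd i k ≡ 1
  multiply-nonunit i e = coprime⇒gcd≡1 λ (d∣i , d∣k) → gcd≡1⇒coprime e
    (ℕ.%-presˡ-∣ (ℕ.∣n⇒∣m*n a d∣i) d∣k , d∣k)

  id′ : ℕ → ℕ
  id′ i = i

  units : ℕ
  units = Prod.sum {k} (λ i → unit-part id′ (toℕ i))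

  unit-step : ∀ i → unit-part id′ ((a * i) % k) ≋ unit-part (const a) i * unit-part id′ i
  unit-step i with gcd i k ℕ.≟ 1
  ... | yes e = trans (cong (_% k) (unit-part-unit id′ ((a * i) % k) (multiply-unit i e))) (m%n%n≡m%n (a * i) k)
  ... | no ¬e = cong (_% k) (unit-part-nonunit id′ ((a * i) % k) (¬e ∘ multiply-nonunit i))

  product-≋ : ∀ n (f g : Fin n → ℕ) → (∀ i → f i ≋ g i) → Prod.sum f ≋ Prod.sum g
  product-≋ zero    f g e = refl
  product-≋ (suc n) f g e = ≋-* {f Fin.zero} (e Fin.zero) (product-≋ n (f ∘ Fin.suc) (g ∘ Fin.suc) (e ∘ Fin.suc))

  units-absorb : Prod.sum {k} (λ i → unit-part (const a) (toℕ i)) * units ≋ units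
  units-absorb = begin
    (Prod.sum {k} (λ i → unit-part (const a) (toℕ i)) * units) % k
      ≡⟨ cong (_% k) (Prod.∑-distrib-+ {k} (λ i → unit-part (const a) (toℕ i)) (λ i → unit-part id′ (toℕ i))) ⟨
    Prod.sum {k} (λ i → unit-part (const a) (toℕ i) * unit-part id′ (toℕ i)) % k
      ≡⟨ product-≋ k _ _ (λ i → sym (trans (cong (λ m → unit-part id′ m % k) (toℕ-mod (a * toℕ i))) (unit-step (toℕ i)))) ⟩
    Prod.sum {k} (λ i → unit-part id′ (toℕ (multiply ⟨$⟩ʳ i))) % k
      ≡⟨ cong (_% k) (Prod.sum-permute (λ i → unit-part id′ (toℕ i)) multiply) ⟨
    units % k ∎

  coprime-* : ∀ {x y} → Coprime k x → Coprime k y → Coprime k (x * y)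
  coprime-* k⊥x k⊥y (d∣k , d∣xy) = k⊥y (d∣k , coprime-divisor (λ (c∣d , c∣x) → k⊥x (ℕ.∣-trans c∣d d∣k , c∣x)) d∣xy)

  coprime-product : ∀ n (f : Fin n → ℕ) → (∀ i → Coprime k (f i)) → Coprime k (Prod.sum f)
  coprime-product zero    f c (_ , d∣1) = ℕ.∣1⇒≡1 d∣1
  coprime-product (suc n) f c = coprime-* (c Fin.zero) (coprime-product n (f ∘ Fin.suc) (c ∘ Fin.suc))

  coprime-unit-part : ∀ i → Coprime k (unit-part id′ i)
  coprime-unit-part i with gcd i k ℕ.≟ 1
  ... | yes e = coprime-sym (gcd≡1⇒coprime e)
  ... | no _  = λ (_ , d∣1) → ℕ.∣1⇒≡1 d∣1

  totatives-step : ∀ i → a ^ totatives k (suc i) ≡ a ^ totatives k i * unit-part (const a) (suc i)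
  totatives-step i with gcd (suc i) k ℕ.≟ 1
  ... | yes _ = ℕ.*-comm a _
  ... | no _  = sym (ℕ.*-identityʳ _)

  -- The residues are indexed from 0 and φ counts from 1; 0 and k agree.
  count-units : ∀ n → Prod.sum {suc n} (λ i → unit-part (const a) (toℕ i)) ≡ unit-part (const a) 0 * a ^ totatives k n
  count-units zero    = refl
  count-units (suc n) = begin
    Prod.sum {suc (suc n)} f                                   ≡⟨ Prod.sum-init-last f ⟩
    Prod.sum {suc n} (f ∘ inject₁) * f (Fin.fromℕ (suc n))     ≡⟨ cong₂ _*_ (Prod.sum-cong-≗ {suc n} (λ i → cong (unit-part (const a)) (Fin.toℕ-inject₁ i)))
                                                                           (cong (unit-part (const a)) (Fin.toℕ-fromℕ (suc n))) ⟩
    Prod.sum {suc n} (λ i → unit-part (const a) (toℕ i)) * unit-part (const a) (suc n)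
      ≡⟨ cong (_* unit-part (const a) (suc n)) (count-units n) ⟩
    unit-part (const a) 0 * a ^ totatives k n * unit-part (const a) (suc n)
      ≡⟨ ℕ.*-assoc (unit-part (const a) 0) _ _ ⟩
    unit-part (const a) 0 * (a ^ totatives k n * unit-part (const a) (suc n))
      ≡⟨ cong (unit-part (const a) 0 *_) (totatives-step n) ⟨
    unit-part (const a) 0 * a ^ totatives k (suc n) ∎
    where
    f : Fin (suc (suc n)) → ℕ
    f i = unit-part (const a) (toℕ i)

unit-part-self : ∀ k .{{_ : ℕ.NonZero k}} a .{{_ : ℕ.NonZero a}} (a⊥k : Coprime a k) →
  let open ModularUnits k a a⊥k in unit-part (const a) 0 ≡ unit-part (const a) k
unit-part-self k a a⊥k = cases (gcd k k ℕ.≟ 1)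
  where
  open ModularUnits k a a⊥k
  gcd-self : gcd k k ≡ gcd 0 k
  gcd-self = ℕ.∣-antisym (gcd-greatest (gcd k k ℕ.∣0) (gcd[m,n]∣n k k)) (gcd-greatest (gcd[m,n]∣n 0 k) (gcd[m,n]∣n 0 k))
  cases : Dec (gcd k k ≡ 1) → unit-part (const a) 0 ≡ unit-part (const a) k
  cases (yes e) = trans (unit-part-unit (const a) 0 (trans (sym gcd-self) e)) (sym (unit-part-unit (const a) k e))
  cases (no ¬e) = trans (unit-part-nonunit (const a) 0 (¬e ∘ trans gcd-self)) (sym (unit-part-nonunit (const a) k ¬e))

-- The congruence a ^ φ(k) P ≡ P makes k divide P (a ^ φ(k) - 1), and P can be cancelled because it
-- is coprime to k.
euler : ∀ k .{{_ : ℕ.NonZero k}} a .{{_ : ℕ.NonZero a}} → Coprime a k → k ∣ a ^ φ k ∸ 1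
euler k@(suc n) a a⊥k = coprime-divisor (coprime-product k (λ i → unit-part id′ (toℕ i)) (coprime-unit-part ∘ toℕ))
  (subst (k ∣_) (begin
    a ^ φ k * units ∸ units              ≡⟨ cong (_∸_ (a ^ φ k * units)) (ℕ.*-identityˡ units) ⟨
    a ^ φ k * units ∸ 1 * units          ≡⟨ ℕ.*-distribʳ-∸ units (a ^ φ k) 1 ⟨
    (a ^ φ k ∸ 1) * units                ≡⟨ ℕ.*-comm (a ^ φ k ∸ 1) units ⟩
    units * (a ^ φ k ∸ 1)                ∎)
    (≋-∸ (a ^ φ k * units) units (trans (cong (λ m → (m * units) % k) (sym count)) units-absorb)))
  where
  open ModularUnits k a a⊥k
  open ≡-Reasoning
  count : Prod.sum {k} (λ i → unit-part (const a) (toℕ i)) ≡ a ^ φ k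
  count = begin
    Prod.sum {k} (λ i → unit-part (const a) (toℕ i))      ≡⟨ count-units n ⟩
    unit-part (const a) 0 * a ^ totatives k n             ≡⟨ cong (_* a ^ totatives k n) (unit-part-self k a a⊥k) ⟩
    unit-part (const a) k * a ^ totatives k n             ≡⟨ ℕ.*-comm (unit-part (const a) k) _ ⟩
    a ^ totatives k n * unit-part (const a) k             ≡⟨ totatives-step n ⟨
    a ^ totatives k k                                     ∎

φ-prime : ∀ p → Prime p → φ p ≡ p ∸ 1
φ-prime 0 p-prime = refl
φ-prime p@(suc n) p-prime = trans last (below n ℕ.≤-refl)
  where
  below : ∀ i → i ≤ n → totatives p i ≡ i
  below zero    i≤n = refl
  below (suc i) i<n = trans (totatives-coprime p i (coprime⇒gcd≡1 (coprime-sym (prime⇒coprime p-prime (ℕ.s≤s i<n)))))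
    (cong suc (below i (ℕ.<⇒≤ i<n)))
  gcd-self : gcd p p ≢ 1
  gcd-self e = ℕ.nonTrivial⇒≢1 {{prime⇒nonTrivial p-prime}}
    (ℕ.∣1⇒≡1 (subst (p ∣_) e (gcd-greatest ℕ.∣-refl ℕ.∣-refl)))
  last : totatives p p ≡ totatives p n
  last with gcd p p ℕ.≟ 1
  ... | yes e = contradiction e gcd-self
  ... | no _  = refl

positive-power : ∀ x .{{_ : ℕ.NonZero x}} n → x ^ n ≡ suc (x ^ n ∸ 1)
positive-power x n = sym (ℕ.m+[n∸m]≡n (ℕ.m^n>0 x n))

fermat : ∀ p → Prime p → ∀ c .{{_ : ℕ.NonZero c}} → c < p → ∃ λ m → c ^ (p ∸ 1) ≡ suc (m * p)
fermat p p-prime c c<p =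
  let instance p-nonZero : ℕ.NonZero p
               p-nonZero = prime⇒nonZero p-prime
      ℕ.divides m e = euler p c (coprime-sym (prime⇒coprime p-prime c<p))
  in m , trans (cong (c ^_) (sym (φ-prime p p-prime))) (trans (positive-power c (φ p)) (cong suc e))

-- The sequence x ^ n − 1 and its divisors Φ

module PowerMinusOne (x : ℕ) .{{_ : ℕ.NonZero x}} where
  open ≡-Reasoning

  u : ℕ → ℕ
  u n = x ^ n ∸ 1

  u-+ : ∀ m n → u (m + n) ≡ u m + x ^ m * u n
  u-+ m n = ℕ.suc-injective (begin
    suc (u (m + n))              ≡⟨ positive-power x (m + n) ⟨
    x ^ (m + n)                  ≡⟨ ℕ.^-distribˡ-+-* x m n ⟩
    x ^ m * x ^ n                ≡⟨ cong (x ^ m *_) (positive-power x n) ⟩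
    x ^ m * suc (u n)            ≡⟨ ℕ.*-suc (x ^ m) (u n) ⟩
    x ^ m + x ^ m * u n          ≡⟨ cong (_+ x ^ m * u n) (positive-power x m) ⟩
    suc (u m) + x ^ m * u n      ∎)

  u-∣ : ∀ {m n} → m ∣ n → u m ∣ u n
  u-∣ {m} (ℕ.divides q refl) = multiple q
    where
    multiple : ∀ q → u m ∣ u (q * m)
    multiple zero    = u m ℕ.∣0
    multiple (suc q) = subst (u m ∣_) (sym (u-+ m (q * m))) (ℕ.∣m∣n⇒∣m+n ℕ.∣-refl (ℕ.∣n⇒∣m*n (x ^ m) (multiple q)))

  -- Bézout gives multiples a, b of the two exponents with g + a = b for the gcd g, and u (g + a) =
  -- u g + x ^ g u a allows the term in u a to be subtracted.
  u-gcd : ∀ {c m n} → c ∣ u m → c ∣ u n → c ∣ u (gcd m n)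
  u-gcd {c} {m} {n} c∣m c∣n = case Bézout.identity (gcd-GCD m n) of λ where
      (Bézout.+- y z e) → difference (gcd m n) (z * n) (y * m) e (multiple n z c∣n) (multiple m y c∣m)
      (Bézout.-+ y z e) → difference (gcd m n) (y * m) (z * n) e (multiple m y c∣m) (multiple n z c∣n)
    where
    multiple : ∀ m y → c ∣ u m → c ∣ u (y * m)
    multiple m y c∣um = ℕ.∣-trans c∣um (u-∣ (ℕ.n∣m*n y))
    difference : ∀ g a b → g + a ≡ b → c ∣ u a → c ∣ u b → c ∣ u g
    difference g a b refl c∣ua c∣ub = ℕ.∣m+n∣m⇒∣n
      (subst (c ∣_) (trans (u-+ g a) (ℕ.+-comm (u g) _)) c∣ub) (ℕ.∣n⇒∣m*n (x ^ g) c∣ua)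

  -- The coefficient of x − 1 in x ^ n − 1 is n modulo x − 1.
  u-linear : ∀ n → ∃ λ w → u n ≡ u 1 * (n + u 1 * w)
  u-linear zero    = 0 , sym (trans (cong (u 1 *_) (ℕ.*-zeroʳ (u 1))) (ℕ.*-zeroʳ (u 1)))
  u-linear (suc n) = let w , e = u-linear n in w + n + u 1 * w , (begin
    u (1 + n)                                              ≡⟨ u-+ 1 n ⟩
    u 1 + x ^ 1 * u n                                      ≡⟨ cong₂ (λ y z → u 1 + y * z) (positive-power x 1) e ⟩
    u 1 + suc (u 1) * (u 1 * (n + u 1 * w))                ≡⟨ ident (u 1) n w ⟩
    u 1 * (suc n + u 1 * (w + n + u 1 * w))                ∎)
    where
    ident : ∀ v n w → v + suc v * (v * (n + v * w)) ≡ v * (suc n + v * (w + n + v * w))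
    ident = ℕSolver.solve-∀

-- Distributivity of the divisor lattice. With g the gcd of the two gcds, it suffices that g w
-- divides gcd x w · gcd y w, and it divides each of the products x y, x w, w y and w w.
∣lcm⇒∣lcm-gcd : ∀ w x y .{{_ : ℕ.NonZero w}} → w ∣ lcm x y → w ∣ lcm (gcd x w) (gcd y w)
∣lcm⇒∣lcm-gcd w x y w∣lcm = ℕ.*-cancelˡ-∣ g {{ℕ.≢-nonZero g≢0}}
  (subst (g * w ∣_) (sym (gcd*lcm (gcd x w) (gcd y w))) (subst (g * w ∣_) (trans expand (ℕ.*-comm (gcd y w) (gcd x w))) product))
  where
  g = gcd (gcd x w) (gcd y w)
  g≢0 : g ≢ 0
  g≢0 e = gcd[m,n]≢0 x w (inj₂ (ℕ.≢-nonZero⁻¹ w)) (ℕ.0∣⇒≡0 (subst (_∣ gcd x w) e (gcd[m,n]∣m (gcd x w) (gcd y w))))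
  g∣x : g ∣ x
  g∣x = ℕ.∣-trans (gcd[m,n]∣m (gcd x w) (gcd y w)) (gcd[m,n]∣m x w)
  g∣y : g ∣ y
  g∣y = ℕ.∣-trans (gcd[m,n]∣n (gcd x w) (gcd y w)) (gcd[m,n]∣m y w)
  g∣w : g ∣ w
  g∣w = ℕ.∣-trans (gcd[m,n]∣n (gcd x w) (gcd y w)) (gcd[m,n]∣n y w)
  into : ∀ z → g * w ∣ z * y → g * w ∣ z * w → g * w ∣ z * gcd y w
  into z d e = subst (g * w ∣_) (sym (c*gcd[m,n]≡gcd[cm,cn] z y w)) (gcd-greatest d e)
  gw∣xy : g * w ∣ x * y
  gw∣xy = subst (g * w ∣_) (gcd*lcm x y) (ℕ.*-pres-∣ (gcd-greatest g∣x g∣y) w∣lcm)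
  gw∣wy : g * w ∣ w * y
  gw∣wy = subst (g * w ∣_) (ℕ.*-comm y w) (ℕ.*-pres-∣ g∣y ℕ.∣-refl)
  expand : gcd (gcd y w * x) (gcd y w * w) ≡ gcd y w * gcd x w
  expand = sym (c*gcd[m,n]≡gcd[cm,cn] (gcd y w) x w)
  product : g * w ∣ gcd (gcd y w * x) (gcd y w * w)
  product = gcd-greatest
    (subst (g * w ∣_) (ℕ.*-comm x (gcd y w)) (into x gw∣xy (ℕ.*-pres-∣ g∣x ℕ.∣-refl)))
    (subst (g * w ∣_) (ℕ.*-comm w (gcd y w)) (into w gw∣wy (ℕ.*-pres-∣ g∣w ℕ.∣-refl)))

-- Unification recovers the private product over proper divisors.
mutual
  divisorProd : ℕ → List ℕ → ℕ
  divisorProd = _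

  private
    divisorProd′ : ℕ → List ℕ → ℕ
    divisorProd′ d []        = 1
    divisorProd′ d (v ∷ tbl) with suc (length tbl) ℕ.∣? d
    ... | yes _ = v * divisorProd d tbl
    ... | no  _ = divisorProd d tbl

    cycTable-unfold : ∀ x n → cycTable x (suc n) ≡
      ((x ^ suc n ∸ 1) div divisorProd′ (suc n) (cycTable x n)) ∷ cycTable x n
    cycTable-unfold x n with cycTable x n | x ^ suc n ∸ 1 | suc n
    ... | []      | _ | d = refl
    ... | v ∷ tbl | _ | d with suc (length tbl) ℕ.∣? d
    ...   | yes _ = refl
    ...   | no  _ = refl

divisorProd-divisor : ∀ d v tbl → suc (length tbl) ∣ d → divisorProd d (v ∷ tbl) ≡ v * divisorProd d tbl
divisorProd-divisor d v tbl n∣d with suc (length tbl) ℕ.∣? d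
... | yes _ = refl
... | no ¬d = contradiction n∣d ¬d

divisorProd-nondivisor : ∀ d v tbl → ¬ suc (length tbl) ∣ d → divisorProd d (v ∷ tbl) ≡ divisorProd d tbl
divisorProd-nondivisor d v tbl n∤d with suc (length tbl) ℕ.∣? d
... | yes n∣d = contradiction n∣d n∤d
... | no _    = refl

div-exact : ∀ m n → n ≢ 0 → n ∣ m → (m div n) * n ≡ m
div-exact m zero    n≢0 n∣m = contradiction refl n≢0
div-exact m (suc n) n≢0 (ℕ.divides q refl) = cong (_* suc n) (m*n/n≡m q (suc n))

-- The product of Φ_e(x) over the e ∣ d with e ≤ m is the least common multiple
-- of the x ^ e − 1, because gcd (x ^ e − 1) (x ^ n − 1) = x ^ gcd e n − 1.
module Cyclotomic (x : ℕ) (2≤x : 2 ≤ x) where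
  instance
    x-nonZero : ℕ.NonZero x
    x-nonZero = ℕ.>-nonZero (ℕ.≤-trans (ℕ.s≤s ℕ.z≤n) 2≤x)
  open PowerMinusOne x
  open ≡-Reasoning

  u-nonzero : ∀ n → u (suc n) ≢ 0
  u-nonzero n e = ℕ.<⇒≢ (ℕ.≤-trans 2≤x (ℕ.≤-trans (ℕ.≤-reflexive (sym (ℕ.*-identityʳ x))) (ℕ.*-monoʳ-≤ x (ℕ.m^n>0 x n))))
    (sym (trans (positive-power x (suc n)) (cong suc e)))

  divisorLcm : ℕ → ℕ → ℕ
  divisorLcm d zero    = 1
  divisorLcm d (suc m) with suc m ℕ.∣? d
  ... | yes _ = lcm (divisorLcm d m) (u (suc m))
  ... | no  _ = divisorLcm d m

  divisorLcm-upper : ∀ d m {e} → suc e ≤ m → suc e ∣ d → u (suc e) ∣ divisorLcm d m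
  divisorLcm-upper d (suc m) {e} e≤m e∣d with suc m ℕ.∣? d | ℕ.m≤n⇒m<n∨m≡n e≤m
  ... | yes _ | inj₁ (ℕ.s≤s lt) = ℕ.∣-trans (divisorLcm-upper d m lt e∣d) (m∣lcm[m,n] (divisorLcm d m) (u (suc m)))
  ... | yes _ | inj₂ refl       = n∣lcm[m,n] (divisorLcm d m) (u (suc m))
  ... | no _  | inj₁ (ℕ.s≤s lt) = divisorLcm-upper d m lt e∣d
  ... | no ¬d | inj₂ refl       = contradiction e∣d ¬d

  divisorLcm-least : ∀ d m c → (∀ e → suc e ≤ m → suc e ∣ d → u (suc e) ∣ c) → divisorLcm d m ∣ c
  divisorLcm-least d zero    c upper = ℕ.1∣ c
  divisorLcm-least d (suc m) c upper with suc m ℕ.∣? d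
  ... | yes m∣d = lcm-least (divisorLcm-least d m c λ e le → upper e (ℕ.m≤n⇒m≤1+n le)) (upper m ℕ.≤-refl m∣d)
  ... | no _    = divisorLcm-least d m c λ e le → upper e (ℕ.m≤n⇒m≤1+n le)

  divisorLcm-∣u : ∀ n m → divisorLcm n m ∣ u n
  divisorLcm-∣u n m = divisorLcm-least n m (u n) λ e _ → u-∣

  divisorLcm-nonzero : ∀ n m → divisorLcm (suc n) m ≢ 0
  divisorLcm-nonzero n m e = u-nonzero n (ℕ.0∣⇒≡0 (subst (_∣ u (suc n)) e (divisorLcm-∣u (suc n) m)))

  -- Distributivity splits `c` along the lcm. The part dividing u (m′ + 1) also divides u (m + 1),
  -- hence u at the gcd of the two indices, which is a divisor of m + 1 not exceeding m. The lemma
  -- is stated for every `c` because the induction is applied to the other part.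
  divisorLcm-gcd : ∀ d m m′ → m′ ≤ m → ∀ c .{{_ : ℕ.NonZero c}} → c ∣ divisorLcm d m′ → c ∣ u (suc m) →
                   c ∣ divisorLcm (suc m) m
  divisorLcm-gcd d m zero     m′≤m c c∣L c∣u = ℕ.∣-trans c∣L (ℕ.1∣ _)
  divisorLcm-gcd d m (suc m′) m′<m c c∣L c∣u with suc m′ ℕ.∣? d
  ... | no _  = divisorLcm-gcd d m m′ (ℕ.<⇒≤ m′<m) c c∣L c∣u
  ... | yes _ = ℕ.∣-trans (∣lcm⇒∣lcm-gcd c (divisorLcm d m′) (u (suc m′)) c∣L) (lcm-least
    (divisorLcm-gcd d m m′ (ℕ.<⇒≤ m′<m) (gcd (divisorLcm d m′) c) {{gcd-nonZero (divisorLcm d m′)}}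
      (gcd[m,n]∣m (divisorLcm d m′) c) (ℕ.∣-trans (gcd[m,n]∣n (divisorLcm d m′) c) c∣u))
    (ℕ.∣-trans
      (u-gcd {m = suc m′} {n = suc m} (gcd[m,n]∣m (u (suc m′)) c) (ℕ.∣-trans (gcd[m,n]∣n (u (suc m′)) c) c∣u))
      (below (gcd (suc m′) (suc m)) refl)))
    where
    gcd-nonZero : ∀ y → ℕ.NonZero (gcd y c)
    gcd-nonZero y = ℕ.≢-nonZero (gcd[m,n]≢0 y c (inj₂ (ℕ.≢-nonZero⁻¹ c)))
    below : ∀ g → gcd (suc m′) (suc m) ≡ g → u g ∣ divisorLcm (suc m) m
    below zero    e = contradiction e (gcd[m,n]≢0 (suc m′) (suc m) (inj₁ λ ()))
    below (suc g) e = divisorLcm-upper (suc m) m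
      (ℕ.≤-trans (ℕ.∣⇒≤ (subst (_∣ suc m′) e (gcd[m,n]∣m (suc m′) (suc m)))) m′<m)
      (subst (_∣ suc m) e (gcd[m,n]∣n (suc m′) (suc m)))

  cycTable-length : ∀ m → length (cycTable x m) ≡ m
  cycTable-length zero    = refl
  cycTable-length (suc m) = cong suc (cycTable-length m)

  -- The two lemmas go together: the division defining Φ_{m+1} is exact once its denominator is
  -- known to be the lcm L′ for m + 1, and Φ_{m+1} L′ = u (m + 1) with gcd L (u (m + 1)) = L′ says
  -- that multiplying L by Φ_{m+1} gives the next lcm.
  divisorProd-lcm : ∀ m d → divisorProd d (cycTable x m) ≡ divisorLcm d m
  cyclotomic-* : ∀ m → cyclotomicAt (suc m) x * divisorLcm (suc m) m ≡ u (suc m)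

  cyclotomic-* m = begin
    (u (suc m) div divisorProd (suc m) (cycTable x m)) * divisorLcm (suc m) m
      ≡⟨ cong (λ l → (u (suc m) div l) * divisorLcm (suc m) m) (divisorProd-lcm m (suc m)) ⟩
    (u (suc m) div divisorLcm (suc m) m) * divisorLcm (suc m) m
      ≡⟨ div-exact (u (suc m)) (divisorLcm (suc m) m) (divisorLcm-nonzero m m) (divisorLcm-∣u (suc m) m) ⟩
    u (suc m) ∎

  divisorProd-lcm zero    d = refl
  divisorProd-lcm (suc m) d = step (divisorProd-lcm m d) (cyclotomic-* m)
    where
    Φ = cyclotomicAt (suc m) x
    L = divisorLcm d m
    L′ = divisorLcm (suc m) m
    step : divisorProd d (cycTable x m) ≡ L → Φ * L′ ≡ u (suc m) →
           divisorProd d (Φ ∷ cycTable x m) ≡ divisorLcm d (suc m)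
    step ih Φ-spec with suc m ℕ.∣? d
    ... | no m∤d  = trans (divisorProd-nondivisor d Φ (cycTable x m) (m∤d ∘ subst (λ l → suc l ∣ d) (cycTable-length m))) ih
    ... | yes m∣d = trans (divisorProd-divisor d Φ (cycTable x m) (subst (λ l → suc l ∣ d) (sym (cycTable-length m)) m∣d))
      (trans (cong (Φ *_) ih) (ℕ.*-cancelˡ-≡ (Φ * L) (lcm L (u (suc m))) L′ {{ℕ.≢-nonZero (divisorLcm-nonzero m m)}} (begin
      L′ * (Φ * L)                            ≡⟨ ident L′ Φ L ⟩
      L * (Φ * L′)                            ≡⟨ cong (L *_) Φ-spec ⟩
      L * u (suc m)                           ≡⟨ gcd*lcm L (u (suc m)) ⟨
      gcd L (u (suc m)) * lcm L (u (suc m))   ≡⟨ cong (_* lcm L (u (suc m))) gcd≡L′ ⟩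
      L′ * lcm L (u (suc m))                  ∎)))
      where
      ident : ∀ a b c → a * (b * c) ≡ c * (b * a)
      ident = ℕSolver.solve-∀
      gcd≡L′ : gcd L (u (suc m)) ≡ L′
      gcd≡L′ = ℕ.∣-antisym
        (divisorLcm-gcd d m m ℕ.≤-refl (gcd L (u (suc m)))
          {{ℕ.≢-nonZero (gcd[m,n]≢0 L (u (suc m)) (inj₂ (u-nonzero m)))}}
          (gcd[m,n]∣m L (u (suc m))) (gcd[m,n]∣n L (u (suc m))))
        (gcd-greatest
          (divisorLcm-least (suc m) m L λ e le e∣m → divisorLcm-upper d m le (ℕ.∣-trans e∣m m∣d))
          (divisorLcm-∣u (suc m) m))

  -- For d > 1 the index 1 is a proper divisor of d, so x - 1 divides the lcm that is the
  -- complementary factor of Φ_d(x) in x ^ d - 1.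
  cyclotomic-∣ : ∀ d → d > 1 → cyclotomicAt d x * (x ∸ 1) ∣ x ^ d ∸ 1
  cyclotomic-∣ (suc m@(suc _)) d>1 = subst (cyclotomicAt (suc m) x * (x ∸ 1) ∣_) (cyclotomic-* m)
    (ℕ.*-monoʳ-∣ (cyclotomicAt (suc m) x) (subst (λ y → y ∸ 1 ∣ divisorLcm (suc m) m) (ℕ.*-identityʳ x)
      (divisorLcm-upper (suc m) m (ℕ.s≤s ℕ.z≤n) (ℕ.1∣ suc m))))
  cyclotomic-∣ (suc zero) (ℕ.s≤s ())

-- From the divisibility condition to the four families

paleyIntegral-from-divisibility : ∀ p e k → Prime p → ∀ a t →
  k * (p ∸ 1) ∣ (p ^ e) ^ t ∸ 1 → PaleyIntegral (paleyExp k (p ^ e) t a) ((p ^ e) ^ (a * t))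
paleyIntegral-from-divisibility p e k p-prime a t (ℕ.divides w s≡) = cases (s ℕ.≟ 0)
  where
  open ≡-Reasoning
  instance
    p-nonZero : ℕ.NonZero p
    p-nonZero = prime⇒nonZero p-prime
    q-nonZero : ℕ.NonZero (p ^ e)
    q-nonZero = ℕ.m^n≢0 p e
    qᵗ-nonZero : ℕ.NonZero ((p ^ e) ^ t)
    qᵗ-nonZero = ℕ.m^n≢0 (p ^ e) t
  s = (p ^ e) ^ t ∸ 1
  Q = (p ^ e) ^ (a * t)
  K = paleyExp k (p ^ e) t a
  Q≡ : Q ≡ ((p ^ e) ^ t) ^ a
  Q≡ = trans (cong ((p ^ e) ^_) (ℕ.*-comm a t)) (sym (ℕ.^-*-assoc (p ^ e) t a))
  numerator : (p ^ e) ^ (t * a) ∸ 1 ≡ ((p ^ e) ^ t) ^ a ∸ 1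
  numerator = cong (_∸ 1) (sym (ℕ.^-*-assoc (p ^ e) t a))
  s∣numerator : s ∣ (p ^ e) ^ (t * a) ∸ 1
  s∣numerator = subst (s ∣_) (sym numerator)
    (subst (λ y → y ∸ 1 ∣ ((p ^ e) ^ t) ^ a ∸ 1) (ℕ.*-identityʳ ((p ^ e) ^ t))
      (PowerMinusOne.u-∣ ((p ^ e) ^ t) (ℕ.1∣ a)))
  cases : Dec (s ≡ 0) → PaleyIntegral K Q
  -- Here q ^ t = 1, so `div` returns its default 0; but then Q = 1 as well.
  cases (yes s≡0) F = contradiction (subst FiniteField Q≡1 F) trivial-field
    where
    Q≡1 : Q ≡ 1
    Q≡1 = begin
      Q                      ≡⟨ Q≡ ⟩
      ((p ^ e) ^ t) ^ a      ≡⟨ cong (_^ a) (positive-power (p ^ e) t) ⟩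
      suc s ^ a              ≡⟨ cong (λ r → suc r ^ a) s≡0 ⟩
      1 ^ a                  ≡⟨ ℕ.^-zeroˡ a ⟩
      1                      ∎
  -- With q ^ t - 1 = w k (p - 1) and m = (q ^ (t a) - 1) / (q ^ t - 1), the factorization Q - 1 = K
  -- r has K = k m and r = (p - 1) w.
  cases (no s≢0) = paley-integral p (e * (a * t)) K ((p ∸ 1) * w) p-prime (fermat p p-prime)
    (ℕ.m∣m*n w) (ℕ.^-*-assoc p e (a * t)) (begin
      Q                                             ≡⟨ positive-power (p ^ e) (a * t) ⟩
      suc (Q ∸ 1)                                   ≡⟨ cong (λ y → suc (y ∸ 1)) (trans Q≡ (ℕ.^-*-assoc (p ^ e) t a)) ⟩
      suc ((p ^ e) ^ (t * a) ∸ 1)                   ≡⟨ cong suc (div-exact _ s s≢0 s∣numerator) ⟨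
      suc (m * s)                                   ≡⟨ cong (λ y → suc (m * y)) s≡ ⟩
      suc (m * (w * (k * (p ∸ 1))))                 ≡⟨ cong suc (ident m w k (p ∸ 1)) ⟩
      suc (K * ((p ∸ 1) * w))                       ∎)
    where
    m = ((p ^ e) ^ (t * a) ∸ 1) div s
    ident : ∀ m w k r → m * (w * (k * r)) ≡ k * m * (r * w)
    ident = ℕSolver.solve-∀

theorem5p16 : (p k : ℕ) → Prime p →
    ((k ∣ p ∸ 1) → ∀ a t → 1 ≤ a → 1 ≤ t →
    PaleyIntegral (paleyExp k (p ^ k) t a) ((p ^ k) ^ (a * t)))
    × ((k ∣ p + 1) → ∀ a t → 1 ≤ a → 1 ≤ t →
    PaleyIntegral (paleyExp k (p ^ 2) t a) ((p ^ 2) ^ (a * t)))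
    × (gcd k (p * (p ∸ 1)) ≡ 1 → ∀ a t → 1 ≤ a → 1 ≤ t →
    PaleyIntegral (paleyExp k (p ^ φ k) t a) ((p ^ φ k) ^ (a * t)))
    × (∀ d → d > 1 → ∀ a t → 1 ≤ a → 1 ≤ t →
    PaleyIntegral (paleyExp (cyclotomicAt d p) (p ^ d) t a) ((p ^ d) ^ (a * t)))
theorem5p16 p k p-prime =
    (λ k∣p-1 a t _ _ → paleyIntegral-from-divisibility p k k p-prime a t
      (subst (λ y → k * (p ∸ 1) ∣ y ∸ 1) (sym (ℕ.^-*-assoc p k t)) (linear-case t k∣p-1)))
  , (λ k∣p+1 a t _ _ → from-base 2 k (square-case k∣p+1) a t)
  , (λ coprime a t _ _ → from-base (φ k) k (euler-case coprime) a t)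
  , (λ d d>1 a t _ _ → from-base d (cyclotomicAt d p) (Cyclotomic.cyclotomic-∣ p 2≤p d d>1) a t)
  where
  open ≡-Reasoning
  instance
    p-nonZero : ℕ.NonZero p
    p-nonZero = prime⇒nonZero p-prime
  2≤p : 2 ≤ p
  2≤p = ℕ.nonTrivial⇒n>1 p {{prime⇒nonTrivial p-prime}}
  open PowerMinusOne p

  u-1 : u 1 ≡ p ∸ 1
  u-1 = cong (_∸ 1) (ℕ.*-identityʳ p)

  from-base : ∀ e k → k * (p ∸ 1) ∣ p ^ e ∸ 1 → ∀ a t →
    PaleyIntegral (paleyExp k (p ^ e) t a) ((p ^ e) ^ (a * t))
  from-base e k d a t = paleyIntegral-from-divisibility p e k p-prime a t (ℕ.∣-trans d
    (subst (λ y → p ^ e ∸ 1 ∣ y ∸ 1) (sym (ℕ.^-*-assoc p e t)) (u-∣ {e} {e * t} (ℕ.m∣m*n t))))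

  -- By `u-linear` the quotient (p ^ (k t) - 1) / (p - 1) is k t + (p - 1) w, and k divides both
  -- terms.
  linear-case : ∀ t → k ∣ p ∸ 1 → k * (p ∸ 1) ∣ p ^ (k * t) ∸ 1
  linear-case t k∣p-1 = let w , e = u-linear (k * t) in
    subst (k * (p ∸ 1) ∣_) (sym (trans e (ℕ.*-comm (u 1) _)))
      (ℕ.*-pres-∣ (ℕ.∣m∣n⇒∣m+n (ℕ.m∣m*n t) (ℕ.∣m⇒∣m*n w (subst (k ∣_) (sym u-1) k∣p-1))) (ℕ.∣-reflexive (sym u-1)))

  square-case : k ∣ p + 1 → k * (p ∸ 1) ∣ p ^ 2 ∸ 1
  square-case k∣p+1 = subst (k * (p ∸ 1) ∣_) (sym factor) (ℕ.*-pres-∣ k∣p+1 ℕ.∣-refl)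
    where
    ident : ∀ v → suc v * (suc v * 1) ≡ suc ((suc v + 1) * v)
    ident = ℕSolver.solve-∀
    factor : p ^ 2 ∸ 1 ≡ (p + 1) * (p ∸ 1)
    factor = at (p ∸ 1) (sym (trans (sym (ℕ.*-identityʳ p)) (trans (positive-power p 1) (cong suc u-1))))
      where
      at : ∀ v → suc v ≡ p → p ^ 2 ∸ 1 ≡ (p + 1) * v
      at v refl = cong (_∸ 1) (ident v)

  euler-case : gcd k (p * (p ∸ 1)) ≡ 1 → k * (p ∸ 1) ∣ p ^ φ k ∸ 1
  euler-case coprime = divides-product (euler k {{k-nonZero}} p (coprime-sym λ (d∣k , d∣p) → k⊥ (d∣k , ℕ.∣m⇒∣m*n (p ∸ 1) d∣p)))
    (subst (_∣ u (φ k)) u-1 (u-∣ (ℕ.1∣ φ k)))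
    where
    k⊥ : Coprime k (p * (p ∸ 1))
    k⊥ = gcd≡1⇒coprime coprime
    k-nonZero : ℕ.NonZero k
    -- For k = 0 the prime p would be a common divisor of k and p (p - 1).
    k-nonZero = ℕ.≢-nonZero λ { refl → ℕ.nonTrivial⇒≢1 {{prime⇒nonTrivial p-prime}} (k⊥ (p ℕ.∣0 , ℕ.m∣m*n (p ∸ 1))) }
    -- k is coprime to p - 1, so k divides the cofactor of p - 1 in m.
    divides-product : ∀ {m} → k ∣ m → p ∸ 1 ∣ m → k * (p ∸ 1) ∣ m
    divides-product k∣m (ℕ.divides q refl) = ℕ.*-pres-∣
      (coprime-divisor (λ (d∣k , d∣p-1) → k⊥ (d∣k , ℕ.∣n⇒∣m*n p d∣p-1)) (subst (k ∣_) (ℕ.*-comm q (p ∸ 1)) k∣m)) ℕ.∣-refl
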